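{- Let $G$ be an $n$-vertex (unweighted, undirected) graph with density $c:=|E(G)|/n^2$. Let $0<\varepsilon_0<1$, and suppose $G$ has an $\varepsilon$-regular $k$-partition $\mathcal{P}=(V_1,\dots,V_k)$ with $\frac1k\le\frac{c}{10}\cdot\frac{\varepsilon_0}{1+\varepsilon_0}$ and $\varepsilon\le(1/k)^{8k^2}$. Then $d_{\mathrm{opt}}(G,G_{/\mathcal{P}})\le\varepsilon_0$.
   Context: Graphs (and weighted graphs) are structures over the signature with one binary symbol $e$: for a graph $G$, $w_G(u,v)=e^{G}(u,v)=1$ if $uv\in E(G)$ and $0$ otherwise; for $U,V\subseteq V(G)$, $w_G(U,V)=\sum_{u\in U}\sum_{v\in V}w_G(u,v)$. For such structures, $\mathrm{opt}(G,H)=\max_{h\colon V(G)\to V(H)}\sum_{(u,v)}w_G(u,v)w_H(h(u),h(v))$ (sum over ordered pairs, maximum over all maps), and $d_{\mathrm{opt}}(G,H)=\sup_{C}|\ln\mathrm{opt}(G,C)-\ln\mathrm{opt}(H,C)|$ over all $\mathbb{Q}_{\ge0}$-weighted structures $C$ on this signature ($\ln0=-\infty$, $|\ln0-\ln0|=0$). A bipartite graph $(V_1,V_2,E)$ with density $d=w(V_1,V_2)/(|V_1||V_2|)$ is $\varepsilon$-homogeneous if for all $W_1\subseteq V_1$, $W_2\subseteq V_2$: $|w(W_1,W_2)-d|W_1||W_2||\le\varepsilon|V_1||V_2|$. An $\varepsilon$-regular $k$-partition of an $n$-vertex graph $G$ is a partition $V_1,\dots,V_k$ of $V(G)$ with $|V_i|\in\{\lfloor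 n/k\rfloor,\lceil n/k\rceil\}$ such that for all $i\ne j$ the bipartite graph between $V_i$ and $V_j$ (with the edges of $G$ between them) is $\varepsilon$-homogeneous. The quotient graph $G_{/\mathcal{P}}$ is the weighted graph on vertex set $[k]$ with weights $w_{G_{/\mathcal{P}}}(i,j)=w_G(V_i,V_j)$ for all $(i,j)\in[k]^2$. -}

module Defs where

open import Data.Bool.Base using (Bool; true; false; if_then_else_; _∧_)
open import Data.Fin.Base using (Fin; finToFun)
import Data.Fin.Base as Fin
import Data.Fin.Properties as Fin
open import Data.Fin.Subset using (Subset; _∈_; _⊆_; ∣_∣)
open import Data.Integer.Base using (+_)
import Data.Integer.Base as ℤ
import Data.Integer.Properties as ℤ
open import Data.Nat.Base using (ℕ; zero; suc; NonZero)
import Data.Nat.Base as ℕ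
import Data.Nat.DivMod as ℕ
import Data.Nat.Properties as ℕ
open import Data.Product.Base using (∃; ∃-syntax; _×_; _,_)
open import Data.Rational.Base using (ℚ; mkℚ; 0ℚ; 1ℚ; ½)
import Data.Rational.Base as ℚ
open import Data.Rational.Literals using (fromℤ)
import Data.Rational.Properties as ℚ
open import Data.Rational.Solver using (module +-*-Solver)
open import Data.Sum.Base using (_⊎_; inj₁; inj₂)
import Data.Vec.Base as Vec
open import Data.Vec.Functional using (foldr)
open import Data.Empty using (⊥)
open import Relation.Binary.PropositionalEquality using (_≡_; _≢_; refl; sym; trans; cong; cong₂; subst; module ≡-Reasoning)
open import Relation.Nullary.Decidable.Core using (does; yes; no)

open import Algebra.Bundles using (CommutativeRing)
open import Algebra.Properties.CommutativeMonoid.Sum ℚ.+-0-commutativeMonoid using (sum)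
import Algebra.Properties.CommutativeMonoid.Sum ℕ.+-0-commutativeMonoid as ℕΣ
open import Algebra.Properties.Semiring.Exp (CommutativeRing.semiring ℚ.+-*-commutativeRing) public using (_^_)

fromℕ : ℕ → ℚ
fromℕ m = fromℤ (+ m)

private
  module Ring where
    open +-*-Solver

    swap- : ∀ p q → p ℚ.- q ≡ ℚ.- (q ℚ.- p)
    swap- = solve 2 (λ p q → p :- q := :- (q :- p)) refl

    q+[p-q] : ∀ p q → q ℚ.+ (p ℚ.- q) ≡ p
    q+[p-q] = solve 2 (λ p q → q :+ (p :- q) := p) refl

    [q+r]-q : ∀ q r → (q ℚ.+ r) ℚ.- q ≡ r
    [q+r]-q = solve 2 (λ q r → (q :+ r) :- q := r) refl

    +-diff : ∀ a b c d → (a ℚ.+ b) ℚ.- (c ℚ.+ d) ≡ (a ℚ.- c) ℚ.+ (b ℚ.- d)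
    +-diff = solve 4 (λ a b c d → (a :+ b) :- (c :+ d) := (a :- c) :+ (b :- d)) refl

    neg-diff : ∀ a b → b ℚ.- a ≡ (ℚ.- a) ℚ.- (ℚ.- b)
    neg-diff = solve 2 (λ a b → b :- a := (:- a) :- (:- b)) refl

    *-diff : ∀ a b c d → a ℚ.* b ℚ.- c ℚ.* d ≡ a ℚ.* (b ℚ.- d) ℚ.+ d ℚ.* (a ℚ.- c)
    *-diff = solve 4 (λ a b c d → a :* b :- c :* d := a :* (b :- d) :+ d :* (a :- c)) refl

    c[re] : ∀ c r e → c ℚ.* (r ℚ.* e) ≡ (r ℚ.* c) ℚ.* e
    c[re] = solve 3 (λ c r e → c :* (r :* e) := (r :* c) :* e) refl

    a[bc] : ∀ a b c → a ℚ.* (b ℚ.* c) ≡ b ℚ.* (a ℚ.* c)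
    a[bc] = solve 3 (λ a b c → a :* (b :* c) := b :* (a :* c)) refl

    inv-diff : ∀ a b c d → a ℚ.* (b ℚ.* d) ℚ.- b ℚ.* (a ℚ.* c) ≡ (a ℚ.* b) ℚ.* (d ℚ.- c)
    inv-diff = solve 4 (λ a b c d → a :* (b :* d) :- b :* (a :* c) := (a :* b) :* (d :- c)) refl

    inv-sq : ∀ r d e → (r ℚ.* r) ℚ.* ((d ℚ.* d) ℚ.* e) ≡ (r ℚ.* d) ℚ.* ((r ℚ.* d) ℚ.* e)
    inv-sq = solve 3 (λ r d e → (r :* r) :* ((d :* d) :* e) := (r :* d) :* ((r :* d) :* e)) refl

    geom : ∀ c r a t → (c ℚ.* r) ℚ.* (t ℚ.- a ℚ.* t) ≡ (c ℚ.* t) ℚ.* (r ℚ.* (1ℚ ℚ.- a))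
    geom = solve 4 (λ c r a t → (c :* r) :* (t :- a :* t) := (c :* t) :* (r :* (con 1ℚ :- a))) refl

    vanish : ∀ k t u → (k ℚ.* (t ℚ.- t)) ℚ.* u ≡ 0ℚ
    vanish = solve 3 (λ k t u → (k :* (t :- t)) :* u := con 0ℚ) refl

    [p+t]-q : ∀ p t q → (p ℚ.+ t) ℚ.- q ≡ (p ℚ.- q) ℚ.+ t
    [p+t]-q = solve 3 (λ p t q → (p :+ t) :- q := (p :- q) :+ t) refl

    telescope : ∀ k p q r u → (k ℚ.* (p ℚ.- q)) ℚ.* u ℚ.+ (k ℚ.* (q ℚ.- r)) ℚ.* u ≡ (k ℚ.* (p ℚ.- r)) ℚ.* u
    telescope = solve 5 (λ k p q r u → (k :* (p :- q)) :* u :+ (k :* (q :- r)) :* u := (k :* (p :- r)) :* u) refl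

    [ku][rd] : ∀ k u r d → (k ℚ.* u) ℚ.* (r ℚ.* d) ≡ (k ℚ.* r) ℚ.* (u ℚ.* d)
    [ku][rd] = solve 4 (λ k u r d → (k :* u) :* (r :* d) := (k :* r) :* (u :* d)) refl

    neg-* : ∀ s r → (ℚ.- s) ℚ.* r ≡ ℚ.- (s ℚ.* r)
    neg-* = solve 2 (λ s r → (:- s) :* r := :- (s :* r)) refl

    -q+1 : ∀ q → (ℚ.- q) ℚ.+ 1ℚ ≡ ℚ.- (q ℚ.- 1ℚ)
    -q+1 = solve 1 (λ q → (:- q) :+ con 1ℚ := :- (q :- con 1ℚ)) refl

  0≤∣∣ : ∀ p → 0ℚ ℚ.≤ ℚ.∣ p ∣
  0≤∣∣ p = ℚ.nonNegative⁻¹ ℚ.∣ p ∣ {{ℚ.∣-∣-nonNeg p}}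

  *-mono-≤ : ∀ {p q r s} → 0ℚ ℚ.≤ p → 0ℚ ℚ.≤ r → p ℚ.≤ q → r ℚ.≤ s → p ℚ.* r ℚ.≤ q ℚ.* s
  *-mono-≤ {p} {q} {r} {s} 0≤p 0≤r p≤q r≤s = ℚ.≤-trans
    (ℚ.*-monoʳ-≤-nonNeg r {{ℚ.nonNegative 0≤r}} p≤q)
    (ℚ.*-monoˡ-≤-nonNeg q {{ℚ.nonNegative (ℚ.≤-trans 0≤p p≤q)}} r≤s)

  0≤* : ∀ {p q} → 0ℚ ℚ.≤ p → 0ℚ ℚ.≤ q → 0ℚ ℚ.≤ p ℚ.* q
  0≤* {p} {q} 0≤p 0≤q = *-mono-≤ (ℚ.≤-refl {0ℚ}) (ℚ.≤-refl {0ℚ}) 0≤p 0≤q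

  0<* : ∀ {p q} → 0ℚ ℚ.< p → 0ℚ ℚ.< q → 0ℚ ℚ.< p ℚ.* q
  0<* {p} {q} 0<p 0<q = subst (ℚ._< p ℚ.* q) (ℚ.*-zeroʳ p) (ℚ.*-monoʳ-<-pos p {{ℚ.positive 0<p}} 0<q)

  0≤+ : ∀ {p q} → 0ℚ ℚ.≤ p → 0ℚ ℚ.≤ q → 0ℚ ℚ.≤ p ℚ.+ q
  0≤+ 0≤p 0≤q = ℚ.+-mono-≤ 0≤p 0≤q

  0<1 : 0ℚ ℚ.< 1ℚ
  0<1 = ℚ.positive⁻¹ 1ℚ

  recip : (p : ℚ) → 0ℚ ℚ.< p → ℚ
  recip p 0<p = ℚ.1/_ p {{ℚ.>-nonZero 0<p}}

  recip-inv : ∀ p (0<p : 0ℚ ℚ.< p) → recip p 0<p ℚ.* p ≡ 1ℚ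
  recip-inv p 0<p = ℚ.*-inverseˡ p {{ℚ.>-nonZero 0<p}}

  0<recip : ∀ p (0<p : 0ℚ ℚ.< p) → 0ℚ ℚ.< recip p 0<p
  0<recip p 0<p = ℚ.positive⁻¹ _ {{ℚ.1/pos⇒pos p {{ℚ.positive 0<p}}}}

  ∣∣-sym : ∀ p q → ℚ.∣ p ℚ.- q ∣ ≡ ℚ.∣ q ℚ.- p ∣
  ∣∣-sym p q = trans (cong ℚ.∣_∣ (Ring.swap- p q)) (ℚ.∣-p∣≡∣p∣ (q ℚ.- p))

  ∣∣-lub : ∀ p {q} → p ℚ.≤ q → ℚ.- p ℚ.≤ q → ℚ.∣ p ∣ ℚ.≤ q
  ∣∣-lub p p≤q -p≤q with ℚ.∣p∣≡p∨∣p∣≡-p p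
  ... | inj₁ eq = subst (ℚ._≤ _) (sym eq) p≤q
  ... | inj₂ eq = subst (ℚ._≤ _) (sym eq) -p≤q

  ∣∣-lub-< : ∀ p {q} → p ℚ.< q → ℚ.- p ℚ.< q → ℚ.∣ p ∣ ℚ.< q
  ∣∣-lub-< p p<q -p<q with ℚ.∣p∣≡p∨∣p∣≡-p p
  ... | inj₁ eq = subst (ℚ._< _) (sym eq) p<q
  ... | inj₂ eq = subst (ℚ._< _) (sym eq) -p<q

  ∣p∣≤∣q∣+∣p-q∣ : ∀ p q → ℚ.∣ p ∣ ℚ.≤ ℚ.∣ q ∣ ℚ.+ ℚ.∣ p ℚ.- q ∣
  ∣p∣≤∣q∣+∣p-q∣ p q = subst (λ t → ℚ.∣ t ∣ ℚ.≤ ℚ.∣ q ∣ ℚ.+ ℚ.∣ p ℚ.- q ∣)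
    (Ring.q+[p-q] p q) (ℚ.∣p+q∣≤∣p∣+∣q∣ q (p ℚ.- q))

  shift : ∀ p q r → p ℚ.≤ q ℚ.+ r → p ℚ.- q ℚ.≤ r
  shift p q r h = subst (p ℚ.- q ℚ.≤_) (Ring.[q+r]-q q r) (ℚ.+-monoˡ-≤ (ℚ.- q) h)

  ∣∣-contract : ∀ p q → ℚ.∣ ℚ.∣ p ∣ ℚ.- ℚ.∣ q ∣ ∣ ℚ.≤ ℚ.∣ p ℚ.- q ∣
  ∣∣-contract p q = ∣∣-lub (ℚ.∣ p ∣ ℚ.- ℚ.∣ q ∣)
    (shift _ _ _ (∣p∣≤∣q∣+∣p-q∣ p q))
    (subst (ℚ._≤ ℚ.∣ p ℚ.- q ∣) (Ring.swap- ℚ.∣ q ∣ ℚ.∣ p ∣)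
      (shift _ _ _ (subst (λ t → ℚ.∣ q ∣ ℚ.≤ ℚ.∣ p ∣ ℚ.+ t) (∣∣-sym q p) (∣p∣≤∣q∣+∣p-q∣ q p))))

  ½+½ : ∀ p → ½ ℚ.* p ℚ.+ ½ ℚ.* p ≡ p
  ½+½ p = trans (sym (ℚ.*-distribʳ-+ p ½ ½)) (ℚ.*-identityˡ p)

  0<½* : ∀ {p} → 0ℚ ℚ.< p → 0ℚ ℚ.< ½ ℚ.* p
  0<½* = 0<* (ℚ.positive⁻¹ ½)

  archimedes : ∀ p → p ℚ.≤ fromℕ (ℤ.∣ ℚ.↥ p ∣)
  archimedes (mkℚ (+ zero) d c) = ℚ.*≤* (ℤ.≤-reflexive refl)
  archimedes (mkℚ ℤ.+[1+ a ] d c) = ℚ.*≤* (ℤ.*-monoˡ-≤-nonNeg ℤ.+[1+ a ] (ℤ.+≤+ (ℕ.s≤s ℕ.z≤n)))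
  archimedes (mkℚ ℤ.-[1+ a ] d c) = ℚ.*≤* ℤ.-≤+

  fromℕ-mono : ∀ {m n} → m ℕ.≤ n → fromℕ m ℚ.≤ fromℕ n
  fromℕ-mono m≤n = ℚ.*≤* (ℤ.*-monoʳ-≤-nonNeg (+ 1) (ℤ.+≤+ m≤n))

  0≤fromℕ : ∀ m → 0ℚ ℚ.≤ fromℕ m
  0≤fromℕ m = fromℕ-mono {0} {m} ℕ.z≤n

-- Real numbers as Cauchy sequences of rationals.  Sequences are not
-- identified; the order relations below only depend on the limits.

record ℝ : Set where
  constructor mkℝ
  field
    seq    : ℕ → ℚ
    cauchy : ∀ δ → 0ℚ ℚ.< δ → ∃[ N ] (∀ m n → N ℕ.≤ m → N ℕ.≤ n → ℚ.∣ seq m ℚ.- seq n ∣ ℚ.≤ δ)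

open ℝ public

infix  4 _≤ᴿ_ _<ᴿ_
infixl 6 _+ᴿ_ _-ᴿ_
infixl 7 _*ᴿ_

_≤ᴿ_ : ℝ → ℝ → Set
x ≤ᴿ y = ∀ δ → 0ℚ ℚ.< δ → ∃[ N ] (∀ n → N ℕ.≤ n → seq x n ℚ.≤ seq y n ℚ.+ δ)

_<ᴿ_ : ℝ → ℝ → Set
x <ᴿ y = ∃[ δ ] (0ℚ ℚ.< δ × ∃[ N ] (∀ n → N ℕ.≤ n → seq x n ℚ.+ δ ℚ.≤ seq y n))

fromℚ : ℚ → ℝ
fromℚ q .seq _ = q
fromℚ q .cauchy δ 0<δ = 0 , λ _ _ _ _ →
  subst (λ t → ℚ.∣ t ∣ ℚ.≤ δ) (sym (ℚ.+-inverseʳ q)) (ℚ.<⇒≤ 0<δ)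

0ᴿ 1ᴿ : ℝ
0ᴿ = fromℚ 0ℚ
1ᴿ = fromℚ 1ℚ

_+ᴿ_ : ℝ → ℝ → ℝ
(x +ᴿ y) .seq n = seq x n ℚ.+ seq y n
(x +ᴿ y) .cauchy δ 0<δ with cauchy x (½ ℚ.* δ) (0<½* 0<δ) | cauchy y (½ ℚ.* δ) (0<½* 0<δ)
... | M , hx | N , hy = M ℕ.⊔ N , λ m n ≤m ≤n → begin
    ℚ.∣ (seq x m ℚ.+ seq y m) ℚ.- (seq x n ℚ.+ seq y n) ∣
      ≡⟨ cong ℚ.∣_∣ (Ring.+-diff (seq x m) (seq y m) (seq x n) (seq y n)) ⟩
    ℚ.∣ (seq x m ℚ.- seq x n) ℚ.+ (seq y m ℚ.- seq y n) ∣
      ≤⟨ ℚ.∣p+q∣≤∣p∣+∣q∣ (seq x m ℚ.- seq x n) (seq y m ℚ.- seq y n) ⟩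
    ℚ.∣ seq x m ℚ.- seq x n ∣ ℚ.+ ℚ.∣ seq y m ℚ.- seq y n ∣
      ≤⟨ ℚ.+-mono-≤ (hx m n (ℕ.m⊔n≤o⇒m≤o M N ≤m) (ℕ.m⊔n≤o⇒m≤o M N ≤n)) (hy m n (ℕ.m⊔n≤o⇒n≤o M N ≤m) (ℕ.m⊔n≤o⇒n≤o M N ≤n)) ⟩
    ½ ℚ.* δ ℚ.+ ½ ℚ.* δ
      ≡⟨ ½+½ δ ⟩
    δ ∎
  where open ℚ.≤-Reasoning

-ᴿ_ : ℝ → ℝ
(-ᴿ x) .seq n = ℚ.- seq x n
(-ᴿ x) .cauchy δ 0<δ with cauchy x δ 0<δ
... | N , h = N , λ m n ≤m ≤n →
    subst (ℚ._≤ δ) (trans (∣∣-sym (seq x m) (seq x n)) (cong ℚ.∣_∣ (Ring.neg-diff (seq x m) (seq x n)))) (h m n ≤m ≤n)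

_-ᴿ_ : ℝ → ℝ → ℝ
x -ᴿ y = x +ᴿ (-ᴿ y)

∣_∣ᴿ : ℝ → ℝ
∣ x ∣ᴿ .seq n = ℚ.∣ seq x n ∣
∣ x ∣ᴿ .cauchy δ 0<δ with cauchy x δ 0<δ
... | N , h = N , λ m n ≤m ≤n → ℚ.≤-trans (∣∣-contract (seq x m) (seq x n)) (h m n ≤m ≤n)

private
  bounded : (x : ℝ) → ∃[ B ] (0ℚ ℚ.< B × ∃[ N ] (∀ n → N ℕ.≤ n → ℚ.∣ seq x n ∣ ℚ.≤ B))
  bounded x with cauchy x 1ℚ 0<1
  ... | N , h = ℚ.∣ seq x N ∣ ℚ.+ 1ℚ , ℚ.+-mono-≤-< (0≤∣∣ (seq x N)) 0<1 , N , λ n N≤n →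
    ℚ.≤-trans (∣p∣≤∣q∣+∣p-q∣ (seq x n) (seq x N)) (ℚ.+-monoʳ-≤ ℚ.∣ seq x N ∣ (h n N N≤n ℕ.≤-refl))

private
  cancel : ∀ C (0<C : 0ℚ ℚ.< C) t → C ℚ.* (recip C 0<C ℚ.* t) ≡ t
  cancel C 0<C t = trans (Ring.c[re] C (recip C 0<C) t)
    (trans (cong (ℚ._* t) (recip-inv C 0<C)) (ℚ.*-identityˡ t))

  product-bound : ∀ a b c d {A B s t} → ℚ.∣ a ∣ ℚ.≤ A → ℚ.∣ d ∣ ℚ.≤ B →
    ℚ.∣ b ℚ.- d ∣ ℚ.≤ s → ℚ.∣ a ℚ.- c ∣ ℚ.≤ t →
    ℚ.∣ a ℚ.* b ℚ.- c ℚ.* d ∣ ℚ.≤ A ℚ.* s ℚ.+ B ℚ.* t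
  product-bound a b c d {A} {B} {s} {t} a≤A d≤B ≤s ≤t = begin
    ℚ.∣ a ℚ.* b ℚ.- c ℚ.* d ∣
      ≡⟨ cong ℚ.∣_∣ (Ring.*-diff a b c d) ⟩
    ℚ.∣ a ℚ.* (b ℚ.- d) ℚ.+ d ℚ.* (a ℚ.- c) ∣
      ≤⟨ ℚ.∣p+q∣≤∣p∣+∣q∣ (a ℚ.* (b ℚ.- d)) (d ℚ.* (a ℚ.- c)) ⟩
    ℚ.∣ a ℚ.* (b ℚ.- d) ∣ ℚ.+ ℚ.∣ d ℚ.* (a ℚ.- c) ∣
      ≡⟨ cong₂ ℚ._+_ (ℚ.∣p*q∣≡∣p∣*∣q∣ a (b ℚ.- d)) (ℚ.∣p*q∣≡∣p∣*∣q∣ d (a ℚ.- c)) ⟩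
    ℚ.∣ a ∣ ℚ.* ℚ.∣ b ℚ.- d ∣ ℚ.+ ℚ.∣ d ∣ ℚ.* ℚ.∣ a ℚ.- c ∣
      ≤⟨ ℚ.+-mono-≤ (*-mono-≤ (0≤∣∣ a) (0≤∣∣ (b ℚ.- d)) a≤A ≤s) (*-mono-≤ (0≤∣∣ d) (0≤∣∣ (a ℚ.- c)) d≤B ≤t) ⟩
    A ℚ.* s ℚ.+ B ℚ.* t ∎
    where open ℚ.≤-Reasoning

_*ᴿ_ : ℝ → ℝ → ℝ
x *ᴿ y = mkℝ (λ n → seq x n ℚ.* seq y n) conv
  where
  conv : ∀ δ → 0ℚ ℚ.< δ → ∃[ N ] (∀ m n → N ℕ.≤ m → N ℕ.≤ n → ℚ.∣ seq x m ℚ.* seq y m ℚ.- seq x n ℚ.* seq y n ∣ ℚ.≤ δ)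
  conv δ 0<δ =
    let A , 0<A , N₁ , hA = bounded x
        B , 0<B , N₂ , hB = bounded y
        N₃ , hx = cauchy x (recip B 0<B ℚ.* (½ ℚ.* δ)) (0<* (0<recip B 0<B) (0<½* 0<δ))
        N₄ , hy = cauchy y (recip A 0<A ℚ.* (½ ℚ.* δ)) (0<* (0<recip A 0<A) (0<½* 0<δ))
        N₁₂ = N₁ ℕ.⊔ N₂
        N₃₄ = N₃ ℕ.⊔ N₄
    in N₁₂ ℕ.⊔ N₃₄ , λ m n ≤m ≤n →
      let m₁₂ = ℕ.m⊔n≤o⇒m≤o N₁₂ N₃₄ ≤m
          n₁₂ = ℕ.m⊔n≤o⇒m≤o N₁₂ N₃₄ ≤n
          m₃₄ = ℕ.m⊔n≤o⇒n≤o N₁₂ N₃₄ ≤m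
          n₃₄ = ℕ.m⊔n≤o⇒n≤o N₁₂ N₃₄ ≤n
      in subst (ℚ.∣ seq x m ℚ.* seq y m ℚ.- seq x n ℚ.* seq y n ∣ ℚ.≤_)
        (trans (cong₂ ℚ._+_ (cancel A 0<A (½ ℚ.* δ)) (cancel B 0<B (½ ℚ.* δ))) (½+½ δ))
        (product-bound (seq x m) (seq y m) (seq x n) (seq y n)
          (hA m (ℕ.m⊔n≤o⇒m≤o N₁ N₂ m₁₂)) (hB n (ℕ.m⊔n≤o⇒n≤o N₁ N₂ n₁₂))
          (hy m n (ℕ.m⊔n≤o⇒n≤o N₃ N₄ m₃₄) (ℕ.m⊔n≤o⇒n≤o N₃ N₄ n₃₄))
          (hx m n (ℕ.m⊔n≤o⇒m≤o N₃ N₄ m₃₄) (ℕ.m⊔n≤o⇒m≤o N₃ N₄ n₃₄)))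

-- The sequence of reciprocals is started at the index N from which on
-- seq x is known to be at least δ > 0.
inv : (x : ℝ) → 0ᴿ <ᴿ x → ℝ
inv x (δ , 0<δ , N , δ≤x) = mkℝ (λ n → recip (y n) (0<y n)) conv
  where
  y : ℕ → ℚ
  y n = seq x (N ℕ.+ n)

  δ≤y : ∀ n → δ ℚ.≤ y n
  δ≤y n = subst (ℚ._≤ y n) (ℚ.+-identityˡ δ) (δ≤x (N ℕ.+ n) (ℕ.m≤m+n N n))

  0<y : ∀ n → 0ℚ ℚ.< y n
  0<y n = ℚ.<-≤-trans 0<δ (δ≤y n)

  1/y : ℕ → ℚ
  1/y n = recip (y n) (0<y n)

  1/δ : ℚ
  1/δ = recip δ 0<δ


  1/y≤1/δ : ∀ n → 1/y n ℚ.≤ 1/δ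
  1/y≤1/δ n = begin
    1/y n                   ≡⟨ ℚ.*-identityʳ _ ⟨
    1/y n ℚ.* 1ℚ            ≡⟨ cong (1/y n ℚ.*_) (recip-inv δ 0<δ) ⟨
    1/y n ℚ.* (1/δ ℚ.* δ)   ≤⟨ ℚ.*-monoˡ-≤-nonNeg (1/y n) {{ℚ.nonNegative (ℚ.<⇒≤ (0<recip (y n) (0<y n)))}}
                                (ℚ.*-monoˡ-≤-nonNeg 1/δ {{ℚ.nonNegative (ℚ.<⇒≤ (0<recip δ 0<δ))}} (δ≤y n)) ⟩
    1/y n ℚ.* (1/δ ℚ.* y n) ≡⟨ Ring.a[bc] (1/y n) 1/δ (y n) ⟩
    1/δ ℚ.* (1/y n ℚ.* y n) ≡⟨ cong (1/δ ℚ.*_) (recip-inv (y n) (0<y n)) ⟩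
    1/δ ℚ.* 1ℚ              ≡⟨ ℚ.*-identityʳ _ ⟩
    1/δ ∎
    where open ℚ.≤-Reasoning

  diff : ∀ m n → 1/y m ℚ.- 1/y n ≡ (1/y m ℚ.* 1/y n) ℚ.* (y n ℚ.- y m)
  diff m n = begin
    1/y m ℚ.- 1/y n
      ≡⟨ cong₂ ℚ._-_ (ℚ.*-identityʳ (1/y m)) (ℚ.*-identityʳ (1/y n)) ⟨
    1/y m ℚ.* 1ℚ ℚ.- 1/y n ℚ.* 1ℚ
      ≡⟨ cong₂ (λ s t → 1/y m ℚ.* s ℚ.- 1/y n ℚ.* t) (recip-inv (y n) (0<y n)) (recip-inv (y m) (0<y m)) ⟨
    1/y m ℚ.* (1/y n ℚ.* y n) ℚ.- 1/y n ℚ.* (1/y m ℚ.* y m)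
      ≡⟨ Ring.inv-diff (1/y m) (1/y n) (y m) (y n) ⟩
    (1/y m ℚ.* 1/y n) ℚ.* (y n ℚ.- y m) ∎
    where open ≡-Reasoning

  conv : ∀ η → 0ℚ ℚ.< η → ∃[ M ] (∀ m n → M ℕ.≤ m → M ℕ.≤ n → ℚ.∣ 1/y m ℚ.- 1/y n ∣ ℚ.≤ η)
  conv η 0<η with cauchy x ((δ ℚ.* δ) ℚ.* η) (0<* (0<* 0<δ 0<δ) 0<η)
  ... | M , h = M , λ m n ≤m ≤n → begin
      ℚ.∣ 1/y m ℚ.- 1/y n ∣
        ≡⟨ cong ℚ.∣_∣ (diff m n) ⟩
      ℚ.∣ (1/y m ℚ.* 1/y n) ℚ.* (y n ℚ.- y m) ∣
        ≡⟨ ℚ.∣p*q∣≡∣p∣*∣q∣ (1/y m ℚ.* 1/y n) (y n ℚ.- y m) ⟩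
      ℚ.∣ 1/y m ℚ.* 1/y n ∣ ℚ.* ℚ.∣ y n ℚ.- y m ∣
        ≡⟨ cong (ℚ._* ℚ.∣ y n ℚ.- y m ∣) (ℚ.0≤p⇒∣p∣≡p (0≤* (0≤1/y m) (0≤1/y n))) ⟩
      (1/y m ℚ.* 1/y n) ℚ.* ℚ.∣ y n ℚ.- y m ∣
        ≤⟨ *-mono-≤ (0≤* (0≤1/y m) (0≤1/y n)) (0≤∣∣ (y n ℚ.- y m))
             (*-mono-≤ (0≤1/y m) (0≤1/y n) (1/y≤1/δ m) (1/y≤1/δ n))
             (h (N ℕ.+ n) (N ℕ.+ m) (ℕ.≤-trans ≤n (ℕ.m≤n+m n N)) (ℕ.≤-trans ≤m (ℕ.m≤n+m m N))) ⟩
      (1/δ ℚ.* 1/δ) ℚ.* ((δ ℚ.* δ) ℚ.* η)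
        ≡⟨ Ring.inv-sq 1/δ δ η ⟩
      (1/δ ℚ.* δ) ℚ.* ((1/δ ℚ.* δ) ℚ.* η)
        ≡⟨ cong (λ t → t ℚ.* (t ℚ.* η)) (recip-inv δ 0<δ) ⟩
      1ℚ ℚ.* (1ℚ ℚ.* η)
        ≡⟨ trans (ℚ.*-identityˡ (1ℚ ℚ.* η)) (ℚ.*-identityˡ η) ⟩
      η ∎
    where
    open ℚ.≤-Reasoning
    0≤1/y : ∀ i → 0ℚ ℚ.≤ 1/y i
    0≤1/y i = ℚ.<⇒≤ (0<recip (y i) (0<y i))

divide : (x y : ℝ) → 0ᴿ <ᴿ y → ℝ
divide x y 0<y = x *ᴿ inv y 0<y

syntax divide x y 0<y = x /ᴿ y [ 0<y ]

0<1+ : (x : ℝ) → 0ᴿ <ᴿ x → 0ᴿ <ᴿ 1ᴿ +ᴿ x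
0<1+ x (δ , 0<δ , N , h) = δ , 0<δ , N , λ n N≤n → ℚ.≤-trans (h n N≤n)
  (subst (ℚ._≤ 1ℚ ℚ.+ seq x n) (ℚ.+-identityˡ (seq x n)) (ℚ.+-monoˡ-≤ (seq x n) (ℚ.<⇒≤ 0<1)))

-- The natural logarithm of a positive rational q, through
--   ln q = 2 artanh z = 2 Σ_{j ≥ 0} z^(2j+1) / (2j+1),  z = (q - 1)/(q + 1),
-- which converges for every q > 0 since |z| < 1.

private
  0<1+ℚ : ∀ {q} → 0ℚ ℚ.< q → 0ℚ ℚ.< q ℚ.+ 1ℚ
  0<1+ℚ 0<q = ℚ.+-mono-< 0<q 0<1

lnArg : (q : ℚ) → 0ℚ ℚ.< q → ℚ
lnArg q 0<q = ℚ._÷_ (q ℚ.- 1ℚ) (q ℚ.+ 1ℚ) {{ℚ.>-nonZero (0<1+ℚ 0<q)}}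

lnTerm : ℚ → ℕ → ℚ
lnTerm z j = fromℕ 2 ℚ.* (z ^ suc (2 ℕ.* j)) ℚ.÷ fromℕ (suc (2 ℕ.* j))

lnPartialSum : ℚ → ℕ → ℚ
lnPartialSum z zero    = 0ℚ
lnPartialSum z (suc N) = lnPartialSum z N ℚ.+ lnTerm z N

private
  module LnConvergence (z : ℚ) (∣z∣<1 : ℚ.∣ z ∣ ℚ.< 1ℚ) where

    a : ℚ
    a = ℚ.∣ z ∣

    0≤a : 0ℚ ℚ.≤ a
    0≤a = 0≤∣∣ z

    0≤a^ : ∀ j → 0ℚ ℚ.≤ a ^ j
    0≤a^ zero = ℚ.<⇒≤ 0<1
    0≤a^ (suc j) = 0≤* 0≤a (0≤a^ j)

    ∣z^∣ : ∀ j → ℚ.∣ z ^ j ∣ ≡ a ^ j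
    ∣z^∣ zero = refl
    ∣z^∣ (suc j) = trans (ℚ.∣p*q∣≡∣p∣*∣q∣ z (z ^ j)) (cong (a ℚ.*_) (∣z^∣ j))

    a^+ : ∀ i j → a ^ (i ℕ.+ j) ℚ.≤ a ^ j
    a^+ zero j = ℚ.≤-refl
    a^+ (suc i) j = ℚ.≤-trans
      (subst (a ℚ.* a ^ (i ℕ.+ j) ℚ.≤_) (ℚ.*-identityˡ (a ^ (i ℕ.+ j)))
        (ℚ.*-monoʳ-≤-nonNeg (a ^ (i ℕ.+ j)) {{ℚ.nonNegative (0≤a^ (i ℕ.+ j))}} (ℚ.<⇒≤ ∣z∣<1)))
      (a^+ i j)

    u : ℕ → ℚ
    u j = ℚ.1/ fromℕ (suc j)

    0<u : ∀ j → 0ℚ ℚ.< u j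
    0<u j = ℚ.positive⁻¹ (u j)

    u-anti : ∀ {i j} → i ℕ.≤ j → u j ℚ.≤ u i
    u-anti i≤j = ℚ.*≤* (ℤ.*-monoˡ-≤-nonNeg (+ 1) (ℤ.+≤+ (ℕ.s≤s i≤j)))

    0<1-a : 0ℚ ℚ.< 1ℚ ℚ.- a
    0<1-a = subst (ℚ._< 1ℚ ℚ.- a) (ℚ.+-inverseʳ a) (ℚ.+-monoˡ-< (ℚ.- a) ∣z∣<1)

    K : ℚ
    K = fromℕ 2 ℚ.* recip (1ℚ ℚ.- a) 0<1-a

    0<K : 0ℚ ℚ.< K
    0<K = 0<* (ℚ.positive⁻¹ (fromℕ 2)) (0<recip (1ℚ ℚ.- a) 0<1-a)

    K-step : ∀ t → K ℚ.* (t ℚ.- a ℚ.* t) ≡ fromℕ 2 ℚ.* t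
    K-step t = trans (Ring.geom (fromℕ 2) r a t)
      (trans (cong ((fromℕ 2 ℚ.* t) ℚ.*_) (recip-inv (1ℚ ℚ.- a) 0<1-a)) (ℚ.*-identityʳ (fromℕ 2 ℚ.* t)))
      where r = recip (1ℚ ℚ.- a) 0<1-a

    term-bound : ∀ n j → n ℕ.≤ j → ℚ.∣ lnTerm z j ∣ ℚ.≤ (K ℚ.* (a ^ j ℚ.- a ^ suc j)) ℚ.* u n
    term-bound n j n≤j = begin
      ℚ.∣ lnTerm z j ∣
        ≡⟨ ℚ.∣p*q∣≡∣p∣*∣q∣ (fromℕ 2 ℚ.* z ^ suc (2 ℕ.* j)) (u (2 ℕ.* j)) ⟩
      ℚ.∣ fromℕ 2 ℚ.* z ^ suc (2 ℕ.* j) ∣ ℚ.* u (2 ℕ.* j)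
        ≡⟨ cong (ℚ._* u (2 ℕ.* j)) (ℚ.∣p*q∣≡∣p∣*∣q∣ (fromℕ 2) (z ^ suc (2 ℕ.* j))) ⟩
      (fromℕ 2 ℚ.* ℚ.∣ z ^ suc (2 ℕ.* j) ∣) ℚ.* u (2 ℕ.* j)
        ≡⟨ cong (λ t → (fromℕ 2 ℚ.* t) ℚ.* u (2 ℕ.* j)) (∣z^∣ (suc (2 ℕ.* j))) ⟩
      (fromℕ 2 ℚ.* a ^ (suc j ℕ.+ (j ℕ.+ 0))) ℚ.* u (2 ℕ.* j)
        ≡⟨ cong (λ t → (fromℕ 2 ℚ.* a ^ (suc j ℕ.+ t)) ℚ.* u (2 ℕ.* j)) (ℕ.+-identityʳ j) ⟩
      (fromℕ 2 ℚ.* a ^ (suc j ℕ.+ j)) ℚ.* u (2 ℕ.* j)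
        ≤⟨ *-mono-≤ (0≤* (0≤fromℕ 2) (0≤a^ (suc j ℕ.+ j))) (ℚ.<⇒≤ (0<u (2 ℕ.* j)))
             (ℚ.*-monoˡ-≤-nonNeg (fromℕ 2) (a^+ (suc j) j)) (u-anti (ℕ.≤-trans n≤j (ℕ.m≤m+n j (j ℕ.+ 0)))) ⟩
      (fromℕ 2 ℚ.* a ^ j) ℚ.* u n
        ≡⟨ cong (ℚ._* u n) (K-step (a ^ j)) ⟨
      (K ℚ.* (a ^ j ℚ.- a ^ suc j)) ℚ.* u n ∎
      where open ℚ.≤-Reasoning

    S : ℕ → ℚ
    S = lnPartialSum z

    tail-bound : ∀ n d → ℚ.∣ S (d ℕ.+ n) ℚ.- S n ∣ ℚ.≤ (K ℚ.* (a ^ n ℚ.- a ^ (d ℕ.+ n))) ℚ.* u n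
    tail-bound n zero = ℚ.≤-reflexive (trans (cong ℚ.∣_∣ (ℚ.+-inverseʳ (S n)))
      (sym (Ring.vanish K (a ^ n) (u n))))
    tail-bound n (suc d) = begin
      ℚ.∣ (S (d ℕ.+ n) ℚ.+ lnTerm z (d ℕ.+ n)) ℚ.- S n ∣
        ≡⟨ cong ℚ.∣_∣ (Ring.[p+t]-q (S (d ℕ.+ n)) (lnTerm z (d ℕ.+ n)) (S n)) ⟩
      ℚ.∣ (S (d ℕ.+ n) ℚ.- S n) ℚ.+ lnTerm z (d ℕ.+ n) ∣
        ≤⟨ ℚ.∣p+q∣≤∣p∣+∣q∣ (S (d ℕ.+ n) ℚ.- S n) (lnTerm z (d ℕ.+ n)) ⟩
      ℚ.∣ S (d ℕ.+ n) ℚ.- S n ∣ ℚ.+ ℚ.∣ lnTerm z (d ℕ.+ n) ∣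
        ≤⟨ ℚ.+-mono-≤ (tail-bound n d) (term-bound n (d ℕ.+ n) (ℕ.m≤n+m n d)) ⟩
      (K ℚ.* (a ^ n ℚ.- a ^ (d ℕ.+ n))) ℚ.* u n ℚ.+ (K ℚ.* (a ^ (d ℕ.+ n) ℚ.- a ^ suc (d ℕ.+ n))) ℚ.* u n
        ≡⟨ Ring.telescope K (a ^ n) (a ^ (d ℕ.+ n)) (a ^ suc (d ℕ.+ n)) (u n) ⟩
      (K ℚ.* (a ^ n ℚ.- a ^ suc (d ℕ.+ n))) ℚ.* u n ∎
      where open ℚ.≤-Reasoning

    a^n-a^m≤1 : ∀ n m → a ^ n ℚ.- a ^ m ℚ.≤ 1ℚ
    a^n-a^m≤1 n m = shift (a ^ n) (a ^ m) 1ℚ (ℚ.≤-trans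
      (subst (λ t → a ^ t ℚ.≤ 1ℚ) (ℕ.+-identityʳ n) (a^+ n 0))
      (subst (ℚ._≤ a ^ m ℚ.+ 1ℚ) (ℚ.+-identityˡ 1ℚ) (ℚ.+-monoˡ-≤ 1ℚ (0≤a^ m))))

    uniform : ∀ N m n → N ℕ.≤ n → n ℕ.≤ m → ℚ.∣ S m ℚ.- S n ∣ ℚ.≤ K ℚ.* u N
    uniform N m n N≤n n≤m = begin
      ℚ.∣ S m ℚ.- S n ∣
        ≡⟨ cong (λ t → ℚ.∣ S t ℚ.- S n ∣) (ℕ.m∸n+n≡m n≤m) ⟨
      ℚ.∣ S ((m ℕ.∸ n) ℕ.+ n) ℚ.- S n ∣
        ≤⟨ tail-bound n (m ℕ.∸ n) ⟩
      (K ℚ.* (a ^ n ℚ.- a ^ ((m ℕ.∸ n) ℕ.+ n))) ℚ.* u n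
        ≤⟨ ℚ.*-monoʳ-≤-nonNeg (u n) {{ℚ.nonNegative (ℚ.<⇒≤ (0<u n))}}
             (ℚ.*-monoˡ-≤-nonNeg K {{ℚ.nonNegative (ℚ.<⇒≤ 0<K)}} (a^n-a^m≤1 n ((m ℕ.∸ n) ℕ.+ n))) ⟩
      (K ℚ.* 1ℚ) ℚ.* u n
        ≡⟨ cong (ℚ._* u n) (ℚ.*-identityʳ K) ⟩
      K ℚ.* u n
        ≤⟨ ℚ.*-monoˡ-≤-nonNeg K {{ℚ.nonNegative (ℚ.<⇒≤ 0<K)}} (u-anti N≤n) ⟩
      K ℚ.* u N ∎
      where open ℚ.≤-Reasoning

    conv : ∀ δ → 0ℚ ℚ.< δ → ∃[ N ] (∀ m n → N ℕ.≤ m → N ℕ.≤ n → ℚ.∣ S m ℚ.- S n ∣ ℚ.≤ δ)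
    conv δ 0<δ = N , go
      where
      open ℚ.≤-Reasoning
      1/δ = recip δ 0<δ
      N = ℤ.∣ ℚ.↥ (K ℚ.* 1/δ) ∣

      Ku≤δ : K ℚ.* u N ℚ.≤ δ
      Ku≤δ = begin
        K ℚ.* u N
          ≡⟨ ℚ.*-identityʳ _ ⟨
        (K ℚ.* u N) ℚ.* 1ℚ
          ≡⟨ cong ((K ℚ.* u N) ℚ.*_) (recip-inv δ 0<δ) ⟨
        (K ℚ.* u N) ℚ.* (1/δ ℚ.* δ)
          ≡⟨ Ring.[ku][rd] K (u N) 1/δ δ ⟩
        (K ℚ.* 1/δ) ℚ.* (u N ℚ.* δ)
          ≤⟨ ℚ.*-monoʳ-≤-nonNeg (u N ℚ.* δ) {{ℚ.nonNegative (ℚ.<⇒≤ (0<* (0<u N) 0<δ))}}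
               (ℚ.≤-trans (archimedes (K ℚ.* 1/δ)) (fromℕ-mono (ℕ.n≤1+n N))) ⟩
        fromℕ (suc N) ℚ.* (u N ℚ.* δ)
          ≡⟨ ℚ.*-assoc (fromℕ (suc N)) (u N) δ ⟨
        (fromℕ (suc N) ℚ.* u N) ℚ.* δ
          ≡⟨ cong (ℚ._* δ) (ℚ.*-inverseʳ (fromℕ (suc N))) ⟩
        1ℚ ℚ.* δ
          ≡⟨ ℚ.*-identityˡ δ ⟩
        δ ∎

      go : ∀ m n → N ℕ.≤ m → N ℕ.≤ n → ℚ.∣ S m ℚ.- S n ∣ ℚ.≤ δ
      go m n N≤m N≤n with ℕ.≤-total n m
      ... | inj₁ n≤m = ℚ.≤-trans (uniform N m n N≤n n≤m) Ku≤δ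
      ... | inj₂ m≤n = subst (ℚ._≤ δ) (∣∣-sym (S n) (S m)) (ℚ.≤-trans (uniform N n m N≤m m≤n) Ku≤δ)

  ∣lnArg∣<1 : ∀ q (0<q : 0ℚ ℚ.< q) → ℚ.∣ lnArg q 0<q ∣ ℚ.< 1ℚ
  ∣lnArg∣<1 q 0<q = ∣∣-lub-< (lnArg q 0<q)
    (subst (lnArg q 0<q ℚ.<_) one (scale (ℚ.+-monoʳ-< q (ℚ.<-trans (ℚ.neg-antimono-< 0<1) 0<1))))
    (subst (ℚ._< 1ℚ) neg (subst ((ℚ.- (q ℚ.- 1ℚ)) ℚ.* r ℚ.<_) one (scale -<)))
    where
    r = recip (q ℚ.+ 1ℚ) (0<1+ℚ 0<q)
    one : (q ℚ.+ 1ℚ) ℚ.* r ≡ 1ℚ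
    one = trans (ℚ.*-comm (q ℚ.+ 1ℚ) r) (recip-inv (q ℚ.+ 1ℚ) (0<1+ℚ 0<q))
    scale : ∀ {s t} → s ℚ.< t → s ℚ.* r ℚ.< t ℚ.* r
    scale = ℚ.*-monoˡ-<-pos r {{ℚ.positive (0<recip (q ℚ.+ 1ℚ) (0<1+ℚ 0<q))}}
    neg : (ℚ.- (q ℚ.- 1ℚ)) ℚ.* r ≡ ℚ.- lnArg q 0<q
    neg = Ring.neg-* (q ℚ.- 1ℚ) r
    -< : ℚ.- (q ℚ.- 1ℚ) ℚ.< q ℚ.+ 1ℚ
    -< = subst (ℚ._< q ℚ.+ 1ℚ) (Ring.-q+1 q)
      (ℚ.+-monoˡ-< 1ℚ (ℚ.<-trans (ℚ.neg-antimono-< 0<q) 0<q))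

lnPos : (q : ℚ) → 0ℚ ℚ.< q → ℝ
lnPos q 0<q = mkℝ (lnPartialSum (lnArg q 0<q)) (LnConvergence.conv (lnArg q 0<q) (∣lnArg∣<1 q 0<q))

data ℝ₋∞ : Set where
  -∞  : ℝ₋∞
  fin : ℝ → ℝ₋∞

data ℝ⁺∞ : Set where
  fin : ℝ → ℝ⁺∞
  +∞  : ℝ⁺∞

-- Only applied to q ≥ 0.
ln : ℚ → ℝ₋∞
ln q with 0ℚ ℚ.<? q
... | yes 0<q = fin (lnPos q 0<q)
... | no  _   = -∞

∣_-_∣ : ℝ₋∞ → ℝ₋∞ → ℝ⁺∞
∣ fin x - fin y ∣ = fin ∣ x -ᴿ y ∣ᴿ
∣ -∞    - -∞    ∣ = fin 0ᴿ
∣ fin _ - -∞    ∣ = +∞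
∣ -∞    - fin _ ∣ = +∞

_≤∞_ : ℝ⁺∞ → ℝ → Set
fin x ≤∞ y = x ≤ᴿ y
+∞    ≤∞ y = ⊥

record Structure (n : ℕ) : Set where
  field
    e   : Fin n → Fin n → ℚ
    0≤e : ∀ u v → 0ℚ ℚ.≤ e u v

open Structure public

value : ∀ {n m} → Structure n → Structure m → (Fin n → Fin m) → ℚ
value G H h = sum λ u → sum λ v → e G u v ℚ.* e H (h u) (h v)

-- finToFun enumerates all maps Fin n → Fin m.  All values are
-- nonnegative, so the base value 0 only matters when there is no map
-- at all (m = 0 < n).
opt : ∀ {n m} → Structure n → Structure m → ℚ
opt {n} {m} G H = foldr ℚ._⊔_ 0ℚ {m ℕ.^ n} λ i → value G H (finToFun i)

-- d_opt(G,H) ≤ x, where d_opt(G,H) = sup_C |ln opt(G,C) - ln opt(H,C)|: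
-- x is an upper bound of the set whose supremum is taken.
dopt[_,_]≤_ : ∀ {n m} → Structure n → Structure m → ℝ → Set
dopt[ G , H ]≤ x = ∀ {l} (C : Structure l) → ∣ ln (opt G C) - ln (opt H C) ∣ ≤∞ x

w : ∀ {n} → Structure n → Subset n → Subset n → ℚ
w G U V = sum λ u → sum λ v → if Vec.lookup U u ∧ Vec.lookup V v then e G u v else 0ℚ

record Graph (n : ℕ) : Set where
  field
    adj        : Fin n → Fin n → Bool
    symmetric  : ∀ u v → adj u v ≡ adj v u
    loopless   : ∀ u → adj u u ≡ false

open Graph public

∣E_∣ : ∀ {n} → Graph n → ℕ
∣E G ∣ = ℕΣ.sum λ u → ℕΣ.sum λ v → if does (u Fin.<? v) ∧ adj G u v then 1 else 0

private
  sum-nonNeg : ∀ {n} (f : Fin n → ℚ) → (∀ i → 0ℚ ℚ.≤ f i) → 0ℚ ℚ.≤ sum f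
  sum-nonNeg {zero}  f 0≤f = ℚ.≤-refl
  sum-nonNeg {suc n} f 0≤f = 0≤+ (0≤f Fin.zero) (sum-nonNeg (λ i → f (Fin.suc i)) (λ i → 0≤f (Fin.suc i)))

  if-nonNeg : ∀ b {p} → 0ℚ ℚ.≤ p → 0ℚ ℚ.≤ (if b then p else 0ℚ)
  if-nonNeg true  0≤p = 0≤p
  if-nonNeg false 0≤p = ℚ.≤-refl

⟦_⟧ : ∀ {n} → Graph n → Structure n
⟦ G ⟧ .e   u v = if adj G u v then 1ℚ else 0ℚ
⟦ G ⟧ .0≤e u v = if-nonNeg (adj G u v) (ℚ.<⇒≤ 0<1)

density : ∀ {n} .{{_ : NonZero n}} → Graph n → ℚ
density {n} G = ℚ._/_ (+ ∣E G ∣) (n ℕ.* n) {{ℕ.m*n≢0 n n}}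

-- Division with the convention p ⊘ 0 = 0; in Homogeneous this only concerns
-- empty vertex classes, for which the choice of the density is irrelevant.
_⊘_ : ℚ → ℕ → ℚ
p ⊘ zero    = 0ℚ
p ⊘ (suc m) = p ℚ.÷ fromℕ (suc m)

pairDensity : ∀ {n} → Graph n → Subset n → Subset n → ℚ
pairDensity G V₁ V₂ = w ⟦ G ⟧ V₁ V₂ ⊘ (∣ V₁ ∣ ℕ.* ∣ V₂ ∣)

-- ε-homogeneity of the bipartite graph with sides V₁, V₂ (disjoint in all uses)
-- whose edges are the edges of G between them.
Homogeneous : ∀ {n} → ℝ → Graph n → Subset n → Subset n → Set
Homogeneous ε G V₁ V₂ = ∀ W₁ W₂ → W₁ ⊆ V₁ → W₂ ⊆ V₂ →
  fromℚ ℚ.∣ w ⟦ G ⟧ W₁ W₂ ℚ.- pairDensity G V₁ V₂ ℚ.* fromℕ (∣ W₁ ∣ ℕ.* ∣ W₂ ∣) ∣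
    ≤ᴿ ε *ᴿ fromℚ (fromℕ (∣ V₁ ∣ ℕ.* ∣ V₂ ∣))

record Partition (n k : ℕ) : Set where
  field
    class    : Fin k → Subset n
    covers   : ∀ v → ∃ λ i → v ∈ class i
    disjoint : ∀ {v i j} → v ∈ class i → v ∈ class j → i ≡ j

open Partition public

⌊_/_⌋ ⌈_/_⌉ : (n k : ℕ) .{{_ : NonZero k}} → ℕ
⌊ n / k ⌋ = n ℕ./ k
⌈ n / k ⌉ = (n ℕ.+ (k ℕ.∸ 1)) ℕ./ k

record Regular {n k : ℕ} .{{_ : NonZero k}} (ε : ℝ) (G : Graph n) (P : Partition n k) : Set where
  field
    equitable   : ∀ i → ∣ class P i ∣ ≡ ⌊ n / k ⌋ ⊎ ∣ class P i ∣ ≡ ⌈ n / k ⌉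
    homogeneous : ∀ i j → i ≢ j → Homogeneous ε G (class P i) (class P j)

_⟋_ : ∀ {n k} → Graph n → Partition n k → Structure k
(G ⟋ P) .e   i j = w ⟦ G ⟧ (class P i) (class P j)
(G ⟋ P) .0≤e i j = sum-nonNeg _ λ u → sum-nonNeg _ λ v →
  if-nonNeg (Vec.lookup (class P i) u ∧ Vec.lookup (class P j) v) (0≤e ⟦ G ⟧ u v)

{-# OPTIONS --safe #-}

-- Write V₁, …, V_k for the classes, D = 1/k, a = opt(G,C) and b = opt(G/P,C); b ≤ a is
-- clear, and everything rests on c (a - b) ≤ 10 D a.  Given h : V(G) → V(C), pick
-- vᵢ ∈ Vᵢ independently and uniformly and condition on all pairs vᵢvⱼ of density
-- at least D being edges: the maps i ↦ h(vᵢ) are candidates for b.  As in the counting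
-- lemma, homogeneity lets one replace the edge indicators one at a time by the
-- densities, so under this conditioning vᵢvⱼ is nearly a uniformly random edge
-- between Vᵢ and Vⱼ, whatever the size of C.  Hence the expected value of the map is
-- that of h, up to M times the number of edges inside classes or in sparse pairs,
-- where M is the maximal weight of C; a random map to the two ends of that weight
-- shows M |E| ≤ 2 a.  Finally the partial sums of the series defining ln satisfy
-- |ln a - ln b| ≤ (a - b)/b, so no exponential function is needed.
module Submission where

open import Defs
open import Algebra.Bundles using (CommutativeRing)
open import Data.Bool.Base using (Bool; true; false; if_then_else_; _∧_)
open import Data.Fin.Base as Fin using (Fin; zero; suc; finToFun; funToFin)
import Data.Fin.Properties as Fin
import Data.Integer.Base as ℤ
import Data.Integer.Properties as ℤ
open import Data.List.Base as List using (List; []; _∷_; length; allFin; cartesianProduct)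
open import Data.List.Membership.Propositional using (_∈_)
import Data.List.Membership.Propositional.Properties as Membership
import Data.List.Properties as List
open import Data.List.Relation.Unary.All as All using (All; []; _∷_)
open import Data.List.Relation.Unary.AllPairs using ([]; _∷_)
open import Data.List.Relation.Unary.Any using (here; there)
open import Data.List.Relation.Unary.Unique.Propositional using (Unique)
import Data.List.Relation.Unary.Unique.Propositional.Properties as Unique
open import Data.Nat.Base as ℕ using (ℕ; zero; suc; NonZero)
import Data.Nat.DivMod as ℕ
import Data.Nat.Properties as ℕ
open import Data.Product.Base using (∃-syntax; _×_; _,_; proj₁; proj₂)
open import Data.Rational.Base as ℚ using (ℚ; 0ℚ; 1ℚ; ½; _/_)
import Data.Rational.Properties as ℚ
open import Data.Rational.Solver using (module +-*-Solver)
import Data.Rational.Unnormalised.Base as ℚᵘ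
import Data.Rational.Unnormalised.Properties as ℚᵘ
open import Data.Sum.Base using (_⊎_; inj₁; inj₂)
open import Data.Vec.Base using (Vec; []; _∷_; lookup; tabulate; _[_]≔_)
open import Data.Vec.Functional using (foldr)
import Data.Vec.Properties as Vec
open import Function.Base using (_∘_; id)
open import Relation.Binary.Definitions using (Tri; tri<; tri≈; tri>)
open import Relation.Binary.PropositionalEquality using (_≡_; _≢_; refl; sym; trans; cong; cong₂; subst; subst₂; module ≡-Reasoning)
open import Relation.Nullary.Decidable.Core using (Dec; does; yes; no; _×-dec_)
open import Relation.Nullary.Negation.Core using (¬_; contradiction)
import Algebra.Properties.CommutativeMonoid.Sum ℕ.+-0-commutativeMonoid as ℕΣ
open import Algebra.Properties.Semiring.Exp (CommutativeRing.semiring ℚ.+-*-commutativeRing) using (^-assocʳ; ^-homo-*)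
open import Algebra.Properties.Semiring.Sum (CommutativeRing.semiring ℚ.+-*-commutativeRing) using (sum; sum-cong-≗; ∑-distrib-+; ∑-comm; *-distribˡ-sum; *-distribʳ-sum)

-- The weights C(h(x),h(y)) form an arbitrary function of (x,y), and closeness in the cut norm says
-- nothing about such a function. The indicator of the pair under study is therefore never replaced
-- by its density. It stays multiplied with the weight, and only the indicators of the other pairs
-- are exchanged. Any other pair shares at most one index with the pair under study, so once the
-- remaining points are fixed the test function is a product f(x)g(y), to which homogeneity applies.
-- Without conditioning, vᵢvⱼ would be a uniformly random pair of points instead of a random edge,
-- and h may place large weights of C on edges only. Sparse pairs are exempt because the event must
-- outweigh the accumulated error: k² factors, each at least D, give a product Δ ≥ D^(k²), against
-- an error k² (1/k)^(8k²) ≤ D^(k²) D. The estimates are kept multiplied by Δ, so no conditional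
-- expectation is formed. The quotient ε₀/(1+ε₀) arises because a relative loss (a - b)/a ≤
-- ε₀/(1+ε₀) is the same as (a - b)/b ≤ ε₀.

module Inequalities where

  -- Ordered-field arithmetic of the rationals and the embedding of the naturals.

  open import Data.Rational.Base using (_+_; _*_; _-_; -_; _≤_; _<_)
  open +-*-Solver using (solve; _:=_; _:+_; _:*_; _:-_; :-_; con)

  ≤-by : ∀ {p q} r → 0ℚ ≤ r → q ≡ p + r → p ≤ q
  ≤-by {p} {q} r 0≤r q≡p+r = subst₂ _≤_ (ℚ.+-identityʳ p) (sym q≡p+r) (ℚ.+-monoʳ-≤ p 0≤r)

  p≤q⇒0≤q-p : ∀ {p q} → p ≤ q → 0ℚ ≤ q - p
  p≤q⇒0≤q-p {p} {q} p≤q = subst (_≤ q - p) (ℚ.+-inverseʳ p) (ℚ.+-monoˡ-≤ (- p) p≤q)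

  0≤+ : ∀ {p q} → 0ℚ ≤ p → 0ℚ ≤ q → 0ℚ ≤ p + q
  0≤+ = ℚ.+-mono-≤

  0≤1 : 0ℚ ≤ 1ℚ
  0≤1 = ℚ.nonNegative⁻¹ 1ℚ

  *-monoˡ : ∀ {p q r} → 0ℚ ≤ r → p ≤ q → r * p ≤ r * q
  *-monoˡ {r = r} 0≤r = ℚ.*-monoˡ-≤-nonNeg r {{ℚ.nonNegative 0≤r}}

  *-monoʳ : ∀ {p q r} → 0ℚ ≤ r → p ≤ q → p * r ≤ q * r
  *-monoʳ {r = r} 0≤r = ℚ.*-monoʳ-≤-nonNeg r {{ℚ.nonNegative 0≤r}}

  *-mono : ∀ {p q r s} → 0ℚ ≤ p → 0ℚ ≤ s → p ≤ q → r ≤ s → p * r ≤ q * s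
  *-mono 0≤p 0≤s p≤q r≤s = ℚ.≤-trans (*-monoˡ 0≤p r≤s) (*-monoʳ 0≤s p≤q)

  0≤* : ∀ {p q} → 0ℚ ≤ p → 0ℚ ≤ q → 0ℚ ≤ p * q
  0≤* {p} {q} 0≤p 0≤q = subst (_≤ p * q) (ℚ.*-zeroʳ p) (*-monoˡ 0≤p 0≤q)

  0<* : ∀ {p q} → 0ℚ < p → 0ℚ < q → 0ℚ < p * q
  0<* {p} {q} 0<p 0<q = subst (_< p * q) (ℚ.*-zeroʳ p) (ℚ.*-monoʳ-<-pos p {{ℚ.positive 0<p}} 0<q)

  *-cancelˡ : ∀ {p q r} → 0ℚ < r → r * p ≤ r * q → p ≤ q
  *-cancelˡ {r = r} 0<r = ℚ.*-cancelˡ-≤-pos r {{ℚ.positive 0<r}}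

  p*q≤p : ∀ {p q} → 0ℚ ≤ p → q ≤ 1ℚ → p * q ≤ p
  p*q≤p {p} {q} 0≤p q≤1 = subst (p * q ≤_) (ℚ.*-identityʳ p) (*-monoˡ 0≤p q≤1)

  p*q≤1 : ∀ {p q} → 0ℚ ≤ p → p ≤ 1ℚ → q ≤ 1ℚ → p * q ≤ 1ℚ
  p*q≤1 0≤p p≤1 q≤1 = ℚ.≤-trans (p*q≤p 0≤p q≤1) p≤1

  ≤-archimedean : ∀ {p q} → (∀ δ → 0ℚ < δ → p ≤ q + δ) → p ≤ q
  ≤-archimedean {p} {q} h with p ℚ.≤? q
  ... | yes p≤q = p≤q
  ... | no  p≰q = contradiction (h (½ * (p - q)) (0<* (ℚ.positive⁻¹ ½) 0<p-q)) λ p≤ →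
      ℚ.<-irrefl refl (ℚ.<-≤-trans (0<* (ℚ.positive⁻¹ ½) 0<p-q) (subst₂ _≤_
        (solve 2 (λ p q → p :- (q :+ con ½ :* (p :- q)) := con ½ :* (p :- q)) refl p q)
        (ℚ.+-inverseʳ (q + ½ * (p - q))) (ℚ.+-monoˡ-≤ (- (q + ½ * (p - q))) p≤)))
    where
    0<p-q : 0ℚ < p - q
    0<p-q = subst (_< p - q) (ℚ.+-inverseʳ q) (ℚ.+-monoˡ-< (- q) (ℚ.≰⇒> p≰q))

  ∣∣≤⇒≤ : ∀ {p q} → ℚ.∣ p ∣ ≤ q → p ≤ q
  ∣∣≤⇒≤ {p} {q} h with ℚ.∣p∣≡p∨∣p∣≡-p p
  ... | inj₁ eq = subst (_≤ q) eq h
  ... | inj₂ eq = ℚ.≤-trans (≤-by (ℚ.∣ p ∣ + ℚ.∣ p ∣) (0≤+ (ℚ.0≤∣p∣ p) (ℚ.0≤∣p∣ p))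
    (trans (solve 1 (λ t → t := :- t :+ (t :+ t)) refl ℚ.∣ p ∣)
      (cong (_+ (ℚ.∣ p ∣ + ℚ.∣ p ∣)) (trans (cong -_ eq) (solve 1 (λ p → :- (:- p) := p) refl p))))) h

  ∣∣≤⇒-≤ : ∀ {p q} → ℚ.∣ p ∣ ≤ q → - p ≤ q
  ∣∣≤⇒-≤ {p} h = ∣∣≤⇒≤ (subst (_≤ _) (sym (ℚ.∣-p∣≡∣p∣ p)) h)

  fromℕ-mono : ∀ {m n} → m ℕ.≤ n → fromℕ m ≤ fromℕ n
  fromℕ-mono m≤n = ℚ.*≤* (ℤ.*-monoʳ-≤-nonNeg (ℤ.+ 1) (ℤ.+≤+ m≤n))

  0≤fromℕ : ∀ m → 0ℚ ≤ fromℕ m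
  0≤fromℕ m = fromℕ-mono {0} {m} ℕ.z≤n

  0<fromℕ : ∀ {m} → m ≢ 0 → 0ℚ < fromℕ m
  0<fromℕ {zero}  m≢0 = contradiction refl m≢0
  0<fromℕ {suc m} _   = ℚ.positive⁻¹ (fromℕ (suc m))

  fromℕ-+ : ∀ m n → fromℕ (m ℕ.+ n) ≡ fromℕ m + fromℕ n
  fromℕ-+ m n = ℚ.toℚᵘ-injective (ℚᵘ.≃-trans (ℚᵘ.*≡* (cong (ℤ._* ℤ.+ 1) (cong₂ ℤ._+_ (sym (ℤ.*-identityʳ (ℤ.+ m))) (sym (ℤ.*-identityʳ (ℤ.+ n))))))
    (ℚᵘ.≃-sym (ℚ.toℚᵘ-homo-+ (fromℕ m) (fromℕ n))))

  fromℕ-* : ∀ m n → fromℕ (m ℕ.* n) ≡ fromℕ m * fromℕ n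
  fromℕ-* m n = ℚ.toℚᵘ-injective (ℚᵘ.≃-trans (ℚᵘ.*≡* (cong (ℤ._* ℤ.+ 1) (ℤ.pos-* m n)))
    (ℚᵘ.≃-sym (ℚ.toℚᵘ-homo-* (fromℕ m) (fromℕ n))))

  fromℕ-/ : ∀ m n .{{_ : NonZero n}} → (ℤ.+ m / n) * fromℕ n ≡ fromℕ m
  fromℕ-/ m n@(suc d) = ℚ.toℚᵘ-injective (begin
    ℚ.toℚᵘ ((ℤ.+ m / n) * fromℕ n)               ≈⟨ ℚ.toℚᵘ-homo-* (ℤ.+ m / n) (fromℕ n) ⟩
    ℚ.toℚᵘ (ℤ.+ m / n) ℚᵘ.* ℚ.toℚᵘ (fromℕ n)     ≈⟨ ℚᵘ.*-congʳ (ℚ.toℚᵘ-fromℚᵘ (ℚᵘ.mkℚᵘ (ℤ.+ m) d)) ⟩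
    ℚᵘ.mkℚᵘ (ℤ.+ m) d ℚᵘ.* ℚ.toℚᵘ (fromℕ n)      ≈⟨ ℚᵘ.*≡* (trans (ℤ.*-identityʳ _) (cong (λ t → ℤ.+ m ℤ.* ℤ.+ t) (sym (ℕ.*-identityʳ n)))) ⟩
    ℚ.toℚᵘ (fromℕ m)                             ∎)
    where open ℚᵘ.≃-Reasoning

  -- Finite sums and double sums.

  sum-mono : ∀ {n} {f g : Fin n → ℚ} → (∀ i → f i ≤ g i) → sum f ≤ sum g
  sum-mono {zero}  f≤g = ℚ.≤-refl
  sum-mono {suc n} f≤g = ℚ.+-mono-≤ (f≤g zero) (sum-mono (f≤g ∘ suc))

  sum-0≤ : ∀ {n} {f : Fin n → ℚ} → (∀ i → 0ℚ ≤ f i) → 0ℚ ≤ sum f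
  sum-0≤ {zero}  0≤f = ℚ.≤-refl
  sum-0≤ {suc n} 0≤f = 0≤+ (0≤f zero) (sum-0≤ (0≤f ∘ suc))

  sum-0≡ : ∀ {n} {f : Fin n → ℚ} → (∀ i → f i ≡ 0ℚ) → sum f ≡ 0ℚ
  sum-0≡ {zero}  f≡0 = refl
  sum-0≡ {suc n} f≡0 = cong₂ _+_ (f≡0 zero) (sum-0≡ (f≡0 ∘ suc))

  sum-const : ∀ n p → sum {n} (λ _ → p) ≡ fromℕ n * p
  sum-const zero    p = sym (ℚ.*-zeroˡ p)
  sum-const (suc n) p = begin
    p + sum {n} (λ _ → p)   ≡⟨ cong (p +_) (sum-const n p) ⟩
    p + fromℕ n * p         ≡⟨ solve 2 (λ p t → p :+ t :* p := (con 1ℚ :+ t) :* p) refl p (fromℕ n) ⟩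
    (1ℚ + fromℕ n) * p      ≡⟨ cong (_* p) (fromℕ-+ 1 n) ⟨
    fromℕ (suc n) * p       ∎
    where open ≡-Reasoning

  sum-single : ∀ {n} (f : Fin n → ℚ) i → (∀ j → j ≢ i → f j ≡ 0ℚ) → sum f ≡ f i
  sum-single f zero    h = trans (cong (f zero +_) (sum-0≡ λ j → h (suc j) λ ())) (ℚ.+-identityʳ (f zero))
  sum-single f (suc i) h = trans (cong₂ _+_ (h zero λ ()) (sum-single (f ∘ suc) i λ j j≢i → h (suc j) λ { refl → j≢i refl })) (ℚ.+-identityˡ (f (suc i)))

  sum²-cong : ∀ {m n} {f g : Fin m → Fin n → ℚ} → (∀ i j → f i j ≡ g i j) → sum (λ i → sum (f i)) ≡ sum (λ i → sum (g i))
  sum²-cong h = sum-cong-≗ λ i → sum-cong-≗ (h i)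

  sum²-mono : ∀ {m n} {f g : Fin m → Fin n → ℚ} → (∀ i j → f i j ≤ g i j) → sum (λ i → sum (f i)) ≤ sum (λ i → sum (g i))
  sum²-mono h = sum-mono λ i → sum-mono (h i)

  sum²-* : ∀ {m n} c (f : Fin m → Fin n → ℚ) → c * sum (λ i → sum (f i)) ≡ sum (λ i → sum λ j → c * f i j)
  sum²-* c f = trans (*-distribˡ-sum c (λ i → sum (f i))) (sum-cong-≗ λ i → *-distribˡ-sum c (f i))

  sum²-+ : ∀ {m n} (f g : Fin m → Fin n → ℚ) → sum (λ i → sum λ j → f i j + g i j) ≡ sum (λ i → sum (f i)) + sum (λ i → sum (g i))
  sum²-+ f g = trans (sum-cong-≗ λ i → ∑-distrib-+ (f i) (g i)) (∑-distrib-+ (λ i → sum (f i)) (λ i → sum (g i)))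

  sum²-1 : ∀ n → (sum {n} λ _ → sum {n} λ _ → 1ℚ) ≡ fromℕ n * fromℕ n
  sum²-1 n = trans (sum-cong-≗ {n} λ _ → sum-const n 1ℚ)
    (trans (sum-const n (fromℕ n * 1ℚ)) (cong (fromℕ n *_) (ℚ.*-identityʳ (fromℕ n))))

-- Expectations over independent random points.

module Expectation where

  open Inequalities
  open import Data.Rational.Base using (_+_; _*_; _≤_)
  open +-*-Solver using (solve; _:=_; _:*_)

  record Probability {m : ℕ} (μ : Fin m → ℚ) : Set where
    field
      0≤μ : ∀ x → 0ℚ ≤ μ x
      ∑≡1 : sum μ ≡ 1ℚ

  open Probability public

  -- Integration against a product measure, as an iterated sum. Vectors let the head be split off
  -- and coordinates be overwritten without appeal to function extensionality.
  E : ∀ {m k} → (Fin k → Fin m → ℚ) → (Vec (Fin m) k → ℚ) → ℚ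
  E {k = zero}  μ Φ = Φ []
  E {k = suc k} μ Φ = sum λ x → μ zero x * E (μ ∘ suc) (λ v → Φ (x ∷ v))

  E-cong : ∀ {m k} (μ : Fin k → Fin m → ℚ) {Φ Ψ : Vec (Fin m) k → ℚ} → (∀ v → Φ v ≡ Ψ v) → E μ Φ ≡ E μ Ψ
  E-cong {k = zero}  μ h = h []
  E-cong {k = suc k} μ h = sum-cong-≗ λ x → cong (μ zero x *_) (E-cong (μ ∘ suc) (h ∘ (x ∷_)))

  E-+ : ∀ {m k} (μ : Fin k → Fin m → ℚ) (Φ Ψ : Vec (Fin m) k → ℚ) → E μ (λ v → Φ v + Ψ v) ≡ E μ Φ + E μ Ψ
  E-+ {k = zero}  μ Φ Ψ = refl
  E-+ {k = suc k} μ Φ Ψ = trans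
    (sum-cong-≗ λ x → trans (cong (μ zero x *_) (E-+ (μ ∘ suc) (Φ ∘ (x ∷_)) (Ψ ∘ (x ∷_)))) (ℚ.*-distribˡ-+ (μ zero x) _ _))
    (∑-distrib-+ (λ x → μ zero x * E (μ ∘ suc) (Φ ∘ (x ∷_))) (λ x → μ zero x * E (μ ∘ suc) (Ψ ∘ (x ∷_))))

  E-* : ∀ {m k} (μ : Fin k → Fin m → ℚ) c (Φ : Vec (Fin m) k → ℚ) → E μ (λ v → c * Φ v) ≡ c * E μ Φ
  E-* {k = zero}  μ c Φ = refl
  E-* {k = suc k} μ c Φ = trans
    (sum-cong-≗ λ x → trans (cong (μ zero x *_) (E-* (μ ∘ suc) c (Φ ∘ (x ∷_))))
      (solve 3 (λ a b c → a :* (b :* c) := b :* (a :* c)) refl (μ zero x) c (E (μ ∘ suc) (Φ ∘ (x ∷_)))))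
    (sym (*-distribˡ-sum c (λ x → μ zero x * E (μ ∘ suc) (Φ ∘ (x ∷_)))))

  E-0 : ∀ {m k} (μ : Fin k → Fin m → ℚ) → E μ (λ _ → 0ℚ) ≡ 0ℚ
  E-0 {k = zero}  μ = refl
  E-0 {k = suc k} μ = sum-0≡ λ x → trans (cong (μ zero x *_) (E-0 (μ ∘ suc))) (ℚ.*-zeroʳ (μ zero x))

  E-sum : ∀ {m k l} (μ : Fin k → Fin m → ℚ) (Φ : Fin l → Vec (Fin m) k → ℚ) → E μ (λ v → sum λ i → Φ i v) ≡ sum λ i → E μ (Φ i)
  E-sum {l = zero}  μ Φ = E-0 μ
  E-sum {l = suc l} μ Φ = trans (E-+ μ (Φ zero) (λ v → sum λ i → Φ (suc i) v)) (cong (E μ (Φ zero) +_) (E-sum μ (Φ ∘ suc)))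

  E-sum² : ∀ {m k l l′} (μ : Fin k → Fin m → ℚ) (Φ : Fin l → Fin l′ → Vec (Fin m) k → ℚ) →
    E μ (λ v → sum λ i → sum λ j → Φ i j v) ≡ sum λ i → sum λ j → E μ (Φ i j)
  E-sum² μ Φ = trans (E-sum μ (λ i v → sum λ j → Φ i j v)) (sum-cong-≗ λ i → E-sum μ (Φ i))

  module _ {m : ℕ} where

    E-mono : ∀ {k} {μ : Fin k → Fin m → ℚ} → (∀ i → Probability (μ i)) → {Φ Ψ : Vec (Fin m) k → ℚ} → (∀ v → Φ v ≤ Ψ v) → E μ Φ ≤ E μ Ψ
    E-mono {zero}  P h = h []
    E-mono {suc k} P h = sum-mono λ x → *-monoˡ (0≤μ (P zero) x) (E-mono (P ∘ suc) (h ∘ (x ∷_)))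

    E-const : ∀ {k} {μ : Fin k → Fin m → ℚ} → (∀ i → Probability (μ i)) → ∀ c → E μ (λ _ → c) ≡ c
    E-const {zero}      P c = refl
    E-const {suc k} {μ} P c = begin
      sum (λ x → μ zero x * E (μ ∘ suc) (λ _ → c))  ≡⟨ sum-cong-≗ (λ x → cong (μ zero x *_) (E-const (P ∘ suc) c)) ⟩
      sum (λ x → μ zero x * c)                      ≡⟨ *-distribʳ-sum c (μ zero) ⟨
      sum (μ zero) * c                              ≡⟨ cong (_* c) (∑≡1 (P zero)) ⟩
      1ℚ * c                                        ≡⟨ ℚ.*-identityˡ c ⟩
      c                                             ∎
      where open ≡-Reasoning

    -- `E` peels off coordinates from the front only. This gives access to a coordinate at any
    -- position while the others stay frozen in `v`, which is how a single pair of random points is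
    -- isolated later.
    E-resample : ∀ {k} {μ : Fin k → Fin m → ℚ} → (∀ i → Probability (μ i)) → ∀ a (Φ : Vec (Fin m) k → ℚ) →
      E μ Φ ≡ E μ (λ v → sum λ x → μ a x * Φ (v [ a ]≔ x))
    E-resample {suc k} {μ} P zero Φ = sym (begin
      sum (λ y → μ zero y * E (μ ∘ suc) (λ v → sum λ x → μ zero x * Φ (x ∷ v)))
        ≡⟨ *-distribʳ-sum avg (μ zero) ⟨
      sum (μ zero) * avg
        ≡⟨ trans (cong (_* avg) (∑≡1 (P zero))) (ℚ.*-identityˡ avg) ⟩
      E (μ ∘ suc) (λ v → sum λ x → μ zero x * Φ (x ∷ v))
        ≡⟨ E-sum (μ ∘ suc) (λ x v → μ zero x * Φ (x ∷ v)) ⟩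
      sum (λ x → E (μ ∘ suc) (λ v → μ zero x * Φ (x ∷ v)))
        ≡⟨ sum-cong-≗ (λ x → E-* (μ ∘ suc) (μ zero x) (Φ ∘ (x ∷_))) ⟩
      sum (λ x → μ zero x * E (μ ∘ suc) (Φ ∘ (x ∷_)))
        ∎)
      where
      open ≡-Reasoning
      avg = E (μ ∘ suc) (λ v → sum λ x → μ zero x * Φ (x ∷ v))
    E-resample {suc k} {μ} P (suc a) Φ = sum-cong-≗ λ x → cong (μ zero x *_) (E-resample (P ∘ suc) a (Φ ∘ (x ∷_)))

    E₂ : (μ ν : Fin m → ℚ) → (Fin m → Fin m → ℚ) → ℚ
    E₂ μ ν F = sum λ x → sum λ y → (μ x * ν y) * F x y

    E-resample₂ : ∀ {k} {μ : Fin k → Fin m → ℚ} → (∀ i → Probability (μ i)) → ∀ a b (Φ : Vec (Fin m) k → ℚ) →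
      E μ Φ ≡ E μ (λ v → E₂ (μ a) (μ b) λ x y → Φ ((v [ a ]≔ x) [ b ]≔ y))
    E-resample₂ {μ = μ} P a b Φ = begin
      E μ Φ
        ≡⟨ E-resample P b Φ ⟩
      E μ (λ v → sum λ y → μ b y * Φ (v [ b ]≔ y))
        ≡⟨ E-resample P a (λ v → sum λ y → μ b y * Φ (v [ b ]≔ y)) ⟩
      E μ (λ v → sum λ x → μ a x * sum (λ y → μ b y * Φ ((v [ a ]≔ x) [ b ]≔ y)))
        ≡⟨ E-cong μ (λ v → sum-cong-≗ λ x → trans (*-distribˡ-sum (μ a x) (λ y → μ b y * Φ ((v [ a ]≔ x) [ b ]≔ y)))
            (sum-cong-≗ λ y → sym (ℚ.*-assoc (μ a x) (μ b y) _))) ⟩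
      E μ (λ v → E₂ (μ a) (μ b) λ x y → Φ ((v [ a ]≔ x) [ b ]≔ y))
        ∎
      where open ≡-Reasoning

    lookup-update₂-fst : ∀ {k} {a b : Fin k} → a ≢ b → ∀ (v : Vec (Fin m) k) x y → lookup ((v [ a ]≔ x) [ b ]≔ y) a ≡ x
    lookup-update₂-fst {a = a} a≢b v x y = trans (Vec.lookup∘update′ a≢b (v [ a ]≔ x) y) (Vec.lookup∘update a v x)

    lookup-update₂-snd : ∀ {k} (a b : Fin k) (v : Vec (Fin m) k) x y → lookup ((v [ a ]≔ x) [ b ]≔ y) b ≡ y
    lookup-update₂-snd a b v x y = Vec.lookup∘update b (v [ a ]≔ x) y

    lookup-update₂-other : ∀ {k} {a b i : Fin k} → i ≢ a → i ≢ b → ∀ (v : Vec (Fin m) k) x y → lookup ((v [ a ]≔ x) [ b ]≔ y) i ≡ lookup v i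
    lookup-update₂-other {a = a} i≢a i≢b v x y = trans (Vec.lookup∘update′ i≢b (v [ a ]≔ x) y) (Vec.lookup∘update′ i≢a v x)

    E-marginal₂ : ∀ {k} {μ : Fin k → Fin m → ℚ} → (∀ i → Probability (μ i)) → ∀ {a b} → a ≢ b → (F : Fin m → Fin m → ℚ) →
      E μ (λ v → F (lookup v a) (lookup v b)) ≡ E₂ (μ a) (μ b) F
    E-marginal₂ {μ = μ} P {a} {b} a≢b F = begin
      E μ (λ v → F (lookup v a) (lookup v b))
        ≡⟨ E-resample₂ P a b _ ⟩
      E μ (λ v → E₂ (μ a) (μ b) λ x y → F (lookup ((v [ a ]≔ x) [ b ]≔ y) a) (lookup ((v [ a ]≔ x) [ b ]≔ y) b))
        ≡⟨ E-cong μ (λ v → sum²-cong λ x y → cong (μ a x * μ b y *_)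
            (cong₂ F (lookup-update₂-fst a≢b v x y) (lookup-update₂-snd a b v x y))) ⟩
      E μ (λ v → E₂ (μ a) (μ b) F)
        ≡⟨ E-const P (E₂ (μ a) (μ b) F) ⟩
      E₂ (μ a) (μ b) F
        ∎
      where open ≡-Reasoning

-- Separable test functions and the counting lemma.

module Counting where

  open Inequalities
  open Expectation
  open import Data.Rational.Base using (_+_; _*_; _≤_; _<_)
  open +-*-Solver using (solve; _:=_; _:+_; _:*_; con)

  ∏ : ∀ {a} {A : Set a} → (A → ℚ) → List A → ℚ
  ∏ f []       = 1ℚ
  ∏ f (x ∷ xs) = f x * ∏ f xs

  ∏-0≤ : ∀ {a} {A : Set a} {f : A → ℚ} → (∀ x → 0ℚ ≤ f x) → ∀ xs → 0ℚ ≤ ∏ f xs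
  ∏-0≤ 0≤f []       = 0≤1
  ∏-0≤ 0≤f (x ∷ xs) = 0≤* (0≤f x) (∏-0≤ 0≤f xs)

  ∏-lower : ∀ {a} {A : Set a} {f : A → ℚ} {p} → 0ℚ ≤ p → (∀ x → p ≤ f x) → ∀ xs → p ^ length xs ≤ ∏ f xs
  ∏-lower 0≤p p≤f []       = ℚ.≤-refl
  ∏-lower 0≤p p≤f (x ∷ xs) = *-mono 0≤p (∏-0≤ (λ x → ℚ.≤-trans 0≤p (p≤f x)) xs) (p≤f x) (∏-lower 0≤p p≤f xs)

  -- The pair under study has to leave the product. `unique` and `avoids` are what the counting
  -- argument asks of the remaining list, `shorter` keeps its error within that of the full list,
  -- and `inherit` carries freshness through the recursion.
  record Extraction {A : Set} (x : A) (xs : List A) : Set₁ where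
    field
      rest    : List A
      unique  : Unique rest
      avoids  : All (x ≢_) rest
      inherit : ∀ {P : A → Set} → All P xs → All P rest
      ∏-split : ∀ f → ∏ f xs ≡ f x * ∏ f rest
      shorter : length rest ℕ.≤ length xs

  extract : ∀ {A : Set} {x : A} {xs} → x ∈ xs → Unique xs → Extraction x xs
  extract {xs = _ ∷ xs} (here refl) (x∉xs ∷ uniq) = record
    { rest = xs ; unique = uniq ; avoids = x∉xs ; inherit = λ { (_ ∷ ps) → ps } ; ∏-split = λ f → refl ; shorter = ℕ.n≤1+n (length xs) }
  extract {x = x} {xs = y ∷ xs} (there x∈xs) (y∉xs ∷ uniq) = record
    { rest    = y ∷ rest ex
    ; unique  = inherit ex y∉xs ∷ unique ex
    ; avoids  = (λ { refl → All.lookup y∉xs x∈xs refl }) ∷ avoids ex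
    ; inherit = λ { (p ∷ ps) → p ∷ inherit ex ps }
    ; ∏-split = λ f → trans (cong (f y *_) (∏-split ex f))
        (solve 3 (λ a b c → a :* (b :* c) := b :* (a :* c)) refl (f y) (f x) (∏ f (rest ex)))
    ; shorter = ℕ.s≤s (shorter ex)
    }
    where
    open Extraction
    ex = extract x∈xs uniq

  -- Once the coordinates of v other than a and b are fixed, Ψ v is a product
  -- of a function of the a-th and a function of the b-th coordinate.
  record Separates {m k : ℕ} (a b : Fin k) (M : ℚ) (Ψ : Vec (Fin m) k → ℚ) (v : Vec (Fin m) k) : Set where
    field
      f g : Fin m → ℚ
      A B : ℚ
      0≤f : ∀ x → 0ℚ ≤ f x
      f≤A : ∀ x → f x ≤ A
      0≤g : ∀ y → 0ℚ ≤ g y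
      g≤B : ∀ y → g y ≤ B
      0≤A : 0ℚ ≤ A
      0≤B : 0ℚ ≤ B
      A*B : A * B ≡ M
      factors : ∀ x y → Ψ ((v [ a ]≔ x) [ b ]≔ y) ≡ f x * g y

  Separable : {m k : ℕ} (a b : Fin k) (M : ℚ) → (Vec (Fin m) k → ℚ) → Set
  Separable a b M Ψ = ∀ v → Separates a b M Ψ v

  module _ {m k : ℕ} {a b : Fin k} where

    module _ {Ψ : Vec (Fin m) k → ℚ} {v : Vec (Fin m) k} {M : ℚ} (0≤M : 0ℚ ≤ M) where

      separates-fst : (f : Fin m → ℚ) → (∀ x → 0ℚ ≤ f x) → (∀ x → f x ≤ M) →
        (∀ x y → Ψ ((v [ a ]≔ x) [ b ]≔ y) ≡ f x) → Separates a b M Ψ v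
      separates-fst f 0≤f f≤M h = record
        { f = f ; g = λ _ → 1ℚ ; A = M ; B = 1ℚ ; 0≤f = 0≤f ; f≤A = f≤M ; 0≤g = λ _ → 0≤1 ; g≤B = λ _ → ℚ.≤-refl
        ; 0≤A = 0≤M ; 0≤B = 0≤1 ; A*B = ℚ.*-identityʳ M ; factors = λ x y → trans (h x y) (sym (ℚ.*-identityʳ (f x))) }

      separates-snd : (g : Fin m → ℚ) → (∀ y → 0ℚ ≤ g y) → (∀ y → g y ≤ M) →
        (∀ x y → Ψ ((v [ a ]≔ x) [ b ]≔ y) ≡ g y) → Separates a b M Ψ v
      separates-snd g 0≤g g≤M h = record
        { f = λ _ → 1ℚ ; g = g ; A = 1ℚ ; B = M ; 0≤f = λ _ → 0≤1 ; f≤A = λ _ → ℚ.≤-refl ; 0≤g = 0≤g ; g≤B = g≤M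
        ; 0≤A = 0≤1 ; 0≤B = 0≤M ; A*B = ℚ.*-identityˡ M ; factors = λ x y → trans (h x y) (sym (ℚ.*-identityˡ (g y))) }

    separable-const : ∀ {M} → 0ℚ ≤ M → Separable {m} a b M (λ _ → M)
    separable-const {M} 0≤M v = separates-fst 0≤M (λ _ → M) (λ _ → 0≤M) (λ _ → ℚ.≤-refl) (λ _ _ → refl)

    -- Since both pairs are increasing, being different as ordered pairs makes them different as
    -- sets. So at least one of `i`, `j` lies outside {a, b}, and `Q` varies with at most one of the
    -- two resampled coordinates.
    separable-pair : a Fin.< b → ∀ {i j} → i Fin.< j → (i , j) ≢ (a , b) → ∀ {M} → 0ℚ ≤ M → (Q : Fin m → Fin m → ℚ) →
      (∀ x y → 0ℚ ≤ Q x y) → (∀ x y → Q x y ≤ M) → Separable a b M (λ v → Q (lookup v i) (lookup v j))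
    separable-pair a<b {i} {j} i<j ≢ 0≤M Q 0≤Q Q≤M v with i Fin.≟ a
    ... | yes refl = separates-fst 0≤M (λ x → Q x (lookup v j)) (λ _ → 0≤Q _ _) (λ _ → Q≤M _ _)
      λ x y → cong₂ Q (lookup-update₂-fst (Fin.<⇒≢ a<b) v x y) (lookup-update₂-other (Fin.<⇒≢ i<j ∘ sym) (λ { refl → ≢ refl }) v x y)
    ... | no i≢a with i Fin.≟ b
    ...   | yes refl = separates-snd 0≤M (λ y → Q y (lookup v j)) (λ _ → 0≤Q _ _) (λ _ → Q≤M _ _)
      λ x y → cong₂ Q (lookup-update₂-snd a b v x y) (lookup-update₂-other (Fin.<⇒≢ (Fin.<-trans a<b i<j) ∘ sym) (Fin.<⇒≢ i<j ∘ sym) v x y)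
    ...   | no i≢b with j Fin.≟ a
    ...     | yes refl = separates-fst 0≤M (λ x → Q (lookup v i) x) (λ _ → 0≤Q _ _) (λ _ → Q≤M _ _)
      λ x y → cong₂ Q (lookup-update₂-other i≢a i≢b v x y) (lookup-update₂-fst (Fin.<⇒≢ a<b) v x y)
    ...     | no j≢a with j Fin.≟ b
    ...       | yes refl = separates-snd 0≤M (λ y → Q (lookup v i) y) (λ _ → 0≤Q _ _) (λ _ → Q≤M _ _)
      λ x y → cong₂ Q (lookup-update₂-other i≢a i≢b v x y) (lookup-update₂-snd a b v x y)
    ...       | no j≢b = separates-fst 0≤M (λ _ → Q (lookup v i) (lookup v j)) (λ _ → 0≤Q _ _) (λ _ → Q≤M _ _)
      λ x y → cong₂ Q (lookup-update₂-other i≢a i≢b v x y) (lookup-update₂-other j≢a j≢b v x y)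

    separable-* : ∀ {M} {Ψ Φ : Vec (Fin m) k → ℚ} → Separable a b M Ψ → Separable a b 1ℚ Φ → Separable a b M (λ v → Ψ v * Φ v)
    separable-* {M} s t v = record
      { f = λ x → S.f x * T.f x ; g = λ y → S.g y * T.g y ; A = S.A * T.A ; B = S.B * T.B
      ; 0≤f = λ x → 0≤* (S.0≤f x) (T.0≤f x) ; f≤A = λ x → *-mono (S.0≤f x) T.0≤A (S.f≤A x) (T.f≤A x)
      ; 0≤g = λ y → 0≤* (S.0≤g y) (T.0≤g y) ; g≤B = λ y → *-mono (S.0≤g y) T.0≤B (S.g≤B y) (T.g≤B y)
      ; 0≤A = 0≤* S.0≤A T.0≤A ; 0≤B = 0≤* S.0≤B T.0≤B
      ; A*B = trans (interchange S.A T.A S.B T.B) (trans (cong₂ _*_ S.A*B T.A*B) (ℚ.*-identityʳ M))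
      ; factors = λ x y → trans (cong₂ _*_ (S.factors x y) (T.factors x y)) (interchange (S.f x) (S.g y) (T.f x) (T.g y))
      }
      where
      module S = Separates (s v)
      module T = Separates (t v)
      interchange : ∀ p q r s → (p * q) * (r * s) ≡ (p * r) * (q * s)
      interchange = solve 4 (λ p q r s → (p :* q) :* (r :* s) := (p :* r) :* (q :* s)) refl

  Within : ℚ → ℚ → ℚ → Set
  Within β p q = p ≤ q + β × q ≤ p + β

  -- The counting lemma for k random points v₁, …, v_k, independent with laws μ₁, …, μ_k:
  -- the weights W p (p an active pair) behave, in the cut norm and up to β, like constants d p.
  module CountingLemma {m k : ℕ} {μ : Fin k → Fin m → ℚ} (prob : ∀ i → Probability (μ i))
    (W : Fin k × Fin k → Fin m → Fin m → ℚ) (d : Fin k × Fin k → ℚ) (β : ℚ)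
    (0≤W : ∀ p x y → 0ℚ ≤ W p x y) (W≤1 : ∀ p x y → W p x y ≤ 1ℚ)
    (0≤d : ∀ p → 0ℚ ≤ d p) (d≤1 : ∀ p → d p ≤ 1ℚ) (0≤β : 0ℚ ≤ β)
    (Active : Fin k × Fin k → Set)
    (active? : ∀ p → (Active p × proj₁ p Fin.< proj₂ p) ⊎ ((∀ x y → W p x y ≡ 1ℚ) × d p ≡ 1ℚ))
    (cut : ∀ a b → Active (a , b) → ∀ (f g : Fin m → ℚ) A B → (∀ x → 0ℚ ≤ f x) → (∀ x → f x ≤ A) → (∀ y → 0ℚ ≤ g y) → (∀ y → g y ≤ B) →
      0ℚ ≤ A → 0ℚ ≤ B →
      Within (β * (A * B)) (E₂ (μ a) (μ b) λ x y → W (a , b) x y * (f x * g y)) (d (a , b) * E₂ (μ a) (μ b) λ x y → f x * g y))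
    where

    factor : Fin k × Fin k → Vec (Fin m) k → ℚ
    factor (i , j) v = W (i , j) (lookup v i) (lookup v j)

    Φ : List (Fin k × Fin k) → Vec (Fin m) k → ℚ
    Φ L v = ∏ (λ p → factor p v) L

    separable-Φ : ∀ {a b} → a Fin.< b → ∀ L → All ((a , b) ≢_) L → Separable a b 1ℚ (Φ L)
    separable-Φ a<b [] [] = separable-const 0≤1
    separable-Φ {a} {b} a<b (p ∷ L) (≢p ∷ ≢L) = separable-* head (separable-Φ a<b L ≢L)
      where
      head : Separable a b 1ℚ (factor p)
      head with active? p
      ... | inj₁ (_ , i<j) = separable-pair a<b i<j (≢p ∘ sym) 0≤1 (W p) (0≤W p) (W≤1 p)
      ... | inj₂ (W≡1 , _) = λ v → separates-fst 0≤1 (λ _ → 1ℚ) (λ _ → 0≤1) (λ _ → ℚ.≤-refl) λ x y → W≡1 _ _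

    -- After resampling the coordinates `a` and `b`, the test function is f(x)g(y) for each frozen
    -- choice of the others. The hypothesis `cut` applies to each choice with the same error
    -- `β * M`, and averaging preserves the bound.
    replace : ∀ {a b} → Active (a , b) → a Fin.< b → ∀ {M Ψ} → Separable a b M Ψ →
      Within (β * M) (E μ λ v → factor (a , b) v * Ψ v) (d (a , b) * E μ Ψ)
    replace {a} {b} act a<b {M} {Ψ} sep =
        subst₂ _≤_ (sym lhs) (trans (E-+ μ _ _) (cong₂ _+_ (sym rhs) (E-const prob (β * M)))) (E-mono prob (proj₁ ∘ pointwise))
      , subst₂ _≤_ (sym rhs) (trans (E-+ μ _ _) (cong₂ _+_ (sym lhs) (E-const prob (β * M)))) (E-mono prob (proj₂ ∘ pointwise))
      where
      module _ (v : Vec (Fin m) k) where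
        open Separates (sep v) public
      X Y : Vec (Fin m) k → ℚ
      X v = E₂ (μ a) (μ b) λ x y → W (a , b) x y * (f v x * g v y)
      Y v = d (a , b) * E₂ (μ a) (μ b) λ x y → f v x * g v y

      pointwise : ∀ v → Within (β * M) (X v) (Y v)
      pointwise v = subst (λ t → Within (β * t) (X v) (Y v)) (A*B v)
        (cut a b act (f v) (g v) (A v) (B v) (0≤f v) (f≤A v) (0≤g v) (g≤B v) (0≤A v) (0≤B v))

      lhs : (E μ λ v → factor (a , b) v * Ψ v) ≡ E μ X
      lhs = trans (E-resample₂ prob a b _) (E-cong μ λ v → sum²-cong λ x y → cong (μ a x * μ b y *_)
        (cong₂ _*_ (cong₂ (W (a , b)) (lookup-update₂-fst (Fin.<⇒≢ a<b) v x y) (lookup-update₂-snd a b v x y)) (factors v x y)))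

      rhs : d (a , b) * E μ Ψ ≡ E μ Y
      rhs = trans (cong (d (a , b) *_) (trans (E-resample₂ prob a b Ψ)
        (E-cong μ λ v → sum²-cong λ x y → cong (μ a x * μ b y *_) (factors v x y)))) (sym (E-* μ (d (a , b)) _))

    -- Each replacement costs `β * M`. The error inherited from the rest of the list is multiplied
    -- by a density at most 1, so the errors only add up. Trivial pairs cost nothing and merely
    -- loosen the bound.
    counting : ∀ {M Ψ} → 0ℚ ≤ M → ∀ L → Unique L → (∀ {a b} → a Fin.< b → (a , b) ∈ L → Separable a b M Ψ) →
      Within (fromℕ (length L) * (β * M)) (E μ λ v → Φ L v * Ψ v) (∏ d L * E μ Ψ)
    counting {M} {Ψ} 0≤M [] [] sep = ℚ.≤-reflexive eq , ℚ.≤-reflexive eq′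
      where
      eq₀ : (E μ λ v → 1ℚ * Ψ v) ≡ 1ℚ * E μ Ψ
      eq₀ = E-* μ 1ℚ Ψ
      pad : ∀ t → t ≡ t + 0ℚ * (β * M)
      pad t = solve 2 (λ t s → t := t :+ con 0ℚ :* s) refl t (β * M)
      eq = trans eq₀ (pad (1ℚ * E μ Ψ))
      eq′ = trans (sym eq₀) (pad (E μ λ v → 1ℚ * Ψ v))
    counting {M} {Ψ} 0≤M (p@(a , b) ∷ L) (p∉L ∷ uniq) sep
      with active? p | counting 0≤M L uniq (λ a<b ∈L → sep a<b (there ∈L))
    ... | inj₂ (W≡1 , d≡1) | IH₁ , IH₂ =
        subst₂ (λ s t → s ≤ t * E μ Ψ + err) lhs rhs (ℚ.≤-trans IH₁ (ℚ.+-monoʳ-≤ (∏ d L * E μ Ψ) err-mono))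
      , subst₂ (λ s t → t * E μ Ψ ≤ s + err) lhs rhs (ℚ.≤-trans IH₂ (ℚ.+-monoʳ-≤ (E μ λ v → Φ L v * Ψ v) err-mono))
      where
      err = fromℕ (suc (length L)) * (β * M)
      err-mono : fromℕ (length L) * (β * M) ≤ err
      err-mono = *-monoʳ (0≤* 0≤β 0≤M) (fromℕ-mono (ℕ.n≤1+n (length L)))
      lhs : (E μ λ v → Φ L v * Ψ v) ≡ (E μ λ v → Φ (p ∷ L) v * Ψ v)
      lhs = E-cong μ λ v → cong (_* Ψ v) (sym (trans (cong (_* Φ L v) (W≡1 (lookup v a) (lookup v b))) (ℚ.*-identityˡ (Φ L v))))
      rhs : ∏ d L ≡ d p * ∏ d L
      rhs = sym (trans (cong (_* ∏ d L) d≡1) (ℚ.*-identityˡ (∏ d L)))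
    ... | inj₁ (act , a<b) | IH₁ , IH₂ = chain first₁ IH₁ lhs , chain′ first₂ IH₂ lhs
      where
      Ψ′ : Vec (Fin m) k → ℚ
      Ψ′ v = Ψ v * Φ L v
      err′ = fromℕ (length L) * (β * M)
      -- The factors not yet replaced join the test function. They separate at `(a , b)` because
      -- this pair does not recur in `L`.
      first = replace act a<b (separable-* (sep a<b (here refl)) (separable-Φ a<b L p∉L))
      first₁ = proj₁ first
      first₂ = proj₂ first
      lhs : (E μ λ v → factor p v * Ψ′ v) ≡ (E μ λ v → Φ (p ∷ L) v * Ψ v)
      lhs = E-cong μ λ v → solve 3 (λ w s t → w :* (s :* t) := (w :* t) :* s) refl (factor p v) (Ψ v) (Φ L v)
      comm : E μ Ψ′ ≡ (E μ λ v → Φ L v * Ψ v)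
      comm = E-cong μ λ v → ℚ.*-comm (Ψ v) (Φ L v)
      err-split : β * M + err′ ≡ fromℕ (suc (length L)) * (β * M)
      err-split = trans (solve 2 (λ s l → s :+ l :* s := (con 1ℚ :+ l) :* s) refl (β * M) (fromℕ (length L)))
        (cong (_* (β * M)) (sym (fromℕ-+ 1 (length L))))
      0≤err′ : 0ℚ ≤ err′
      0≤err′ = 0≤* (0≤fromℕ (length L)) (0≤* 0≤β 0≤M)
      open ℚ.≤-Reasoning
      chain : ∀ {X Y} → X ≤ d p * E μ Ψ′ + β * M → (E μ λ v → Φ L v * Ψ v) ≤ ∏ d L * E μ Ψ + err′ → X ≡ Y →
        Y ≤ (d p * ∏ d L) * E μ Ψ + fromℕ (suc (length L)) * (β * M)
      chain {X} {Y} h₁ h₂ X≡Y = begin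
        Y                                            ≡⟨ X≡Y ⟨
        X                                            ≤⟨ h₁ ⟩
        d p * E μ Ψ′ + β * M                         ≡⟨ cong (λ t → d p * t + β * M) comm ⟩
        d p * E μ (λ v → Φ L v * Ψ v) + β * M        ≤⟨ ℚ.+-monoˡ-≤ (β * M) (*-monoˡ (0≤d p) h₂) ⟩
        d p * (∏ d L * E μ Ψ + err′) + β * M         ≡⟨ solve 5 (λ d c e r s → d :* (c :* e :+ r) :+ s := (d :* c) :* e :+ (s :+ r :* d)) refl (d p) (∏ d L) (E μ Ψ) err′ (β * M) ⟩
        (d p * ∏ d L) * E μ Ψ + (β * M + err′ * d p) ≤⟨ ℚ.+-monoʳ-≤ ((d p * ∏ d L) * E μ Ψ) (ℚ.+-monoʳ-≤ (β * M) (p*q≤p 0≤err′ (d≤1 p))) ⟩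
        (d p * ∏ d L) * E μ Ψ + (β * M + err′)       ≡⟨ cong ((d p * ∏ d L) * E μ Ψ +_) err-split ⟩
        (d p * ∏ d L) * E μ Ψ + fromℕ (suc (length L)) * (β * M) ∎
      chain′ : ∀ {X Y} → d p * E μ Ψ′ ≤ X + β * M → ∏ d L * E μ Ψ ≤ (E μ λ v → Φ L v * Ψ v) + err′ → X ≡ Y →
        (d p * ∏ d L) * E μ Ψ ≤ Y + fromℕ (suc (length L)) * (β * M)
      chain′ {X} {Y} h₁ h₂ X≡Y = begin
        (d p * ∏ d L) * E μ Ψ                        ≡⟨ ℚ.*-assoc (d p) (∏ d L) (E μ Ψ) ⟩
        d p * (∏ d L * E μ Ψ)                        ≤⟨ *-monoˡ (0≤d p) h₂ ⟩
        d p * (E μ (λ v → Φ L v * Ψ v) + err′)       ≡⟨ cong (λ t → d p * (t + err′)) comm ⟨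
        d p * (E μ Ψ′ + err′)                        ≡⟨ solve 3 (λ d e r → d :* (e :+ r) := d :* e :+ r :* d) refl (d p) (E μ Ψ′) err′ ⟩
        d p * E μ Ψ′ + err′ * d p                    ≤⟨ ℚ.+-mono-≤ h₁ (p*q≤p 0≤err′ (d≤1 p)) ⟩
        (X + β * M) + err′                           ≡⟨ ℚ.+-assoc X (β * M) err′ ⟩
        X + (β * M + err′)                           ≡⟨ cong₂ _+_ X≡Y err-split ⟩
        Y + fromℕ (suc (length L)) * (β * M)         ∎

-- From indicators of sets to bounded test functions.

module CutNorm where

  open Inequalities
  open import Data.Rational.Base using (_*_; _≤_)
  open +-*-Solver using (solve; _:=_; _:*_; con)

  𝟙 : Bool → ℚ
  𝟙 b = if b then 1ℚ else 0ℚ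

  0≤𝟙 : ∀ b → 0ℚ ≤ 𝟙 b
  0≤𝟙 true  = 0≤1
  0≤𝟙 false = ℚ.≤-refl

  𝟙≤1 : ∀ b → 𝟙 b ≤ 1ℚ
  𝟙≤1 true  = ℚ.≤-refl
  𝟙≤1 false = 0≤1

  -- A linear form on a box attains its maximum at a vertex.
  p*s≤A*𝟙*s : ∀ {p A} s (0≤?s : Dec (0ℚ ≤ s)) → 0ℚ ≤ p → p ≤ A → p * s ≤ A * (𝟙 (does 0≤?s) * s)
  p*s≤A*𝟙*s {p} {A} s (yes 0≤s) 0≤p p≤A = ℚ.≤-trans (*-monoʳ 0≤s p≤A) (ℚ.≤-reflexive (cong (A *_) (sym (ℚ.*-identityˡ s))))
  p*s≤A*𝟙*s {p} {A} s (no 0≰s)  0≤p p≤A = ℚ.≤-trans (*-monoˡ 0≤p (ℚ.<⇒≤ (ℚ.≰⇒> 0≰s)))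
    (ℚ.≤-reflexive (solve 3 (λ p A s → p :* con 0ℚ := A :* (con 0ℚ :* s)) refl p A s))

  -- A bilinear form is linear in each argument, so `f` is moved to a vertex of its box with `g`
  -- fixed, and then `g` with the new first argument fixed. Accordingly `V` is read off from `t`,
  -- which already involves `U` in place of `f`.
  bilinear-bound : ∀ {m n} (N : Fin m → Fin n → ℚ) {β} →
    (∀ (U : Fin m → Bool) (V : Fin n → Bool) → sum (λ x → sum λ y → (𝟙 (U x) * 𝟙 (V y)) * N x y) ≤ β) →
    ∀ {f : Fin m → ℚ} {g : Fin n → ℚ} {A B} → (∀ x → 0ℚ ≤ f x) → (∀ x → f x ≤ A) → (∀ y → 0ℚ ≤ g y) → (∀ y → g y ≤ B) → 0ℚ ≤ A → 0ℚ ≤ B →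
    sum (λ x → sum λ y → (f x * g y) * N x y) ≤ (A * B) * β
  bilinear-bound N {β} cut {f} {g} {A} {B} 0≤f f≤A 0≤g g≤B 0≤A 0≤B = begin
    sum (λ x → sum λ y → (f x * g y) * N x y)
      ≡⟨ sum-cong-≗ (λ x → trans (sum-cong-≗ λ y → ℚ.*-assoc (f x) (g y) (N x y)) (sym (*-distribˡ-sum (f x) (λ y → g y * N x y)))) ⟩
    sum (λ x → f x * s x)
      ≤⟨ sum-mono (λ x → p*s≤A*𝟙*s (s x) (0ℚ ℚ.≤? s x) (0≤f x) (f≤A x)) ⟩
    sum (λ x → A * (𝟙 (U x) * s x))
      ≡⟨ *-distribˡ-sum A (λ x → 𝟙 (U x) * s x) ⟨
    A * sum (λ x → 𝟙 (U x) * s x)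
      ≡⟨ cong (A *_) (sum-cong-≗ λ x → *-distribˡ-sum (𝟙 (U x)) (λ y → g y * N x y)) ⟩
    A * sum (λ x → sum λ y → 𝟙 (U x) * (g y * N x y))
      ≡⟨ cong (A *_) (∑-comm (λ x y → 𝟙 (U x) * (g y * N x y))) ⟩
    A * sum (λ y → sum λ x → 𝟙 (U x) * (g y * N x y))
      ≡⟨ cong (A *_) (sum-cong-≗ λ y → trans (sum-cong-≗ λ x → a[bc] (𝟙 (U x)) (g y) (N x y)) (sym (*-distribˡ-sum (g y) (λ x → 𝟙 (U x) * N x y)))) ⟩
    A * sum (λ y → g y * t y)
      ≤⟨ *-monoˡ 0≤A (sum-mono λ y → p*s≤A*𝟙*s (t y) (0ℚ ℚ.≤? t y) (0≤g y) (g≤B y)) ⟩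
    A * sum (λ y → B * (𝟙 (V y) * t y))
      ≡⟨ cong (A *_) (*-distribˡ-sum B (λ y → 𝟙 (V y) * t y)) ⟨
    A * (B * sum (λ y → 𝟙 (V y) * t y))
      ≡⟨ ℚ.*-assoc A B (sum (λ y → 𝟙 (V y) * t y)) ⟨
    (A * B) * sum (λ y → 𝟙 (V y) * t y)
      ≡⟨ cong ((A * B) *_) (trans (sum-cong-≗ λ y → trans (*-distribˡ-sum (𝟙 (V y)) (λ x → 𝟙 (U x) * N x y))
            (sum-cong-≗ λ x → solve 3 (λ v u n → v :* (u :* n) := (u :* v) :* n) refl (𝟙 (V y)) (𝟙 (U x)) (N x y)))
          (∑-comm (λ y x → (𝟙 (U x) * 𝟙 (V y)) * N x y))) ⟩
    (A * B) * sum (λ x → sum λ y → (𝟙 (U x) * 𝟙 (V y)) * N x y)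
      ≤⟨ *-monoˡ (0≤* 0≤A 0≤B) (cut U V) ⟩
    (A * B) * β ∎
    where
    open ℚ.≤-Reasoning
    a[bc] : ∀ a b c → a * (b * c) ≡ b * (a * c)
    a[bc] = solve 3 (λ a b c → a :* (b :* c) := b :* (a :* c)) refl
    s = λ x → sum λ y → g y * N x y
    U = λ x → does (0ℚ ℚ.≤? s x)
    t = λ y → sum λ x → 𝟙 (U x) * N x y
    V = λ y → does (0ℚ ℚ.≤? t y)

-- A Lipschitz bound for the partial sums of the logarithm series.

module Logarithm where

  open Inequalities
  open import Data.Rational.Base using (_+_; _*_; _-_; -_; _≤_; _<_)
  open +-*-Solver using (solve; _:=_; _:+_; _:*_; _:-_; :-_; con)

  ^-0≤ : ∀ {p} → 0ℚ ≤ p → ∀ n → 0ℚ ≤ p ^ n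
  ^-0≤ 0≤p zero    = 0≤1
  ^-0≤ 0≤p (suc n) = 0≤* 0≤p (^-0≤ 0≤p n)

  module PartialSums {x y s : ℚ} (∣x∣≤s : ℚ.∣ x ∣ ≤ s) (∣y∣≤s : ℚ.∣ y ∣ ≤ s) (0≤1-s² : 0ℚ ≤ 1ℚ - s ^ 2) where

    0≤s : 0ℚ ≤ s
    0≤s = ℚ.≤-trans (ℚ.0≤∣p∣ x) ∣x∣≤s

    ∣y^∣≤s^ : ∀ n → ℚ.∣ y ^ n ∣ ≤ s ^ n
    ∣y^∣≤s^ zero    = ℚ.≤-refl
    ∣y^∣≤s^ (suc n) = subst (_≤ s * s ^ n) (sym (ℚ.∣p*q∣≡∣p∣*∣q∣ y (y ^ n))) (*-mono (ℚ.0≤∣p∣ y) (^-0≤ 0≤s n) ∣y∣≤s (∣y^∣≤s^ n))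

    D : ℚ
    D = ℚ.∣ x - y ∣

    0≤D : 0ℚ ≤ D
    0≤D = ℚ.0≤∣p∣ (x - y)

    power-diff : ∀ n → ℚ.∣ x ^ suc n - y ^ suc n ∣ ≤ fromℕ (suc n) * (s ^ n * D)
    power-diff zero = ℚ.≤-reflexive (trans
      (cong ℚ.∣_∣ (cong₂ _-_ (ℚ.*-identityʳ x) (ℚ.*-identityʳ y)))
      (solve 1 (λ d → d := con 1ℚ :* (con 1ℚ :* d)) refl D))
    power-diff (suc n) = begin
      ℚ.∣ x * X - y * Y ∣
        ≡⟨ cong ℚ.∣_∣ (solve 4 (λ x X y Y → x :* X :- y :* Y := x :* (X :- Y) :+ Y :* (x :- y)) refl x X y Y) ⟩
      ℚ.∣ x * (X - Y) + Y * (x - y) ∣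
        ≤⟨ ℚ.∣p+q∣≤∣p∣+∣q∣ (x * (X - Y)) (Y * (x - y)) ⟩
      ℚ.∣ x * (X - Y) ∣ + ℚ.∣ Y * (x - y) ∣
        ≡⟨ cong₂ _+_ (ℚ.∣p*q∣≡∣p∣*∣q∣ x (X - Y)) (ℚ.∣p*q∣≡∣p∣*∣q∣ Y (x - y)) ⟩
      ℚ.∣ x ∣ * ℚ.∣ X - Y ∣ + ℚ.∣ Y ∣ * D
        ≤⟨ ℚ.+-mono-≤ (*-mono (ℚ.0≤∣p∣ x) (0≤* (0≤fromℕ (suc n)) (0≤* (^-0≤ 0≤s n) 0≤D)) ∣x∣≤s (power-diff n))
                      (*-monoʳ 0≤D (∣y^∣≤s^ (suc n))) ⟩
      s * (fromℕ (suc n) * (s ^ n * D)) + s * s ^ n * D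
        ≡⟨ solve 4 (λ s m t d → s :* (m :* (t :* d)) :+ (s :* t) :* d := (con 1ℚ :+ m) :* ((s :* t) :* d)) refl s (fromℕ (suc n)) (s ^ n) D ⟩
      (1ℚ + fromℕ (suc n)) * (s * s ^ n * D)
        ≡⟨ cong (_* (s * s ^ n * D)) (fromℕ-+ 1 (suc n)) ⟨
      fromℕ (suc (suc n)) * (s ^ suc n * D) ∎
      where
      open ℚ.≤-Reasoning
      X = x ^ suc n
      Y = y ^ suc n

    -- The exponent brought down by the difference of powers cancels the denominator 2j+1 of the
    -- series, so that what remains is a term of a geometric series in s².
    term-diff : ∀ j → ℚ.∣ lnTerm x j - lnTerm y j ∣ ≤ fromℕ 2 * ((s ^ 2) ^ j * D)
    term-diff j = begin
      ℚ.∣ fromℕ 2 * X * r - fromℕ 2 * Y * r ∣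
        ≡⟨ cong ℚ.∣_∣ (solve 4 (λ c X Y r → c :* X :* r :- c :* Y :* r := (c :* r) :* (X :- Y)) refl (fromℕ 2) X Y r) ⟩
      ℚ.∣ (fromℕ 2 * r) * (X - Y) ∣
        ≡⟨ trans (ℚ.∣p*q∣≡∣p∣*∣q∣ (fromℕ 2 * r) (X - Y)) (cong (_* ℚ.∣ X - Y ∣) (ℚ.0≤p⇒∣p∣≡p 0≤2r)) ⟩
      (fromℕ 2 * r) * ℚ.∣ X - Y ∣
        ≤⟨ *-monoˡ 0≤2r (power-diff (2 ℕ.* j)) ⟩
      (fromℕ 2 * r) * (fromℕ (suc (2 ℕ.* j)) * (s ^ (2 ℕ.* j) * D))
        ≡⟨ solve 4 (λ c r m t → (c :* r) :* (m :* t) := (r :* m) :* (c :* t)) refl (fromℕ 2) r (fromℕ (suc (2 ℕ.* j))) (s ^ (2 ℕ.* j) * D) ⟩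
      (r * fromℕ (suc (2 ℕ.* j))) * (fromℕ 2 * (s ^ (2 ℕ.* j) * D))
        ≡⟨ trans (cong (_* (fromℕ 2 * (s ^ (2 ℕ.* j) * D))) (ℚ.*-inverseˡ (fromℕ (suc (2 ℕ.* j))))) (ℚ.*-identityˡ (fromℕ 2 * (s ^ (2 ℕ.* j) * D))) ⟩
      fromℕ 2 * (s ^ (2 ℕ.* j) * D)
        ≡⟨ cong (λ t → fromℕ 2 * (t * D)) (^-assocʳ s 2 j) ⟨
      fromℕ 2 * ((s ^ 2) ^ j * D) ∎
      where
      open ℚ.≤-Reasoning
      X = x ^ suc (2 ℕ.* j)
      Y = y ^ suc (2 ℕ.* j)
      r = ℚ.1/ fromℕ (suc (2 ℕ.* j))
      0≤2r : 0ℚ ≤ fromℕ 2 * r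
      0≤2r = 0≤* (0≤fromℕ 2) (ℚ.<⇒≤ (ℚ.positive⁻¹ r))

    -- Multiplying by 1 - s² lets the geometric series telescope without division. The bound holds
    -- at every index, so no limit has to be taken.
    partial-sums-geometric : ∀ N → (1ℚ - s ^ 2) * ℚ.∣ lnPartialSum x N - lnPartialSum y N ∣ ≤ (fromℕ 2 * D) * (1ℚ - (s ^ 2) ^ N)
    partial-sums-geometric zero = ℚ.≤-reflexive
      (solve 2 (λ q d → (con 1ℚ :- q) :* con 0ℚ := (con (fromℕ 2) :* d) :* (con 1ℚ :- con 1ℚ)) refl (s ^ 2) D)
    partial-sums-geometric (suc N) = begin
      (1ℚ - s ^ 2) * ℚ.∣ (X + u) - (Y + v) ∣
        ≤⟨ *-monoˡ 0≤1-s² (subst (λ t → ℚ.∣ t ∣ ≤ ℚ.∣ X - Y ∣ + ℚ.∣ u - v ∣)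
             (solve 4 (λ X u Y v → (X :- Y) :+ (u :- v) := (X :+ u) :- (Y :+ v)) refl X u Y v) (ℚ.∣p+q∣≤∣p∣+∣q∣ (X - Y) (u - v))) ⟩
      (1ℚ - s ^ 2) * (ℚ.∣ X - Y ∣ + ℚ.∣ u - v ∣)
        ≡⟨ ℚ.*-distribˡ-+ (1ℚ - s ^ 2) ℚ.∣ X - Y ∣ ℚ.∣ u - v ∣ ⟩
      (1ℚ - s ^ 2) * ℚ.∣ X - Y ∣ + (1ℚ - s ^ 2) * ℚ.∣ u - v ∣
        ≤⟨ ℚ.+-mono-≤ (partial-sums-geometric N) (*-monoˡ 0≤1-s² (term-diff N)) ⟩
      (fromℕ 2 * D) * (1ℚ - (s ^ 2) ^ N) + (1ℚ - s ^ 2) * (fromℕ 2 * ((s ^ 2) ^ N * D))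
        ≡⟨ solve 4 (λ c d q t → (c :* d) :* (con 1ℚ :- t) :+ (con 1ℚ :- q) :* (c :* (t :* d)) := (c :* d) :* (con 1ℚ :- q :* t)) refl (fromℕ 2) D (s ^ 2) ((s ^ 2) ^ N) ⟩
      (fromℕ 2 * D) * (1ℚ - (s ^ 2) ^ suc N) ∎
      where
      open ℚ.≤-Reasoning
      X = lnPartialSum x N
      Y = lnPartialSum y N
      u = lnTerm x N
      v = lnTerm y N

    partial-sums-lipschitz : ∀ N → (1ℚ - s ^ 2) * ℚ.∣ lnPartialSum x N - lnPartialSum y N ∣ ≤ fromℕ 2 * D
    partial-sums-lipschitz N = ℚ.≤-trans (partial-sums-geometric N) (p*q≤p (0≤* (0≤fromℕ 2) 0≤D)
      (≤-by ((s ^ 2) ^ N) (^-0≤ (^-0≤ 0≤s 2) N) (solve 1 (λ t → con 1ℚ := (con 1ℚ :- t) :+ t) refl ((s ^ 2) ^ N))))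

  lnArg-* : ∀ q (0<q : 0ℚ < q) → lnArg q 0<q * (q + 1ℚ) ≡ q - 1ℚ
  lnArg-* q 0<q = trans (ℚ.*-assoc (q - 1ℚ) _ (q + 1ℚ))
    (trans (cong ((q - 1ℚ) *_) (ℚ.*-inverseˡ (q + 1ℚ) {{_}})) (ℚ.*-identityʳ (q - 1ℚ)))

  -- The partial sums inherit the bound ln a - ln b ≤ (a - b) / b from the derivative of ln.
  module _ {a b : ℚ} (0<a : 0ℚ < a) (0<b : 0ℚ < b) (b≤a : b ≤ a) where

    private
      x = lnArg a 0<a
      y = lnArg b 0<b

      0<+1 : ∀ {q} → 0ℚ < q → 0ℚ < q + 1ℚ
      0<+1 0<q = ℚ.+-mono-< 0<q (ℚ.positive⁻¹ 1ℚ)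

      -- From (q+1)² - (q-1)² = 4q. This turns the Lipschitz constant 2/(1 - s²) into an expression
      -- in `a` or `b`.
      1-z² : ∀ {q} (0<q : 0ℚ < q) → let z = lnArg q 0<q in
        ((q + 1ℚ) * (q + 1ℚ)) * (1ℚ - ℚ.∣ z ∣ ^ 2) ≡ fromℕ 4 * q
      1-z² {q} 0<q = begin
        ((q + 1ℚ) * (q + 1ℚ)) * (1ℚ - ℚ.∣ z ∣ ^ 2)
          ≡⟨ cong (λ t → ((q + 1ℚ) * (q + 1ℚ)) * (1ℚ - t)) ∣z∣² ⟩
        ((q + 1ℚ) * (q + 1ℚ)) * (1ℚ - z * z)
          ≡⟨ solve 2 (λ q z → ((q :+ con 1ℚ) :* (q :+ con 1ℚ)) :* (con 1ℚ :- z :* z) := (q :+ con 1ℚ) :* (q :+ con 1ℚ) :- (z :* (q :+ con 1ℚ)) :* (z :* (q :+ con 1ℚ))) refl q z ⟩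
        (q + 1ℚ) * (q + 1ℚ) - (z * (q + 1ℚ)) * (z * (q + 1ℚ))
          ≡⟨ cong (λ t → (q + 1ℚ) * (q + 1ℚ) - t * t) (lnArg-* q 0<q) ⟩
        (q + 1ℚ) * (q + 1ℚ) - (q - 1ℚ) * (q - 1ℚ)
          ≡⟨ solve 1 (λ q → (q :+ con 1ℚ) :* (q :+ con 1ℚ) :- (q :- con 1ℚ) :* (q :- con 1ℚ) := con (fromℕ 4) :* q) refl q ⟩
        fromℕ 4 * q ∎
        where
        open ≡-Reasoning
        z = lnArg q 0<q
        ∣z∣² : ℚ.∣ z ∣ ^ 2 ≡ z * z
        ∣z∣² with ℚ.∣p∣≡p∨∣p∣≡-p z
        ... | inj₁ eq = trans (cong (_^ 2) eq) (cong (z *_) (ℚ.*-identityʳ z))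
        ... | inj₂ eq = trans (cong (_^ 2) eq) (solve 1 (λ z → (:- z) :* ((:- z) :* con 1ℚ) := z :* z) refl z)

      0≤1-z² : ∀ {q} (0<q : 0ℚ < q) → 0ℚ ≤ 1ℚ - ℚ.∣ lnArg q 0<q ∣ ^ 2
      0≤1-z² {q} 0<q = *-cancelˡ (0<* (0<+1 0<q) (0<+1 0<q))
        (subst₂ _≤_ (sym (ℚ.*-zeroʳ ((q + 1ℚ) * (q + 1ℚ)))) (sym (1-z² 0<q)) (0≤* (0≤fromℕ 4) (ℚ.<⇒≤ 0<q)))

      ∣x-y∣ : ((a + 1ℚ) * (b + 1ℚ)) * ℚ.∣ x - y ∣ ≡ fromℕ 2 * (a - b)
      ∣x-y∣ = begin
        c * ℚ.∣ x - y ∣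
          ≡⟨ cong (_* ℚ.∣ x - y ∣) (ℚ.0≤p⇒∣p∣≡p 0≤c) ⟨
        ℚ.∣ c ∣ * ℚ.∣ x - y ∣
          ≡⟨ ℚ.∣p*q∣≡∣p∣*∣q∣ c (x - y) ⟨
        ℚ.∣ c * (x - y) ∣
          ≡⟨ cong ℚ.∣_∣ (solve 4 (λ a b x y → ((a :+ con 1ℚ) :* (b :+ con 1ℚ)) :* (x :- y) := (x :* (a :+ con 1ℚ)) :* (b :+ con 1ℚ) :- (y :* (b :+ con 1ℚ)) :* (a :+ con 1ℚ)) refl a b x y) ⟩
        ℚ.∣ (x * (a + 1ℚ)) * (b + 1ℚ) - (y * (b + 1ℚ)) * (a + 1ℚ) ∣
          ≡⟨ cong₂ (λ s t → ℚ.∣ s * (b + 1ℚ) - t * (a + 1ℚ) ∣) (lnArg-* a 0<a) (lnArg-* b 0<b) ⟩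
        ℚ.∣ (a - 1ℚ) * (b + 1ℚ) - (b - 1ℚ) * (a + 1ℚ) ∣
          ≡⟨ cong ℚ.∣_∣ (solve 2 (λ a b → (a :- con 1ℚ) :* (b :+ con 1ℚ) :- (b :- con 1ℚ) :* (a :+ con 1ℚ) := con (fromℕ 2) :* (a :- b)) refl a b) ⟩
        ℚ.∣ fromℕ 2 * (a - b) ∣
          ≡⟨ ℚ.0≤p⇒∣p∣≡p (0≤* (0≤fromℕ 2) (p≤q⇒0≤q-p b≤a)) ⟩
        fromℕ 2 * (a - b) ∎
        where
        open ≡-Reasoning
        c = (a + 1ℚ) * (b + 1ℚ)
        0≤c = ℚ.<⇒≤ (0<* (0<+1 0<a) (0<+1 0<b))

    ln-lipschitz : ∀ N → ℚ.∣ seq (lnPos a 0<a) N - seq (lnPos b 0<b) N ∣ * b ≤ a - b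
    ln-lipschitz N with ℚ.≤-total ℚ.∣ x ∣ ℚ.∣ y ∣
    -- With s = |y| the Lipschitz bound is (a-b)(b+1)/((a+1)b), which is at most (a-b)/b since b ≤
    -- a. The common factor cancelled here only clears denominators.
    ... | inj₁ ∣x∣≤∣y∣ = *-cancelˡ {r = fromℕ 4 * (a + 1ℚ)} (0<* (ℚ.positive⁻¹ (fromℕ 4)) (0<+1 0<a)) (begin
        (fromℕ 4 * (a + 1ℚ)) * (T * b)
          ≡⟨ solve 4 (λ c a t b → (c :* a) :* (t :* b) := (a :* t) :* (c :* b)) refl (fromℕ 4) (a + 1ℚ) T b ⟩
        ((a + 1ℚ) * T) * (fromℕ 4 * b)
          ≡⟨ cong (((a + 1ℚ) * T) *_) (1-z² 0<b) ⟨
        ((a + 1ℚ) * T) * (((b + 1ℚ) * (b + 1ℚ)) * (1ℚ - ℚ.∣ y ∣ ^ 2))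
          ≡⟨ solve 4 (λ a t b s → (a :* t) :* ((b :* b) :* s) := ((a :* b) :* b) :* (s :* t)) refl (a + 1ℚ) T (b + 1ℚ) (1ℚ - ℚ.∣ y ∣ ^ 2) ⟩
        (((a + 1ℚ) * (b + 1ℚ)) * (b + 1ℚ)) * ((1ℚ - ℚ.∣ y ∣ ^ 2) * T)
          ≤⟨ *-monoˡ (ℚ.<⇒≤ (0<* (0<* (0<+1 0<a) (0<+1 0<b)) (0<+1 0<b))) (PartialSums.partial-sums-lipschitz ∣x∣≤∣y∣ ℚ.≤-refl (0≤1-z² 0<b) N) ⟩
        (((a + 1ℚ) * (b + 1ℚ)) * (b + 1ℚ)) * (fromℕ 2 * ℚ.∣ x - y ∣)
          ≡⟨ solve 4 (λ c b d t → (c :* b) :* (t :* d) := (t :* b) :* (c :* d)) refl ((a + 1ℚ) * (b + 1ℚ)) (b + 1ℚ) ℚ.∣ x - y ∣ (fromℕ 2) ⟩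
        (fromℕ 2 * (b + 1ℚ)) * (((a + 1ℚ) * (b + 1ℚ)) * ℚ.∣ x - y ∣)
          ≡⟨ cong ((fromℕ 2 * (b + 1ℚ)) *_) ∣x-y∣ ⟩
        (fromℕ 2 * (b + 1ℚ)) * (fromℕ 2 * (a - b))
          ≡⟨ solve 2 (λ b d → (con (fromℕ 2) :* b) :* (con (fromℕ 2) :* d) := (con (fromℕ 4) :* b) :* d) refl (b + 1ℚ) (a - b) ⟩
        (fromℕ 4 * (b + 1ℚ)) * (a - b)
          ≤⟨ *-monoʳ (p≤q⇒0≤q-p b≤a) (*-monoˡ (0≤fromℕ 4) (ℚ.+-monoˡ-≤ 1ℚ b≤a)) ⟩
        (fromℕ 4 * (a + 1ℚ)) * (a - b) ∎)
      where
      open ℚ.≤-Reasoning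
      T = ℚ.∣ seq (lnPos a 0<a) N - seq (lnPos b 0<b) N ∣
    -- With s = |x| the bound is (a-b)(a+1)/((b+1)a), and (a+1)/a ≤ (b+1)/b because b ≤ a.
    ... | inj₂ ∣y∣≤∣x∣ = *-cancelˡ {r = fromℕ 4 * (a * (b + 1ℚ))} (0<* (ℚ.positive⁻¹ (fromℕ 4)) (0<* 0<a (0<+1 0<b))) (begin
        (fromℕ 4 * (a * (b + 1ℚ))) * (T * b)
          ≡⟨ solve 5 (λ c a b′ t b → (c :* (a :* b′)) :* (t :* b) := ((b :* b′) :* t) :* (c :* a)) refl (fromℕ 4) a (b + 1ℚ) T b ⟩
        ((b * (b + 1ℚ)) * T) * (fromℕ 4 * a)
          ≡⟨ cong (((b * (b + 1ℚ)) * T) *_) (1-z² 0<a) ⟨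
        ((b * (b + 1ℚ)) * T) * (((a + 1ℚ) * (a + 1ℚ)) * (1ℚ - ℚ.∣ x ∣ ^ 2))
          ≡⟨ solve 5 (λ b b′ t a′ s → ((b :* b′) :* t) :* ((a′ :* a′) :* s) := ((b :* a′) :* (a′ :* b′)) :* (s :* t)) refl b (b + 1ℚ) T (a + 1ℚ) (1ℚ - ℚ.∣ x ∣ ^ 2) ⟩
        ((b * (a + 1ℚ)) * ((a + 1ℚ) * (b + 1ℚ))) * ((1ℚ - ℚ.∣ x ∣ ^ 2) * T)
          ≤⟨ *-monoˡ (ℚ.<⇒≤ (0<* (0<* 0<b (0<+1 0<a)) (0<* (0<+1 0<a) (0<+1 0<b)))) (PartialSums.partial-sums-lipschitz ℚ.≤-refl ∣y∣≤∣x∣ (0≤1-z² 0<a) N) ⟩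
        ((b * (a + 1ℚ)) * ((a + 1ℚ) * (b + 1ℚ))) * (fromℕ 2 * ℚ.∣ x - y ∣)
          ≡⟨ solve 4 (λ b c d t → (b :* c) :* (t :* d) := (t :* b) :* (c :* d)) refl (b * (a + 1ℚ)) ((a + 1ℚ) * (b + 1ℚ)) ℚ.∣ x - y ∣ (fromℕ 2) ⟩
        (fromℕ 2 * (b * (a + 1ℚ))) * (((a + 1ℚ) * (b + 1ℚ)) * ℚ.∣ x - y ∣)
          ≡⟨ cong ((fromℕ 2 * (b * (a + 1ℚ))) *_) ∣x-y∣ ⟩
        (fromℕ 2 * (b * (a + 1ℚ))) * (fromℕ 2 * (a - b))
          ≡⟨ solve 2 (λ b d → (con (fromℕ 2) :* b) :* (con (fromℕ 2) :* d) := (con (fromℕ 4) :* b) :* d) refl (b * (a + 1ℚ)) (a - b) ⟩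
        (fromℕ 4 * (b * (a + 1ℚ))) * (a - b)
          ≤⟨ *-monoʳ (p≤q⇒0≤q-p b≤a) (*-monoˡ (0≤fromℕ 4) (≤-by {b * (a + 1ℚ)} {a * (b + 1ℚ)} (a - b) (p≤q⇒0≤q-p b≤a)
               (solve 2 (λ a b → a :* (b :+ con 1ℚ) := b :* (a :+ con 1ℚ) :+ (a :- b)) refl a b))) ⟩
        (fromℕ 4 * (a * (b + 1ℚ))) * (a - b) ∎)
      where
      open ℚ.≤-Reasoning
      T = ℚ.∣ seq (lnPos a 0<a) N - seq (lnPos b 0<b) N ∣

-- Optimal values, random maps and a lower bound by the maximal weight.

module Optimum where

  open Inequalities
  open Expectation
  open CutNorm
  open import Data.Rational.Base using (_+_; _*_; _≤_)
  open +-*-Solver using (solve; _:=_; _:+_; _:*_; con)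

  foldr-⊔-upper : ∀ {n} (f : Fin n → ℚ) i → f i ≤ foldr ℚ._⊔_ 0ℚ f
  foldr-⊔-upper f zero    = ℚ.p≤p⊔q (f zero) (foldr ℚ._⊔_ 0ℚ (f ∘ suc))
  foldr-⊔-upper f (suc i) = ℚ.≤-trans (foldr-⊔-upper (f ∘ suc) i) (ℚ.p≤q⊔p (f zero) (foldr ℚ._⊔_ 0ℚ (f ∘ suc)))

  foldr-⊔-lub : ∀ {n} (f : Fin n → ℚ) {p} → 0ℚ ≤ p → (∀ i → f i ≤ p) → foldr ℚ._⊔_ 0ℚ f ≤ p
  foldr-⊔-lub {zero}  f 0≤p f≤p = 0≤p
  foldr-⊔-lub {suc n} f 0≤p f≤p = ℚ.⊔-lub (f≤p zero) (foldr-⊔-lub (f ∘ suc) 0≤p (f≤p ∘ suc))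

  foldr-⊔-0≤ : ∀ {n} (f : Fin n → ℚ) → 0ℚ ≤ foldr ℚ._⊔_ 0ℚ f
  foldr-⊔-0≤ {zero}  f = ℚ.≤-refl
  foldr-⊔-0≤ {suc n} f = ℚ.≤-trans (foldr-⊔-0≤ (f ∘ suc)) (ℚ.p≤q⊔p (f zero) (foldr ℚ._⊔_ 0ℚ (f ∘ suc)))

  module _ {n m : ℕ} (G : Structure n) (H : Structure m) where

    value≤opt : ∀ h → value G H h ≤ opt G H
    value≤opt h = subst (_≤ opt G H)
      (sum²-cong λ u v → cong₂ (λ s t → e G u v * e H s t) (Fin.finToFun-funToFin h u) (Fin.finToFun-funToFin h v))
      (foldr-⊔-upper (λ i → value G H (finToFun i)) (funToFin h))

    0≤opt : 0ℚ ≤ opt G H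
    0≤opt = foldr-⊔-0≤ (λ i → value G H (finToFun {m} {n} i))

    opt≤ : ∀ {p} → 0ℚ ≤ p → (∀ h → value G H h ≤ p) → opt G H ≤ p
    opt≤ 0≤p h = foldr-⊔-lub (λ i → value G H (finToFun i)) 0≤p (λ i → h (finToFun i))

    -- Divided by `E μ Φ` this would say that a conditional expectation of values is at most the
    -- optimum. The undivided form is meaningful even if `E μ Φ` vanishes.
    weighted-average≤opt : {l l′ : ℕ} {μ : Fin l → Fin l′ → ℚ} → (∀ i → Probability (μ i)) → (h : Vec (Fin l′) l → Fin n → Fin m) →
      (Φ : Vec (Fin l′) l → ℚ) → (∀ v → 0ℚ ≤ Φ v) → E μ (λ v → Φ v * value G H (h v)) ≤ opt G H * E μ Φ
    weighted-average≤opt {μ = μ} P h Φ 0≤Φ = ℚ.≤-trans (E-mono P λ v → *-monoˡ (0≤Φ v) (value≤opt (h v)))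
      (ℚ.≤-reflexive (trans (E-cong μ λ v → ℚ.*-comm (Φ v) (opt G H)) (E-* μ (opt G H) Φ)))

  argmax : ∀ {n} (f : Fin (suc n) → ℚ) → ∃[ i ] (∀ j → f j ≤ f i)
  argmax {zero}  f = zero , λ { zero → ℚ.≤-refl }
  argmax {suc n} f with argmax (f ∘ suc)
  ... | i , max with ℚ.≤-total (f zero) (f (suc i))
  ...   | inj₁ ≤i = suc i , λ { zero → ≤i ; (suc j) → max j }
  ...   | inj₂ i≤ = zero , λ { zero → ℚ.≤-refl ; (suc j) → ℚ.≤-trans (max j) i≤ }

  δ : ∀ {m} → Fin m → Fin m → ℚ
  δ p x = 𝟙 (does (x Fin.≟ p))

  δ-refl : ∀ {m} (p : Fin m) → δ p p ≡ 1ℚ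
  δ-refl p with p Fin.≟ p
  ... | yes _   = refl
  ... | no  p≢p = contradiction refl p≢p

  δ-≢ : ∀ {m} {p x : Fin m} → x ≢ p → δ p x ≡ 0ℚ
  δ-≢ {p = p} {x} x≢p with x Fin.≟ p
  ... | yes x≡p = contradiction x≡p x≢p
  ... | no  _   = refl

  0≤δ : ∀ {m} (p x : Fin m) → 0ℚ ≤ δ p x
  0≤δ p x = 0≤𝟙 (does (x Fin.≟ p))

  probability-δ : ∀ {m} (p : Fin m) → Probability (δ p)
  probability-δ p = record
    { 0≤μ = 0≤δ p
    ; ∑≡1 = trans (sum-single (δ p) p λ _ → δ-≢) (δ-refl p)
    }

  -- For p = q the formula degenerates to the point mass, so a maximal weight sitting on a loop of C
  -- needs no separate treatment.
  coin : ∀ {m} → Fin m → Fin m → Fin m → ℚ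
  coin p q x = ½ * (δ p x + δ q x)

  probability-coin : ∀ {m} (p q : Fin m) → Probability (coin p q)
  probability-coin p q = record
    { 0≤μ = λ x → 0≤* (ℚ.nonNegative⁻¹ ½) (0≤+ (0≤δ p x) (0≤δ q x))
    ; ∑≡1 = begin
        sum (λ x → ½ * (δ p x + δ q x))   ≡⟨ *-distribˡ-sum ½ (λ x → δ p x + δ q x) ⟨
        ½ * sum (λ x → δ p x + δ q x)     ≡⟨ cong (½ *_) (∑-distrib-+ (δ p) (δ q)) ⟩
        ½ * (sum (δ p) + sum (δ q))       ≡⟨ cong₂ (λ s t → ½ * (s + t)) (∑≡1 (probability-δ p)) (∑≡1 (probability-δ q)) ⟩
        1ℚ                                ∎
    }
    where open ≡-Reasoning

  f≤sum : ∀ {n} {f : Fin n → ℚ} → (∀ i → 0ℚ ≤ f i) → ∀ i → f i ≤ sum f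
  f≤sum {f = f} 0≤f zero    = ≤-by (sum (f ∘ suc)) (sum-0≤ (0≤f ∘ suc)) refl
  f≤sum {f = f} 0≤f (suc i) = ℚ.≤-trans (f≤sum (0≤f ∘ suc) i) (≤-by (f zero) (0≤f zero) (ℚ.+-comm (f zero) (sum (f ∘ suc))))

  -- All outcomes other than (p, q) are dropped. Each coin shows its side with probability at least
  -- ½, and with probability 1 if p = q.
  ¼≤E₂-coin : ∀ {m} (p q : Fin m) (F : Fin m → Fin m → ℚ) → (∀ x y → 0ℚ ≤ F x y) → ½ * ½ * F p q ≤ E₂ (coin p q) (coin p q) F
  ¼≤E₂-coin p q F 0≤F = ℚ.≤-trans
    (*-monoʳ (0≤F p q) (*-mono (ℚ.nonNegative⁻¹ ½) (0≤μ coin-prob q) ½≤coin-p ½≤coin-q))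
    (ℚ.≤-trans (f≤sum (0≤term p) q) (f≤sum (λ x → sum-0≤ (0≤term x)) p))
    where
    coin-prob = probability-coin p q
    0≤term : ∀ x y → 0ℚ ≤ (coin p q x * coin p q y) * F x y
    0≤term x y = 0≤* (0≤* (0≤μ coin-prob x) (0≤μ coin-prob y)) (0≤F x y)
    ½≤coin-p : ½ ≤ coin p q p
    ½≤coin-p = *-monoˡ {p = 1ℚ} {δ p p + δ q p} {½} (ℚ.nonNegative⁻¹ ½) (≤-by (δ q p) (0≤δ q p) (cong (_+ δ q p) (δ-refl p)))
    ½≤coin-q : ½ ≤ coin p q q
    ½≤coin-q = *-monoˡ {p = 1ℚ} {δ p q + δ q q} {½} (ℚ.nonNegative⁻¹ ½)
      (≤-by (δ p q) (0≤δ p q) (trans (ℚ.+-comm (δ p q) (δ q q)) (cong (_+ δ p q) (δ-refl q))))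

  fromℕ-sum : ∀ {n} (f : Fin n → ℕ) → fromℕ (ℕΣ.sum f) ≡ sum (fromℕ ∘ f)
  fromℕ-sum {zero}  f = refl
  fromℕ-sum {suc n} f = trans (fromℕ-+ (f zero) (ℕΣ.sum (f ∘ suc))) (cong (fromℕ (f zero) +_) (fromℕ-sum (f ∘ suc)))

  exclusive : ∀ {P Q : Set} (P? : Dec P) (Q? : Dec Q) → (P → ¬ Q) → ∀ b →
    fromℕ (if does P? ∧ b then 1 else 0) + fromℕ (if does Q? ∧ b then 1 else 0) ≤ 𝟙 b
  exclusive (yes p) (yes q) ¬pq b     = contradiction q (¬pq p)
  exclusive (yes p) (no _)  ¬pq true  = ℚ.≤-refl
  exclusive (no _)  (yes q) ¬pq true  = ℚ.≤-refl
  exclusive (no _)  (no _)  ¬pq true  = 0≤1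
  exclusive (yes p) (no _)  ¬pq false = ℚ.≤-refl
  exclusive (no _)  (yes q) ¬pq false = ℚ.≤-refl
  exclusive (no _)  (no _)  ¬pq false = ℚ.≤-refl

  module _ {n : ℕ} (G : Graph n) where

    arcs : ℚ
    arcs = sum λ u → sum λ v → e ⟦ G ⟧ u v

    arcs≤n² : arcs ≤ fromℕ n * fromℕ n
    arcs≤n² = ℚ.≤-trans (sum²-mono λ u v → 𝟙≤1 (adj G u v)) (ℚ.≤-reflexive (sum²-1 n))

    2∣E∣≤arcs : fromℕ 2 * fromℕ ∣E G ∣ ≤ arcs
    2∣E∣≤arcs = begin
      fromℕ 2 * fromℕ ∣E G ∣
        ≡⟨ solve 1 (λ t → con (fromℕ 2) :* t := t :+ t) refl (fromℕ ∣E G ∣) ⟩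
      fromℕ ∣E G ∣ + fromℕ ∣E G ∣
        ≡⟨ cong₂ _+_ ∣E∣≡ (trans ∣E∣≡ (∑-comm up)) ⟩
      sum (λ u → sum λ v → up u v) + sum (λ u → sum λ v → up v u)
        ≡⟨ sum²-+ up (λ u v → up v u) ⟨
      sum (λ u → sum λ v → up u v + up v u)
        ≤⟨ sum²-mono up+down≤ ⟩
      arcs ∎
      where
      open ℚ.≤-Reasoning
      up : Fin n → Fin n → ℚ
      up u v = fromℕ (if does (u Fin.<? v) ∧ adj G u v then 1 else 0)
      ∣E∣≡ : fromℕ ∣E G ∣ ≡ sum λ u → sum λ v → up u v
      ∣E∣≡ = trans (fromℕ-sum {n} _) (sum-cong-≗ {n} λ u → fromℕ-sum {n} _)
      up+down≤ : ∀ u v → up u v + up v u ≤ e ⟦ G ⟧ u v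
      up+down≤ u v rewrite symmetric G v u = exclusive (u Fin.<? v) (v Fin.<? u) (λ u<v v<u → Fin.<-asym u<v v<u) (adj G u v)

    -- Each arc contributes at least C(p,q)/4 to the expected value of a uniformly
    -- random map to {p , q}.
    opt-lower : ∀ {l} (C : Structure l) p q → fromℕ ∣E G ∣ * e C p q ≤ fromℕ 2 * opt ⟦ G ⟧ C
    opt-lower C p q = *-cancelˡ {r = ½} (ℚ.positive⁻¹ ½) (begin
      ½ * (fromℕ ∣E G ∣ * c)
        ≡⟨ solve 2 (λ E c → con ½ :* (E :* c) := (con ½ :* con ½ :* c) :* (con (fromℕ 2) :* E)) refl (fromℕ ∣E G ∣) c ⟩
      (½ * ½ * c) * (fromℕ 2 * fromℕ ∣E G ∣)
        ≤⟨ *-monoˡ (0≤* (ℚ.nonNegative⁻¹ (½ * ½)) (0≤e C p q)) 2∣E∣≤arcs ⟩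
      (½ * ½ * c) * arcs
        ≡⟨ sum²-* (½ * ½ * c) (e ⟦ G ⟧) ⟩
      sum (λ u → sum λ v → (½ * ½ * c) * e ⟦ G ⟧ u v)
        ≤⟨ sum²-mono arc ⟩
      sum (λ u → sum λ v → E μ (λ x → e ⟦ G ⟧ u v * e C (lookup x u) (lookup x v)))
        ≡⟨ E-sum² μ (λ u v x → e ⟦ G ⟧ u v * e C (lookup x u) (lookup x v)) ⟨
      E μ (λ x → value ⟦ G ⟧ C (lookup x))
        ≤⟨ E-mono P (λ x → value≤opt ⟦ G ⟧ C (lookup x)) ⟩
      E μ (λ x → opt ⟦ G ⟧ C)
        ≡⟨ E-const P (opt ⟦ G ⟧ C) ⟩
      opt ⟦ G ⟧ C
        ≡⟨ solve 1 (λ t → t := con ½ :* (con (fromℕ 2) :* t)) refl (opt ⟦ G ⟧ C) ⟩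
      ½ * (fromℕ 2 * opt ⟦ G ⟧ C) ∎)
      where
      open ℚ.≤-Reasoning
      c = e C p q
      μ : Fin n → Fin _ → ℚ
      μ _ = coin p q
      P : ∀ i → Probability (μ i)
      P _ = probability-coin p q
      arc : ∀ u v → (½ * ½ * c) * e ⟦ G ⟧ u v ≤ E μ (λ x → e ⟦ G ⟧ u v * e C (lookup x u) (lookup x v))
      arc u v with u Fin.≟ v
      -- The two ends of a loop would share one coin, so the marginal would not be a product.
      -- Looplessness makes the term vanish.
      ... | yes refl rewrite loopless G u = ℚ.≤-reflexive (trans (ℚ.*-zeroʳ (½ * ½ * c))
        (sym (trans (E-* μ 0ℚ (λ x → e C (lookup x u) (lookup x u))) (ℚ.*-zeroˡ (E μ λ x → e C (lookup x u) (lookup x u))))))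
      ... | no u≢v = begin
        (½ * ½ * c) * e ⟦ G ⟧ u v
          ≡⟨ ℚ.*-comm (½ * ½ * c) (e ⟦ G ⟧ u v) ⟩
        e ⟦ G ⟧ u v * (½ * ½ * c)
          ≤⟨ *-monoˡ (0≤e ⟦ G ⟧ u v) (¼≤E₂-coin p q (e C) (0≤e C)) ⟩
        e ⟦ G ⟧ u v * E₂ (coin p q) (coin p q) (e C)
          ≡⟨ cong (e ⟦ G ⟧ u v *_) (E-marginal₂ P u≢v (e C)) ⟨
        e ⟦ G ⟧ u v * E μ (λ x → e C (lookup x u) (lookup x v))
          ≡⟨ E-* μ (e ⟦ G ⟧ u v) (λ x → e C (lookup x u) (lookup x v)) ⟨
        E μ (λ x → e ⟦ G ⟧ u v * e C (lookup x u) (lookup x v)) ∎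

    record WeightBound {l : ℕ} (C : Structure l) : Set where
      field
        M     : ℚ
        0≤M   : 0ℚ ≤ M
        e≤M   : ∀ p q → e C p q ≤ M
        M≤opt : fromℕ ∣E G ∣ * M ≤ fromℕ 2 * opt ⟦ G ⟧ C

    weightBound : ∀ {l} (C : Structure l) → WeightBound C
    weightBound {zero} C = record
      { M = 0ℚ ; 0≤M = ℚ.≤-refl ; e≤M = λ ()
      ; M≤opt = subst (_≤ fromℕ 2 * opt ⟦ G ⟧ C) (sym (ℚ.*-zeroʳ (fromℕ ∣E G ∣))) (0≤* (0≤fromℕ 2) (0≤opt ⟦ G ⟧ C)) }
    weightBound {suc l} C with argmax (λ p → e C p (proj₁ (argmax (e C p))))
    ... | p , max = record
      { M = e C p (proj₁ (argmax (e C p))) ; 0≤M = 0≤e C p _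
      ; e≤M = λ p′ q′ → ℚ.≤-trans (proj₂ (argmax (e C p′)) q′) (max p′)
      ; M≤opt = opt-lower C p (proj₁ (argmax (e C p))) }

-- Vertex classes: block sums, uniform laws and homogeneity.

module Classes where

  open import Data.Fin.Subset using (Subset; _⊆_; ∣_∣)
  open Inequalities
  open Expectation
  open Counting using (Within)
  open CutNorm
  open Optimum
  open import Data.Rational.Base using (_+_; _*_; _-_; -_; _≤_; _<_)
  open +-*-Solver using (solve; _:=_; _:+_; _:*_; _:-_; :-_; con)

  sum-*-sum : ∀ {m n} (f : Fin m → ℚ) (g : Fin n → ℚ) → sum f * sum g ≡ sum λ x → sum λ y → f x * g y
  sum-*-sum f g = trans (*-distribʳ-sum (sum g) f) (sum-cong-≗ λ x → *-distribˡ-sum (f x) g)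

  𝟙-∧ : ∀ a b → 𝟙 (a ∧ b) ≡ 𝟙 a * 𝟙 b
  𝟙-∧ true  b = sym (ℚ.*-identityˡ (𝟙 b))
  𝟙-∧ false b = sym (ℚ.*-zeroˡ (𝟙 b))

  if-𝟙 : ∀ b p → (if b then p else 0ℚ) ≡ 𝟙 b * p
  if-𝟙 true  p = sym (ℚ.*-identityˡ p)
  if-𝟙 false p = sym (ℚ.*-zeroˡ p)

  χ : ∀ {n} → Subset n → Fin n → ℚ
  χ U u = 𝟙 (lookup U u)

  0≤χ : ∀ {n} (U : Subset n) u → 0ℚ ≤ χ U u
  0≤χ U u = 0≤𝟙 (lookup U u)

  ∣∣≡sum-χ : ∀ {n} (U : Subset n) → fromℕ ∣ U ∣ ≡ sum (χ U)
  ∣∣≡sum-χ []          = refl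
  ∣∣≡sum-χ (true ∷ U)  = trans (fromℕ-+ 1 ∣ U ∣) (cong (1ℚ +_) (∣∣≡sum-χ U))
  ∣∣≡sum-χ (false ∷ U) = trans (∣∣≡sum-χ U) (sym (ℚ.+-identityˡ (sum (χ U))))

  block : ∀ {n} → Subset n → Subset n → (Fin n → Fin n → ℚ) → ℚ
  block U V F = sum λ u → sum λ v → (χ U u * χ V v) * F u v

  module _ {n : ℕ} (U V : Subset n) where

    0≤χχ : ∀ u v → 0ℚ ≤ χ U u * χ V v
    0≤χχ u v = 0≤* (0≤χ U u) (0≤χ V v)

    block-mono : ∀ {F F′ : Fin n → Fin n → ℚ} → (∀ u v → F u v ≤ F′ u v) → block U V F ≤ block U V F′
    block-mono h = sum²-mono λ u v → *-monoˡ (0≤χχ u v) (h u v)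

    block-0≤ : ∀ {F : Fin n → Fin n → ℚ} → (∀ u v → 0ℚ ≤ F u v) → 0ℚ ≤ block U V F
    block-0≤ 0≤F = sum-0≤ λ u → sum-0≤ λ v → 0≤* (0≤χχ u v) (0≤F u v)

    block-* : ∀ c (F : Fin n → Fin n → ℚ) → block U V (λ u v → c * F u v) ≡ c * block U V F
    block-* c F = trans (sum²-cong λ u v → solve 3 (λ x c f → x :* (c :* f) := c :* (x :* f)) refl (χ U u * χ V v) c (F u v))
      (sym (sum²-* c (λ u v → (χ U u * χ V v) * F u v)))

    block-1 : block U V (λ _ _ → 1ℚ) ≡ fromℕ (∣ U ∣ ℕ.* ∣ V ∣)
    block-1 = trans (sum²-cong λ u v → ℚ.*-identityʳ (χ U u * χ V v)) (sym (begin
      fromℕ (∣ U ∣ ℕ.* ∣ V ∣)                  ≡⟨ fromℕ-* ∣ U ∣ ∣ V ∣ ⟩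
      fromℕ ∣ U ∣ * fromℕ ∣ V ∣                ≡⟨ cong₂ _*_ (∣∣≡sum-χ U) (∣∣≡sum-χ V) ⟩
      sum (χ U) * sum (χ V)                    ≡⟨ sum-*-sum (χ U) (χ V) ⟩
      sum (λ u → sum λ v → χ U u * χ V v)      ∎))
      where open ≡-Reasoning

    w≡block : (G : Structure n) → w G U V ≡ block U V (e G)
    w≡block G = sum²-cong λ u v → trans (if-𝟙 (lookup U u ∧ lookup V v) (e G u v)) (cong (_* e G u v) (𝟙-∧ (lookup U u) (lookup V v)))

  block-transpose : ∀ {n} (U V : Subset n) (F : Fin n → Fin n → ℚ) → block U V F ≡ block V U (λ v u → F u v)
  block-transpose U V F = trans (∑-comm (λ u v → (χ U u * χ V v) * F u v)) (sum²-cong λ v u → cong (_* F u v) (ℚ.*-comm (χ U u) (χ V v)))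

  -- For m = 0 the two bounds force p = 0, so the convention for division by zero keeps the identity
  -- true for empty classes as well.
  ⊘-* : ∀ m {p} → 0ℚ ≤ p → p ≤ fromℕ m → (p ⊘ m) * fromℕ m ≡ p
  ⊘-* zero    0≤p p≤0 = ℚ.≤-antisym 0≤p p≤0
  ⊘-* (suc m) {p} _ _ = trans (ℚ.*-assoc p (ℚ.1/ fromℕ (suc m)) (fromℕ (suc m)))
    (trans (cong (p *_) (ℚ.*-inverseˡ (fromℕ (suc m)))) (ℚ.*-identityʳ p))

  ⊘-≤1 : ∀ m {p} → 0ℚ ≤ p → p ≤ fromℕ m → p ⊘ m ≤ 1ℚ
  ⊘-≤1 zero    _ _ = 0≤1
  ⊘-≤1 (suc m) {p} 0≤p p≤m = *-cancelˡ {r = fromℕ (suc m)} (ℚ.positive⁻¹ (fromℕ (suc m)))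
    (subst₂ _≤_ (trans (sym (⊘-* (suc m) 0≤p p≤m)) (ℚ.*-comm (p ⊘ suc m) (fromℕ (suc m)))) (sym (ℚ.*-identityʳ (fromℕ (suc m)))) p≤m)

  module _ {n : ℕ} (G : Graph n) (U V : Subset n) where

    0≤w : 0ℚ ≤ w ⟦ G ⟧ U V
    0≤w = subst (0ℚ ≤_) (sym (w≡block U V ⟦ G ⟧)) (block-0≤ U V (0≤e ⟦ G ⟧))

    w≤∣∣ : w ⟦ G ⟧ U V ≤ fromℕ (∣ U ∣ ℕ.* ∣ V ∣)
    w≤∣∣ = subst₂ _≤_ (sym (w≡block U V ⟦ G ⟧)) (block-1 U V) (block-mono U V λ u v → 𝟙≤1 (adj G u v))

    pairDensity-* : pairDensity G U V * fromℕ (∣ U ∣ ℕ.* ∣ V ∣) ≡ w ⟦ G ⟧ U V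
    pairDensity-* = ⊘-* (∣ U ∣ ℕ.* ∣ V ∣) 0≤w w≤∣∣

    pairDensity≤1 : pairDensity G U V ≤ 1ℚ
    pairDensity≤1 = ⊘-≤1 (∣ U ∣ ℕ.* ∣ V ∣) 0≤w w≤∣∣

    -- By the convention p ⊘ 0 = 0, a pair with an empty class has density 0. Dense pairs therefore
    -- never meet the point mass that stands in for the uniform law on the empty set.
    0<pairDensity⇒nonempty : 0ℚ < pairDensity G U V → ∣ U ∣ ℕ.* ∣ V ∣ ≢ 0
    0<pairDensity⇒nonempty 0<d with ∣ U ∣ ℕ.* ∣ V ∣
    ... | zero  = contradiction 0<d (ℚ.<-irrefl refl)
    ... | suc _ = λ ()

  -- The uniform distribution on U; a point mass at x₀ if U is empty.
  module Uniform {n : ℕ} (x₀ : Fin n) where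

    -- The size is a separate argument so that it can be matched on while the set stays a variable;
    -- it is tied to the set only where an equation is supplied.
    law : ℕ → Subset n → Fin n → ℚ
    law zero    U x = δ x₀ x
    law (suc m) U x = χ U x * ℚ.1/ fromℕ (suc m)

    uniform : Subset n → Fin n → ℚ
    uniform U = law ∣ U ∣ U

    probability-law : ∀ m U → fromℕ m ≡ sum (χ U) → Probability (law m U)
    probability-law zero    U eq = probability-δ x₀
    probability-law (suc m) U eq = record
      { 0≤μ = λ x → 0≤* (0≤χ U x) (ℚ.<⇒≤ (ℚ.positive⁻¹ (ℚ.1/ fromℕ (suc m))))
      ; ∑≡1 = trans (sym (*-distribʳ-sum (ℚ.1/ fromℕ (suc m)) (χ U)))
          (trans (cong (_* ℚ.1/ fromℕ (suc m)) (sym eq)) (ℚ.*-inverseʳ (fromℕ (suc m))))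
      }

    probability-uniform : ∀ U → Probability (uniform U)
    probability-uniform U = probability-law ∣ U ∣ U (∣∣≡sum-χ U)

    law-* : ∀ m U x → m ≢ 0 → fromℕ m * law m U x ≡ χ U x
    law-* zero    U x m≢0 = contradiction refl m≢0
    law-* (suc m) U x _   = trans (solve 3 (λ m c r → m :* (c :* r) := c :* (m :* r)) refl (fromℕ (suc m)) (χ U x) (ℚ.1/ fromℕ (suc m)))
      (trans (cong (χ U x *_) (ℚ.*-inverseʳ (fromℕ (suc m)))) (ℚ.*-identityʳ (χ U x)))

    E₂-uniform : ∀ U V → ∣ U ∣ ℕ.* ∣ V ∣ ≢ 0 → (F : Fin n → Fin n → ℚ) →
      fromℕ (∣ U ∣ ℕ.* ∣ V ∣) * E₂ (uniform U) (uniform V) F ≡ block U V F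
    E₂-uniform U V ≢0 F = trans (cong (_* E₂ (uniform U) (uniform V) F) (fromℕ-* ∣ U ∣ ∣ V ∣))
      (trans (sum²-* (fromℕ ∣ U ∣ * fromℕ ∣ V ∣) (λ x y → (uniform U x * uniform V y) * F x y))
      (sum²-cong λ x y → trans
        (solve 5 (λ m n s t f → (m :* n) :* ((s :* t) :* f) := ((m :* s) :* (n :* t)) :* f) refl (fromℕ ∣ U ∣) (fromℕ ∣ V ∣) (uniform U x) (uniform V y) (F x y))
        (cong (_* F x y) (cong₂ _*_ (law-* ∣ U ∣ U x ∣U∣≢0) (law-* ∣ V ∣ V y ∣V∣≢0)))))
      where
      ∣U∣≢0 : ∣ U ∣ ≢ 0
      ∣U∣≢0 eq = ≢0 (cong (ℕ._* ∣ V ∣) eq)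
      ∣V∣≢0 : ∣ V ∣ ≢ 0
      ∣V∣≢0 eq = ≢0 (trans (cong (∣ U ∣ ℕ.*_) eq) (ℕ.*-zeroʳ ∣ U ∣))

    module _ (G : Graph n) {U V : Subset n} {β : ℚ}
      (homogeneous : ∀ U′ V′ → U′ ⊆ U → V′ ⊆ V →
        ℚ.∣ w ⟦ G ⟧ U′ V′ - pairDensity G U V * fromℕ (∣ U′ ∣ ℕ.* ∣ V′ ∣) ∣ ≤ β * fromℕ (∣ U ∣ ℕ.* ∣ V ∣))
      where

      private
        d = pairDensity G U V
        size = fromℕ (∣ U ∣ ℕ.* ∣ V ∣)
        A = e ⟦ G ⟧

        restrict : Subset n → (Fin n → Bool) → Subset n
        restrict U f = tabulate λ x → lookup U x ∧ f x

        restrict⊆ : ∀ U f → restrict U f ⊆ U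
        restrict⊆ U f {x} x∈ = Vec.lookup⇒[]= x U (∧-true (lookup U x) (f x)
          (trans (sym (Vec.lookup∘tabulate (λ x → lookup U x ∧ f x) x)) (Vec.[]=⇒lookup x∈)))
          where
          ∧-true : ∀ a b → a ∧ b ≡ true → a ≡ true
          ∧-true true b eq = refl

        χ-restrict : ∀ U f x → χ (restrict U f) x ≡ χ U x * 𝟙 (f x)
        χ-restrict U f x = trans (cong 𝟙 (Vec.lookup∘tabulate (λ x → lookup U x ∧ f x) x)) (𝟙-∧ (lookup U x) (f x))

        discrepancy : Fin n → Fin n → ℚ
        discrepancy x y = (χ U x * χ V y) * (A x y - d)

        indicator-discrepancy : ∀ f g →
          sum (λ x → sum λ y → (𝟙 (f x) * 𝟙 (g y)) * discrepancy x y) ≡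
          w ⟦ G ⟧ (restrict U f) (restrict V g) - d * fromℕ (∣ restrict U f ∣ ℕ.* ∣ restrict V g ∣)
        indicator-discrepancy f g = begin
          sum (λ x → sum λ y → (𝟙 (f x) * 𝟙 (g y)) * discrepancy x y)
            ≡⟨ sum²-cong (λ x y → trans
                 (solve 6 (λ u v f g a d → (f :* g) :* ((u :* v) :* (a :- d)) := ((u :* f) :* (v :* g)) :* a :+ (:- d) :* (((u :* f) :* (v :* g)) :* con 1ℚ)) refl (χ U x) (χ V y) (𝟙 (f x)) (𝟙 (g y)) (A x y) d)
                 (cong₂ (λ s t → (s * t) * A x y + (- d) * ((s * t) * 1ℚ)) (sym (χ-restrict U f x)) (sym (χ-restrict V g y)))) ⟩
          sum (λ x → sum λ y → (χ U′ x * χ V′ y) * A x y + (- d) * ((χ U′ x * χ V′ y) * 1ℚ))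
            ≡⟨ sum²-+ (λ x y → (χ U′ x * χ V′ y) * A x y) (λ x y → (- d) * ((χ U′ x * χ V′ y) * 1ℚ)) ⟩
          block U′ V′ A + sum (λ x → sum λ y → (- d) * ((χ U′ x * χ V′ y) * 1ℚ))
            ≡⟨ cong₂ _+_ (w≡block U′ V′ ⟦ G ⟧) (sum²-* (- d) (λ x y → (χ U′ x * χ V′ y) * 1ℚ)) ⟨
          w ⟦ G ⟧ U′ V′ + (- d) * block U′ V′ (λ _ _ → 1ℚ)
            ≡⟨ cong (λ t → w ⟦ G ⟧ U′ V′ + (- d) * t) (block-1 U′ V′) ⟩
          w ⟦ G ⟧ U′ V′ + (- d) * fromℕ (∣ U′ ∣ ℕ.* ∣ V′ ∣)
            ≡⟨ cong (w ⟦ G ⟧ U′ V′ +_) (ℚ.neg-distribˡ-* d (fromℕ (∣ U′ ∣ ℕ.* ∣ V′ ∣))) ⟨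
          w ⟦ G ⟧ U′ V′ - d * fromℕ (∣ U′ ∣ ℕ.* ∣ V′ ∣) ∎
          where
          open ≡-Reasoning
          U′ = restrict U f
          V′ = restrict V g

      -- Homogeneity bounds the discrepancy on the rectangles cut out by indicator tests, and
      -- `bilinear-bound` extends this to all bounded product tests. As that bound is one-sided, it
      -- is applied to the discrepancy and to its negative. Multiplying by `size` turns expectations
      -- into block sums.
      cut-uniform : ∣ U ∣ ℕ.* ∣ V ∣ ≢ 0 → ∀ (f g : Fin n → ℚ) A B →
        (∀ x → 0ℚ ≤ f x) → (∀ x → f x ≤ A) → (∀ y → 0ℚ ≤ g y) → (∀ y → g y ≤ B) → 0ℚ ≤ A → 0ℚ ≤ B →
        Within (β * (A * B)) (E₂ (uniform U) (uniform V) λ x y → e ⟦ G ⟧ x y * (f x * g y)) (d * E₂ (uniform U) (uniform V) λ x y → f x * g y)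
      cut-uniform ≢0 f g A′ B 0≤f f≤A 0≤g g≤B 0≤A 0≤B = *-cancelˡ 0<size upper , *-cancelˡ 0<size lower
        where
        open ℚ.≤-Reasoning
        X = E₂ (uniform U) (uniform V) λ x y → A x y * (f x * g y)
        Y = E₂ (uniform U) (uniform V) λ x y → f x * g y
        AB = A′ * B
        0<size : 0ℚ < size
        0<size = 0<fromℕ ≢0

        bilinear = bilinear-bound discrepancy (λ f g → subst (_≤ β * size) (sym (indicator-discrepancy f g))
          (∣∣≤⇒≤ (homogeneous (restrict U f) (restrict V g) (restrict⊆ U f) (restrict⊆ V g)))) 0≤f f≤A 0≤g g≤B 0≤A 0≤B

        bilinear⁻ = bilinear-bound (λ x y → - discrepancy x y) (λ f g → subst (_≤ β * size)
          (sym (trans (trans (sum²-cong λ x y → solve 2 (λ a b → a :* (:- b) := con (- 1ℚ) :* (a :* b)) refl (𝟙 (f x) * 𝟙 (g y)) (discrepancy x y))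
            (sym (sum²-* (- 1ℚ) (λ x y → (𝟙 (f x) * 𝟙 (g y)) * discrepancy x y)))) (trans (cong (- 1ℚ *_) (indicator-discrepancy f g))
            (solve 1 (λ t → con (- 1ℚ) :* t := :- t) refl (w ⟦ G ⟧ (restrict U f) (restrict V g) - d * fromℕ (∣ restrict U f ∣ ℕ.* ∣ restrict V g ∣))))))
          (∣∣≤⇒-≤ (homogeneous (restrict U f) (restrict V g) (restrict⊆ U f) (restrict⊆ V g)))) 0≤f f≤A 0≤g g≤B 0≤A 0≤B

        size*X : size * X ≡ block U V (λ x y → A x y * (f x * g y))
        size*X = E₂-uniform U V ≢0 (λ x y → A x y * (f x * g y))
        size*dY : size * (d * Y) ≡ block U V (λ x y → d * (f x * g y))
        size*dY = trans (solve 3 (λ s d y → s :* (d :* y) := d :* (s :* y)) refl size d Y)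
          (trans (cong (d *_) (E₂-uniform U V ≢0 (λ x y → f x * g y))) (sym (block-* U V d (λ x y → f x * g y))))

        error : AB * (β * size) ≡ size * (β * AB)
        error = solve 3 (λ c b s → c :* (b :* s) := s :* (b :* c)) refl AB β size

        upper : size * X ≤ size * (d * Y + β * AB)
        upper = begin
          size * X
            ≡⟨ size*X ⟩
          block U V (λ x y → A x y * (f x * g y))
            ≡⟨ sum²-cong (λ x y → solve 4 (λ c a d t → c :* (a :* t) := t :* (c :* (a :- d)) :+ c :* (d :* t)) refl (χ U x * χ V y) (A x y) d (f x * g y)) ⟩
          sum (λ x → sum λ y → (f x * g y) * discrepancy x y + (χ U x * χ V y) * (d * (f x * g y)))
            ≡⟨ sum²-+ (λ x y → (f x * g y) * discrepancy x y) (λ x y → (χ U x * χ V y) * (d * (f x * g y))) ⟩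
          sum (λ x → sum λ y → (f x * g y) * discrepancy x y) + block U V (λ x y → d * (f x * g y))
            ≤⟨ ℚ.+-mono-≤ bilinear (ℚ.≤-reflexive (sym size*dY)) ⟩
          AB * (β * size) + size * (d * Y)
            ≡⟨ cong (_+ size * (d * Y)) error ⟩
          size * (β * AB) + size * (d * Y)
            ≡⟨ solve 3 (λ s p q → s :* p :+ s :* q := s :* (q :+ p)) refl size (β * AB) (d * Y) ⟩
          size * (d * Y + β * AB) ∎

        lower : size * (d * Y) ≤ size * (X + β * AB)
        lower = begin
          size * (d * Y)
            ≡⟨ size*dY ⟩
          block U V (λ x y → d * (f x * g y))
            ≡⟨ sum²-cong (λ x y → solve 4 (λ c a d t → c :* (d :* t) := t :* (:- (c :* (a :- d))) :+ c :* (a :* t)) refl (χ U x * χ V y) (A x y) d (f x * g y)) ⟩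
          sum (λ x → sum λ y → (f x * g y) * (- discrepancy x y) + (χ U x * χ V y) * (A x y * (f x * g y)))
            ≡⟨ sum²-+ (λ x y → (f x * g y) * (- discrepancy x y)) (λ x y → (χ U x * χ V y) * (A x y * (f x * g y))) ⟩
          sum (λ x → sum λ y → (f x * g y) * (- discrepancy x y)) + block U V (λ x y → A x y * (f x * g y))
            ≤⟨ ℚ.+-mono-≤ bilinear⁻ (ℚ.≤-reflexive (sym size*X)) ⟩
          AB * (β * size) + size * X
            ≡⟨ cong (_+ size * X) error ⟩
          size * (β * AB) + size * X
            ≡⟨ solve 3 (λ s p q → s :* p :+ s :* q := s :* (q :+ p)) refl size (β * AB) X ⟩
          size * (X + β * AB) ∎

-- Comparison of a graph with its quotient.

module Quotient where

  open import Data.Fin.Subset using (_⊆_; ∣_∣)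
  open Inequalities
  open Expectation
  open Counting
  open CutNorm
  open Logarithm using (^-0≤)
  open Optimum
  open Classes
  open import Data.Rational.Base using (_+_; _*_; _-_; -_; _≤_; _<_)
  open +-*-Solver using (solve; _:=_; _:+_; _:*_; _:-_; :-_; con)

  module _ {n k : ℕ} (P : Partition n k) where

    χ-single : ∀ v j → j ≢ proj₁ (covers P v) → χ (class P j) v ≡ 0ℚ
    χ-single v j j≢ with lookup (class P j) v in eq
    ... | true  = contradiction (disjoint P (Vec.lookup⇒[]= v (class P j) eq) (proj₂ (covers P v))) j≢
    ... | false = refl

    ∑χ≡1 : ∀ v → sum (λ i → χ (class P i) v) ≡ 1ℚ
    ∑χ≡1 v = trans (sum-single (λ i → χ (class P i) v) (proj₁ (covers P v)) (χ-single v))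
      (cong 𝟙 (Vec.[]=⇒lookup (proj₂ (covers P v))))

    sum-classes : (f : Fin n → ℚ) → sum f ≡ sum λ i → sum λ v → χ (class P i) v * f v
    sum-classes f = sym (begin
      sum (λ i → sum λ v → χ (class P i) v * f v)     ≡⟨ ∑-comm (λ i v → χ (class P i) v * f v) ⟩
      sum (λ v → sum λ i → χ (class P i) v * f v)     ≡⟨ sum-cong-≗ (λ v → sym (*-distribʳ-sum (f v) (λ i → χ (class P i) v))) ⟩
      sum (λ v → sum (λ i → χ (class P i) v) * f v)   ≡⟨ sum-cong-≗ (λ v → trans (cong (_* f v) (∑χ≡1 v)) (ℚ.*-identityˡ (f v))) ⟩
      sum f                                           ∎)
      where open ≡-Reasoning

    sum-blocks : (F : Fin n → Fin n → ℚ) → (sum λ u → sum λ v → F u v) ≡ sum λ i → sum λ j → block (class P i) (class P j) F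
    sum-blocks F = begin
      sum (λ u → sum λ v → F u v)
        ≡⟨ sum-cong-≗ (λ u → sum-classes (F u)) ⟩
      sum (λ u → sum λ j → sum λ v → χ (class P j) v * F u v)
        ≡⟨ sum-classes (λ u → sum λ j → sum λ v → χ (class P j) v * F u v) ⟩
      sum (λ i → sum λ u → χ (class P i) u * sum (λ j → sum λ v → χ (class P j) v * F u v))
        ≡⟨ sum²-cong (λ i u → sum²-* (χ (class P i) u) (λ j v → χ (class P j) v * F u v)) ⟩
      sum (λ i → sum λ u → sum λ j → sum λ v → χ (class P i) u * (χ (class P j) v * F u v))
        ≡⟨ sum-cong-≗ (λ i → ∑-comm (λ u j → sum λ v → χ (class P i) u * (χ (class P j) v * F u v))) ⟩
      sum (λ i → sum λ j → sum λ u → sum λ v → χ (class P i) u * (χ (class P j) v * F u v))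
        ≡⟨ sum²-cong (λ i j → sum²-cong λ u v → sym (ℚ.*-assoc (χ (class P i) u) (χ (class P j) v) (F u v))) ⟩
      sum (λ i → sum λ j → block (class P i) (class P j) F) ∎
      where open ≡-Reasoning

  length-cartesianProduct : ∀ {A B : Set} (xs : List A) (ys : List B) → length (cartesianProduct xs ys) ≡ length xs ℕ.* length ys
  length-cartesianProduct []       ys = refl
  length-cartesianProduct (x ∷ xs) ys = trans (List.length-++ (List.map (x ,_) ys))
    (cong₂ ℕ._+_ (List.length-map (x ,_) ys) (length-cartesianProduct xs ys))

  select : {A : Set} → Dec A → ℚ → ℚ
  select A? p = if does A? then p else 1ℚ

  -- The equations hold for all `p` because a single decision governs both the edge indicator and
  -- the density of a pair.
  select-cases : {A : Set} (A? : Dec A) → (A × ∀ p → select A? p ≡ p) ⊎ ((¬ A) × ∀ p → select A? p ≡ 1ℚ)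
  select-cases (yes a) = inj₁ (a , λ _ → refl)
  select-cases (no ¬a) = inj₂ (¬a , λ _ → refl)

  select-elim : {A : Set} (A? : Dec A) (B : ℚ → Set) {p : ℚ} → (A → B p) → B 1ℚ → B (select A? p)
  select-elim (yes a) B Bp B1 = Bp a
  select-elim (no _)  B Bp B1 = B1

  module _ (k : ℕ) .{{_ : NonZero k}} where

    0<1/k : 0ℚ < ℤ.+ 1 / k
    0<1/k = ℚ.positive⁻¹ (ℤ.+ 1 / k) {{ℚ.normalize-pos 1 k}}

    1/k≤1 : ℤ.+ 1 / k ≤ 1ℚ
    1/k≤1 = subst₂ _≤_ (ℚ.*-identityʳ (ℤ.+ 1 / k)) (fromℕ-/ 1 k) (*-monoˡ (ℚ.<⇒≤ 0<1/k) (fromℕ-mono (ℕ.>-nonZero⁻¹ k)))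

  -- Of the 8k² factors D, k² are set aside to match the lower bound for `Δ`, two cancel the factor
  -- k² through D k = 1, one is the D on the right, and the others are at most 1. Splitting these
  -- off uses 3 ≤ 7k², which holds as k ≥ 1.
  1/k^8k² : ∀ k .{{_ : NonZero k}} → let D = ℤ.+ 1 / k in fromℕ (k ℕ.* k) * D ^ (8 ℕ.* (k ℕ.* k)) ≤ D ^ (k ℕ.* k) * D
  1/k^8k² k = begin
    fromℕ (k ℕ.* k) * D ^ (8 ℕ.* K)
      ≡⟨ cong₂ _*_ (fromℕ-* k k) (trans (^-homo-* D K (7 ℕ.* K)) (cong (D ^ K *_) (trans (cong (D ^_) (sym (ℕ.m+[n∸m]≡n 3≤7K))) (^-homo-* D 3 (7 ℕ.* K ℕ.∸ 3))))) ⟩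
    (fromℕ k * fromℕ k) * (D ^ K * (D ^ 3 * D ^ (7 ℕ.* K ℕ.∸ 3)))
      ≡⟨ solve 4 (λ k d p q → (k :* k) :* (p :* ((d :* (d :* (d :* con 1ℚ))) :* q)) := (p :* d) :* (((d :* k) :* (d :* k)) :* q)) refl (fromℕ k) D (D ^ K) (D ^ (7 ℕ.* K ℕ.∸ 3)) ⟩
    (D ^ K * D) * (((D * fromℕ k) * (D * fromℕ k)) * D ^ (7 ℕ.* K ℕ.∸ 3))
      ≡⟨ cong (λ t → (D ^ K * D) * ((t * t) * D ^ (7 ℕ.* K ℕ.∸ 3))) (fromℕ-/ 1 k) ⟩
    (D ^ K * D) * (1ℚ * D ^ (7 ℕ.* K ℕ.∸ 3))
      ≤⟨ p*q≤p (0≤* (^-0≤ 0≤D K) 0≤D) (subst (_≤ 1ℚ) (sym (ℚ.*-identityˡ (D ^ (7 ℕ.* K ℕ.∸ 3)))) (^≤1 (7 ℕ.* K ℕ.∸ 3))) ⟩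
    D ^ K * D ∎
    where
    open ℚ.≤-Reasoning
    D = ℤ.+ 1 / k
    K = k ℕ.* k
    0≤D : 0ℚ ≤ D
    0≤D = ℚ.<⇒≤ (0<1/k k)
    1≤k : 1 ℕ.≤ k
    1≤k = ℕ.>-nonZero⁻¹ k
    3≤7K : 3 ℕ.≤ 7 ℕ.* K
    3≤7K = ℕ.≤-trans (ℕ.m≤m+n 3 4) (ℕ.*-monoʳ-≤ 7 (ℕ.*-mono-≤ 1≤k 1≤k))
    ^≤1 : ∀ m → D ^ m ≤ 1ℚ
    ^≤1 zero    = ℚ.≤-refl
    ^≤1 (suc m) = p*q≤1 0≤D (1/k≤1 k) (^≤1 m)

  -- Random representatives of the classes of a regular partition.

  module RegularQuotient {n k : ℕ} (x₀ : Fin n) (G : Graph n) (P : Partition n k) {D β : ℚ}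
    (0<D : 0ℚ < D) (D≤1 : D ≤ 1ℚ) (0≤β : 0ℚ ≤ β)
    (β-small : fromℕ (k ℕ.* k) * β ≤ D ^ (k ℕ.* k) * D)
    (class-size : ∀ i → fromℕ ∣ class P i ∣ ≤ 1ℚ + D * fromℕ n)
    (homogeneous : ∀ i j → i ≢ j → ∀ U V → U ⊆ class P i → V ⊆ class P j →
      ℚ.∣ w ⟦ G ⟧ U V - pairDensity G (class P i) (class P j) * fromℕ (∣ U ∣ ℕ.* ∣ V ∣) ∣ ≤ β * fromℕ (∣ class P i ∣ ℕ.* ∣ class P j ∣))
    where

    open Uniform x₀

    A : Fin n → Fin n → ℚ
    A = e ⟦ G ⟧

    0≤D : 0ℚ ≤ D
    0≤D = ℚ.<⇒≤ 0<D

    μ : Fin k → Fin n → ℚ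
    μ i = uniform (class P i)

    prob : ∀ i → Probability (μ i)
    prob i = probability-uniform (class P i)

    size : Fin k → Fin k → ℚ
    size i j = fromℕ (∣ class P i ∣ ℕ.* ∣ class P j ∣)

    density′ : Fin k × Fin k → ℚ
    density′ (i , j) = pairDensity G (class P i) (class P j)

    -- The order picks one of (i,j) and (j,i): the two indicators depend on the same two points, so
    -- with both present neither would be separable relative to the other. The threshold D keeps the
    -- product `Δ` away from 0.
    Active : Fin k × Fin k → Set
    Active p = proj₁ p Fin.< proj₂ p × D ≤ density′ p

    active? : ∀ p → Dec (Active p)
    active? p = (proj₁ p Fin.<? proj₂ p) ×-dec (D ℚ.≤? density′ p)

    active-nonempty : ∀ {i j} → D ≤ density′ (i , j) → ∣ class P i ∣ ℕ.* ∣ class P j ∣ ≢ 0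
    active-nonempty {i} {j} D≤d = 0<pairDensity⇒nonempty G (class P i) (class P j) (ℚ.<-≤-trans 0<D D≤d)

    W : Fin k × Fin k → Fin n → Fin n → ℚ
    W p x y = select (active? p) (A x y)

    d : Fin k × Fin k → ℚ
    d p = select (active? p) (density′ p)

    D≤d : ∀ p → D ≤ d p
    D≤d p = select-elim (active? p) (D ≤_) proj₂ D≤1

    d≤1 : ∀ p → d p ≤ 1ℚ
    d≤1 p@(i , j) = select-elim (active? p) (_≤ 1ℚ) (λ _ → pairDensity≤1 G (class P i) (class P j)) ℚ.≤-refl

    0≤d : ∀ p → 0ℚ ≤ d p
    0≤d p = ℚ.≤-trans 0≤D (D≤d p)

    0≤W : ∀ p x y → 0ℚ ≤ W p x y
    0≤W p x y = select-elim (active? p) (0ℚ ≤_) (λ _ → 0≤e ⟦ G ⟧ x y) 0≤1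

    W≤1 : ∀ p x y → W p x y ≤ 1ℚ
    W≤1 p x y = select-elim (active? p) (_≤ 1ℚ) (λ _ → 𝟙≤1 (adj G x y)) ℚ.≤-refl

    -- Activity together with the equation that resolves `select`, so that estimates for adjacency
    -- and density transfer to `W` and `d` without deciding again.
    Selected : Fin k × Fin k → Set
    Selected p = Active p × (∀ t → select (active? p) t ≡ t)

    selected-or-trivial : ∀ p → (Selected p × proj₁ p Fin.< proj₂ p) ⊎ ((∀ x y → W p x y ≡ 1ℚ) × d p ≡ 1ℚ)
    selected-or-trivial p with select-cases (active? p)
    ... | inj₁ (act , eq) = inj₁ ((act , eq) , proj₁ act)
    ... | inj₂ (_ , eq)   = inj₂ ((λ x y → eq (A x y)) , eq (density′ p))

    selected-cut : ∀ i j → Selected (i , j) → ∀ (f g : Fin n → ℚ) B B′ →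
      (∀ x → 0ℚ ≤ f x) → (∀ x → f x ≤ B) → (∀ y → 0ℚ ≤ g y) → (∀ y → g y ≤ B′) → 0ℚ ≤ B → 0ℚ ≤ B′ →
      Within (β * (B * B′)) (E₂ (μ i) (μ j) λ x y → W (i , j) x y * (f x * g y)) (d (i , j) * E₂ (μ i) (μ j) λ x y → f x * g y)
    selected-cut i j ((i<j , D≤d) , eq) f g B B′ 0≤f f≤B 0≤g g≤B′ 0≤B 0≤B′ = subst₂ (Within (β * (B * B′)))
      (sum²-cong λ x y → cong (λ t → (μ i x * μ j y) * (t * (f x * g y))) (sym (eq (A x y))))
      (cong (_* E₂ (μ i) (μ j) (λ x y → f x * g y)) (sym (eq (density′ (i , j)))))
      (cut-uniform G {class P i} {class P j} {β} (homogeneous i j (Fin.<⇒≢ i<j)) (active-nonempty D≤d) f g B B′ 0≤f f≤B 0≤g g≤B′ 0≤B 0≤B′)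

    module Count = CountingLemma prob W d β 0≤W W≤1 0≤d d≤1 0≤β Selected selected-or-trivial selected-cut

    -- All k² ordered pairs are listed, inactive ones contributing the factor 1. The length, and
    -- with it the exponent of D and the number of errors, is then independent of the graph.
    pairs : List (Fin k × Fin k)
    pairs = cartesianProduct (allFin k) (allFin k)

    pairs-unique : Unique pairs
    pairs-unique = Unique.cartesianProduct⁺ (Unique.allFin⁺ k) (Unique.allFin⁺ k)

    ∈-pairs : ∀ p → p ∈ pairs
    ∈-pairs (i , j) = Membership.∈-cartesianProduct⁺ (Membership.∈-allFin i) (Membership.∈-allFin j)

    length-pairs : length pairs ≡ k ℕ.* k
    length-pairs = trans (length-cartesianProduct (allFin k) (allFin k)) (cong (λ m → m ℕ.* m) (List.length-tabulate {n = k} id))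

    -- The indicator of the conditioning event: each active pair of representatives spans an edge.
    Φ : Vec (Fin n) k → ℚ
    Φ = Count.Φ pairs

    0≤Φ : ∀ v → 0ℚ ≤ Φ v
    0≤Φ v = ∏-0≤ (λ p → 0≤W p (lookup v (proj₁ p)) (lookup v (proj₂ p))) pairs

    -- The probability of the event `Φ`, up to `κ`.
    Δ : ℚ
    Δ = ∏ d pairs

    κ : ℚ
    κ = fromℕ (k ℕ.* k) * β

    0≤κ : 0ℚ ≤ κ
    0≤κ = 0≤* (0≤fromℕ (k ℕ.* k)) 0≤β

    D^k²≤Δ : D ^ (k ℕ.* k) ≤ Δ
    D^k²≤Δ = subst (λ m → D ^ m ≤ Δ) length-pairs (∏-lower 0≤D D≤d pairs)

    0<Δ : 0ℚ < Δ
    0<Δ = ℚ.<-≤-trans (0<^ (k ℕ.* k)) D^k²≤Δ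
      where
      0<^ : ∀ m → 0ℚ < D ^ m
      0<^ zero    = ℚ.positive⁻¹ 1ℚ
      0<^ (suc m) = 0<* 0<D (0<^ m)

    0≤Δ : 0ℚ ≤ Δ
    0≤Δ = ℚ.<⇒≤ 0<Δ

    κ≤ΔD : κ ≤ Δ * D
    κ≤ΔD = ℚ.≤-trans β-small (*-monoʳ 0≤D D^k²≤Δ)

    EΦ≤ : E μ Φ ≤ Δ + κ
    EΦ≤ = subst₂ _≤_ (E-cong μ λ v → ℚ.*-identityʳ (Φ v))
      (cong₂ _+_ (trans (cong (Δ *_) (E-const prob 1ℚ)) (ℚ.*-identityʳ Δ)) (cong₂ _*_ (cong fromℕ length-pairs) (ℚ.*-identityʳ β)))
      (proj₁ (Count.counting 0≤1 pairs pairs-unique λ _ _ → separable-const 0≤1))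

    wᵢⱼ : Fin k → Fin k → ℚ
    wᵢⱼ i j = w ⟦ G ⟧ (class P i) (class P j)

    0≤wᵢⱼ : ∀ i j → 0ℚ ≤ wᵢⱼ i j
    0≤wᵢⱼ i j = 0≤w G (class P i) (class P j)

    module _ {M : ℚ} (0≤M : 0ℚ ≤ M) where

      X : Fin k → Fin k → (Fin n → Fin n → ℚ) → ℚ
      X i j c = block (class P i) (class P j) λ u v → A u v * c u v

      Y : Fin k → Fin k → (Fin n → Fin n → ℚ) → ℚ
      Y i j c = E μ λ v → Φ v * c (lookup v i) (lookup v j)

      X≤M*w : ∀ i j {c} → (∀ u v → c u v ≤ M) → X i j c ≤ M * wᵢⱼ i j
      X≤M*w i j {c} c≤M = begin
        X i j c                                             ≤⟨ block-mono (class P i) (class P j) (λ u v → *-monoˡ (0≤e ⟦ G ⟧ u v) (c≤M u v)) ⟩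
        block (class P i) (class P j) (λ u v → A u v * M)   ≡⟨ sum²-cong (λ u v → cong ((χ (class P i) u * χ (class P j) v) *_) (ℚ.*-comm (A u v) M)) ⟩
        block (class P i) (class P j) (λ u v → M * A u v)   ≡⟨ block-* (class P i) (class P j) M A ⟩
        M * block (class P i) (class P j) A                 ≡⟨ cong (M *_) (w≡block (class P i) (class P j) ⟦ G ⟧) ⟨
        M * wᵢⱼ i j                                         ∎
        where open ℚ.≤-Reasoning

      -- `X` is what the edges between two classes contribute to the value of a map of G. Up to the
      -- errors, `Y` divided by `Δ` is the conditional expectation of the weight on the two
      -- representatives. The first error comes from counting, the second from sparse pairs;
      -- allowing both gives dense and sparse pairs the same shape.
      PairBound : Fin k → Fin k → (Fin n → Fin n → ℚ) → Set
      PairBound i j c = Δ * X i j c ≤ wᵢⱼ i j * Y i j c + (wᵢⱼ i j * (κ * M) + (Δ * M) * (D * size i j))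

      module _ {c : Fin n → Fin n → ℚ} (0≤c : ∀ u v → 0ℚ ≤ c u v) (c≤M : ∀ u v → c u v ≤ M) where

        0≤Y : ∀ i j → 0ℚ ≤ Y i j c
        0≤Y i j = subst (_≤ Y i j c) (E-0 μ) (E-mono prob λ v → 0≤* (0≤Φ v) (0≤c (lookup v i) (lookup v j)))

        0≤wκM : ∀ i j → 0ℚ ≤ wᵢⱼ i j * (κ * M)
        0≤wκM i j = 0≤* (0≤wᵢⱼ i j) (0≤* 0≤κ 0≤M)

        0≤ΔMD : ∀ i j → 0ℚ ≤ (Δ * M) * (D * size i j)
        0≤ΔMD i j = 0≤* (0≤* 0≤Δ 0≤M) (0≤* 0≤D (0≤fromℕ (∣ class P i ∣ ℕ.* ∣ class P j ∣)))

        sparse-bound : ∀ i j → ¬ (D ≤ density′ (i , j)) → PairBound i j c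
        sparse-bound i j D≰d = begin
          Δ * X i j c
            ≤⟨ *-monoˡ 0≤Δ (X≤M*w i j c≤M) ⟩
          Δ * (M * wᵢⱼ i j)
            ≡⟨ cong (λ t → Δ * (M * t)) (pairDensity-* G (class P i) (class P j)) ⟨
          Δ * (M * (density′ (i , j) * size i j))
            ≤⟨ *-monoˡ 0≤Δ (*-monoˡ 0≤M (*-monoʳ (0≤fromℕ (∣ class P i ∣ ℕ.* ∣ class P j ∣)) (ℚ.<⇒≤ (ℚ.≰⇒> D≰d)))) ⟩
          Δ * (M * (D * size i j))
            ≡⟨ ℚ.*-assoc Δ M (D * size i j) ⟨
          (Δ * M) * (D * size i j)
            ≤⟨ ≤-by (wᵢⱼ i j * Y i j c + wᵢⱼ i j * (κ * M)) (0≤+ (0≤* (0≤wᵢⱼ i j) (0≤Y i j)) (0≤wκM i j))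
                 (solve 3 (λ p q r → p :+ (q :+ r) := r :+ (p :+ q)) refl (wᵢⱼ i j * Y i j c) (wᵢⱼ i j * (κ * M)) ((Δ * M) * (D * size i j))) ⟩
          wᵢⱼ i j * Y i j c + (wᵢⱼ i j * (κ * M) + (Δ * M) * (D * size i j)) ∎
          where open ℚ.≤-Reasoning

        -- The density of (i,j) is split off `Δ` and, multiplied by the number of pairs, becomes the
        -- quotient weight. What is left is the average of adjacency times weight over all pairs,
        -- which is the expectation of a function of two representatives. Counting inserts the
        -- indicators of the other pairs into that expectation.
        dense-bound : ∀ {i j} → Active (i , j) → (∀ t → select (active? (i , j)) t ≡ t) → PairBound i j c
        dense-bound {i} {j} (i<j , D≤dᵢⱼ) eq = begin
          Δ * X i j c
            ≡⟨ cong₂ _*_ (trans (∏-split d) (cong (_* ∏ d rest) (eq (density′ (i , j))))) (sym (E₂-uniform (class P i) (class P j) (active-nonempty D≤dᵢⱼ) Q)) ⟩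
          (density′ (i , j) * ∏ d rest) * (size i j * E₂ (μ i) (μ j) Q)
            ≡⟨ solve 4 (λ a b c d → (a :* b) :* (c :* d) := (a :* c) :* (b :* d)) refl (density′ (i , j)) (∏ d rest) (size i j) (E₂ (μ i) (μ j) Q) ⟩
          (density′ (i , j) * size i j) * (∏ d rest * E₂ (μ i) (μ j) Q)
            ≡⟨ cong₂ (λ s t → s * (∏ d rest * t)) (pairDensity-* G (class P i) (class P j)) (sym (E-marginal₂ prob (Fin.<⇒≢ i<j) Q)) ⟩
          wᵢⱼ i j * (∏ d rest * E μ Ψ)
            ≤⟨ *-monoˡ (0≤wᵢⱼ i j) (proj₂ (Count.counting 0≤M rest unique sep)) ⟩
          wᵢⱼ i j * (E μ (λ v → Count.Φ rest v * Ψ v) + fromℕ (length rest) * (β * M))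
            ≤⟨ *-monoˡ (0≤wᵢⱼ i j) (ℚ.+-mono-≤ (ℚ.≤-reflexive merge) error) ⟩
          wᵢⱼ i j * (Y i j c + κ * M)
            ≤⟨ ≤-by ((Δ * M) * (D * size i j)) (0≤ΔMD i j)
                 (solve 4 (λ w y k r → w :* y :+ (w :* k :+ r) := w :* (y :+ k) :+ r) refl (wᵢⱼ i j) (Y i j c) (κ * M) ((Δ * M) * (D * size i j))) ⟩
          wᵢⱼ i j * Y i j c + (wᵢⱼ i j * (κ * M) + (Δ * M) * (D * size i j)) ∎
          where
          open ℚ.≤-Reasoning
          open Extraction (extract (∈-pairs (i , j)) pairs-unique)
          Q : Fin n → Fin n → ℚ
          Q x y = A x y * c x y
          Ψ : Vec (Fin n) k → ℚ
          Ψ v = Q (lookup v i) (lookup v j)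
          sep : ∀ {a b} → a Fin.< b → (a , b) ∈ rest → Separable a b M Ψ
          sep a<b ab∈ = separable-pair a<b i<j (All.lookup avoids ab∈) 0≤M Q (λ x y → 0≤* (0≤e ⟦ G ⟧ x y) (0≤c x y))
            (λ x y → ℚ.≤-trans (subst (A x y * c x y ≤_) (ℚ.*-identityˡ (c x y)) (*-monoʳ (0≤c x y) (𝟙≤1 (adj G x y)))) (c≤M x y))
          -- The adjacency inside `Ψ` is exactly the factor missing from the remaining product, so
          -- `Φ` is restored without error.
          merge : E μ (λ v → Count.Φ rest v * Ψ v) ≡ Y i j c
          merge = E-cong μ λ v → begin-equality
            Count.Φ rest v * (A (lookup v i) (lookup v j) * c (lookup v i) (lookup v j))
              ≡⟨ solve 3 (λ f a c → f :* (a :* c) := (a :* f) :* c) refl (Count.Φ rest v) (A (lookup v i) (lookup v j)) (c (lookup v i) (lookup v j)) ⟩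
            (A (lookup v i) (lookup v j) * Count.Φ rest v) * c (lookup v i) (lookup v j)
              ≡⟨ cong (λ t → (t * Count.Φ rest v) * c (lookup v i) (lookup v j)) (eq (A (lookup v i) (lookup v j))) ⟨
            (W (i , j) (lookup v i) (lookup v j) * Count.Φ rest v) * c (lookup v i) (lookup v j)
              ≡⟨ cong (_* c (lookup v i) (lookup v j)) (∏-split (λ p → Count.factor p v)) ⟨
            Φ v * c (lookup v i) (lookup v j) ∎
          error : fromℕ (length rest) * (β * M) ≤ κ * M
          error = ℚ.≤-trans (*-monoʳ (0≤* 0≤β 0≤M) (fromℕ-mono (subst (length rest ℕ.≤_) length-pairs shorter)))
            (ℚ.≤-reflexive (sym (ℚ.*-assoc (fromℕ (k ℕ.* k)) β M)))

        ordered-bound : ∀ {i j} → i Fin.< j → PairBound i j c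
        ordered-bound {i} {j} i<j with select-cases (active? (i , j))
        ... | inj₁ (act , eq)   = dense-bound act eq
        ... | inj₂ (inact , _)  = sparse-bound i j λ D≤d → inact (i<j , D≤d)

      -- One representative per class carries no information about edges inside the class, so the
      -- diagonal is estimated trivially by the maximal weight; `δ i j` lets one formula cover all
      -- pairs. Decreasing pairs reduce to increasing ones by the symmetry of G.
      pair-bound : ∀ i j {c} → (∀ u v → 0ℚ ≤ c u v) → (∀ u v → c u v ≤ M) →
        Δ * X i j c ≤ (wᵢⱼ i j * Y i j c + (wᵢⱼ i j * (κ * M) + (Δ * M) * (D * size i j))) + (Δ * M) * (δ i j * wᵢⱼ i j)
      pair-bound i j {c} 0≤c c≤M = split (Fin.<-cmp i j)
        where
        rhs : ℚ
        rhs = wᵢⱼ i j * Y i j c + (wᵢⱼ i j * (κ * M) + (Δ * M) * (D * size i j))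
        diagonal : ℚ
        diagonal = (Δ * M) * (δ i j * wᵢⱼ i j)
        0≤diagonal : 0ℚ ≤ diagonal
        0≤diagonal = 0≤* (0≤* 0≤Δ 0≤M) (0≤* (0≤δ i j) (0≤wᵢⱼ i j))
        transposed : PairBound j i (λ u v → c v u) → PairBound i j c
        transposed = subst₂ (λ x y → Δ * x ≤ y)
          (trans (block-transpose (class P j) (class P i) (λ u v → A u v * c v u))
            (sum²-cong λ u v → cong (λ t → (χ (class P i) u * χ (class P j) v) * (𝟙 t * c u v)) (symmetric G v u)))
          (cong₂ (λ x y → x * Y i j c + (x * (κ * M) + (Δ * M) * (D * fromℕ y))) wⱼᵢ≡wᵢⱼ (ℕ.*-comm ∣ class P j ∣ ∣ class P i ∣))
          where
          wⱼᵢ≡wᵢⱼ : wᵢⱼ j i ≡ wᵢⱼ i j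
          wⱼᵢ≡wᵢⱼ = trans (w≡block (class P j) (class P i) ⟦ G ⟧) (trans (block-transpose (class P j) (class P i) A)
            (trans (sum²-cong λ u v → cong (λ t → (χ (class P i) u * χ (class P j) v) * 𝟙 t) (symmetric G v u))
              (sym (w≡block (class P i) (class P j) ⟦ G ⟧))))
        off-diagonal : PairBound i j c → Δ * X i j c ≤ rhs + diagonal
        off-diagonal h = ℚ.≤-trans h (≤-by {rhs} diagonal 0≤diagonal refl)
        split : Tri (i Fin.< j) (i ≡ j) (j Fin.< i) → Δ * X i j c ≤ rhs + diagonal
        split (tri< i<j _ _)  = off-diagonal (ordered-bound 0≤c c≤M i<j)
        split (tri> _ _ j<i)  = off-diagonal (transposed (ordered-bound (λ u v → 0≤c v u) (λ u v → c≤M v u) j<i))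
        split (tri≈ _ refl _) = begin
          Δ * X i i c                           ≤⟨ *-monoˡ 0≤Δ (X≤M*w i i c≤M) ⟩
          Δ * (M * wᵢⱼ i i)                     ≡⟨ solve 3 (λ d m w → d :* (m :* w) := (d :* m) :* (con 1ℚ :* w)) refl Δ M (wᵢⱼ i i) ⟩
          (Δ * M) * (1ℚ * wᵢⱼ i i)              ≡⟨ cong (λ t → (Δ * M) * (t * wᵢⱼ i i)) (δ-refl i) ⟨
          diagonal                              ≤⟨ ≤-by rhs 0≤rhs (ℚ.+-comm rhs diagonal) ⟩
          rhs + diagonal                        ∎
          where
          open ℚ.≤-Reasoning
          0≤rhs : 0ℚ ≤ rhs
          0≤rhs = 0≤+ (0≤* (0≤wᵢⱼ i j) (0≤Y 0≤c c≤M i j)) (0≤+ (0≤wκM 0≤c c≤M i j) (0≤ΔMD 0≤c c≤M i j))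

    N : ℚ
    N = fromℕ n

    0≤N : 0ℚ ≤ N
    0≤N = 0≤fromℕ n

    ∑∑w≤N² : (sum λ i → sum λ j → wᵢⱼ i j) ≤ N * N
    ∑∑w≤N² = subst (_≤ N * N) (trans (sum-blocks P A) (sum²-cong λ i j → sym (w≡block (class P i) (class P j) ⟦ G ⟧))) (arcs≤n² G)

    ∑∑size≡N² : (sum λ i → sum λ j → size i j) ≡ N * N
    ∑∑size≡N² = trans (sum²-cong λ i j → sym (block-1 (class P i) (class P j))) (trans (sym (sum-blocks P λ _ _ → 1ℚ)) (sum²-1 n))

    ∑∣class∣≡N : (sum λ i → fromℕ ∣ class P i ∣) ≡ N
    ∑∣class∣≡N = trans (sum-cong-≗ λ i → trans (∣∣≡sum-χ (class P i)) (sum-cong-≗ λ v → sym (ℚ.*-identityʳ (χ (class P i) v))))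
      (trans (sym (sum-classes P λ _ → 1ℚ)) (trans (sum-const n 1ℚ) (ℚ.*-identityʳ N)))

    -- A vertex is not adjacent to itself, so it has at most ∣V∣ - 1 ≤ D n neighbours in its own class V.
    neighbours-in-class : ∀ i u → (sum λ v → χ (class P i) v * A u v) + χ (class P i) u ≤ 1ℚ + D * N
    neighbours-in-class i u = begin
      sum (λ v → χ V v * A u v) + χ V u
        ≡⟨ cong (sum (λ v → χ V v * A u v) +_) (trans (sym (trans (cong (_* χ V u) (δ-refl u)) (ℚ.*-identityˡ (χ V u))))
             (sym (sum-single (λ v → δ u v * χ V v) u λ v v≢u → trans (cong (_* χ V v) (δ-≢ v≢u)) (ℚ.*-zeroˡ (χ V v))))) ⟩
      sum (λ v → χ V v * A u v) + sum (λ v → δ u v * χ V v)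
        ≡⟨ ∑-distrib-+ (λ v → χ V v * A u v) (λ v → δ u v * χ V v) ⟨
      sum (λ v → χ V v * A u v + δ u v * χ V v)
        ≤⟨ sum-mono pointwise ⟩
      sum (χ V)
        ≡⟨ ∣∣≡sum-χ V ⟨
      fromℕ ∣ V ∣
        ≤⟨ class-size i ⟩
      1ℚ + D * N ∎
      where
      open ℚ.≤-Reasoning
      V = class P i
      pointwise : ∀ v → χ V v * A u v + δ u v * χ V v ≤ χ V v
      pointwise v = split (v Fin.≟ u)
        where
        split : Dec (v ≡ u) → χ V v * A u v + δ u v * χ V v ≤ χ V v
        split (yes refl) = ℚ.≤-reflexive (trans (cong₂ (λ s t → χ V v * 𝟙 s + t * χ V v) (loopless G v) (δ-refl v))
          (solve 1 (λ x → x :* con 0ℚ :+ con 1ℚ :* x := x) refl (χ V v)))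
        split (no v≢u) = ℚ.≤-trans (ℚ.≤-reflexive (trans (cong (λ t → χ V v * A u v + t * χ V v) (δ-≢ v≢u))
          (solve 2 (λ x a → x :* a :+ con 0ℚ :* x := x :* a) refl (χ V v) (A u v)))) (p*q≤p (0≤χ V v) (𝟙≤1 (adj G u v)))

    wᵢᵢ≤ : ∀ i → wᵢⱼ i i ≤ (D * N) * fromℕ ∣ class P i ∣
    wᵢᵢ≤ i = begin
      wᵢⱼ i i
        ≡⟨ w≡block V V ⟦ G ⟧ ⟩
      block V V A
        ≡⟨ sum-cong-≗ (λ u → trans (sum-cong-≗ λ v → ℚ.*-assoc (χ V u) (χ V v) (A u v)) (sym (*-distribˡ-sum (χ V u) (λ v → χ V v * A u v)))) ⟩
      sum (λ u → χ V u * sum (λ v → χ V v * A u v))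
        ≤⟨ sum-mono (λ u → restrict (lookup V u) (neighbours-in-class i u)) ⟩
      sum (λ u → χ V u * (D * N))
        ≡⟨ *-distribʳ-sum (D * N) (χ V) ⟨
      sum (χ V) * (D * N)
        ≡⟨ trans (ℚ.*-comm (sum (χ V)) (D * N)) (cong ((D * N) *_) (sym (∣∣≡sum-χ V))) ⟩
      (D * N) * fromℕ ∣ V ∣ ∎
      where
      open ℚ.≤-Reasoning
      V = class P i
      -- For u in the class its own indicator is 1 and cancels the 1 lost in rounding the class
      -- size. For u outside, both sides vanish.
      restrict : ∀ b {p q} → p + 𝟙 b ≤ 1ℚ + q → 𝟙 b * p ≤ 𝟙 b * q
      restrict true {p} {q} h = *-monoˡ 0≤1 (subst₂ _≤_
        (solve 1 (λ p → (p :+ con 1ℚ) :- con 1ℚ := p) refl p) (solve 1 (λ q → (con 1ℚ :+ q) :- con 1ℚ := q) refl q) (ℚ.+-monoˡ-≤ (- 1ℚ) h))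
      restrict false {p} {q} h = ℚ.≤-reflexive (trans (ℚ.*-zeroˡ p) (sym (ℚ.*-zeroˡ q)))

    ∑diagonal≤ : (sum λ i → sum λ j → δ i j * wᵢⱼ i j) ≤ D * (N * N)
    ∑diagonal≤ = begin
      sum (λ i → sum λ j → δ i j * wᵢⱼ i j)
        ≡⟨ sum-cong-≗ (λ i → trans (sum-single (λ j → δ i j * wᵢⱼ i j) i λ j j≢i → trans (cong (_* wᵢⱼ i j) (δ-≢ j≢i)) (ℚ.*-zeroˡ (wᵢⱼ i j)))
             (trans (cong (_* wᵢⱼ i i) (δ-refl i)) (ℚ.*-identityˡ (wᵢⱼ i i)))) ⟩
      sum (λ i → wᵢⱼ i i)
        ≤⟨ sum-mono wᵢᵢ≤ ⟩
      sum (λ i → (D * N) * fromℕ ∣ class P i ∣)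
        ≡⟨ *-distribˡ-sum (D * N) (λ i → fromℕ ∣ class P i ∣) ⟨
      (D * N) * sum (λ i → fromℕ ∣ class P i ∣)
        ≡⟨ trans (cong ((D * N) *_) ∑∣class∣≡N) (ℚ.*-assoc D N N) ⟩
      D * (N * N) ∎
      where open ℚ.≤-Reasoning

    module _ {l : ℕ} (C : Structure l) {M : ℚ} (0≤M : 0ℚ ≤ M) (e≤M : ∀ p q → e C p q ≤ M) where

      private
        b = opt (G ⟋ P) C

        0≤b : 0ℚ ≤ b
        0≤b = 0≤opt (G ⟋ P) C

      -- By linearity the left side is the expectation of `Φ` times the value of the random map i ↦
      -- h(vᵢ) of the quotient, and each such value is at most `b`.
      ∑∑wY≤ : (h : Fin n → Fin l) → (sum λ i → sum λ j → wᵢⱼ i j * Y 0≤M i j (λ u v → e C (h u) (h v))) ≤ b * (Δ + κ)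
      ∑∑wY≤ h = begin
        sum (λ i → sum λ j → wᵢⱼ i j * Y 0≤M i j c)
          ≡⟨ sum²-cong (λ i j → sym (E-* μ (wᵢⱼ i j) (λ v → Φ v * c (lookup v i) (lookup v j)))) ⟩
        sum (λ i → sum λ j → E μ (λ v → wᵢⱼ i j * (Φ v * c (lookup v i) (lookup v j))))
          ≡⟨ E-sum² μ (λ i j v → wᵢⱼ i j * (Φ v * c (lookup v i) (lookup v j))) ⟨
        E μ (λ v → sum λ i → sum λ j → wᵢⱼ i j * (Φ v * c (lookup v i) (lookup v j)))
          ≡⟨ E-cong μ (λ v → trans (sum²-cong λ i j → solve 3 (λ w f c → w :* (f :* c) := f :* (w :* c)) refl (wᵢⱼ i j) (Φ v) (c (lookup v i) (lookup v j)))
               (sym (sum²-* (Φ v) (λ i j → wᵢⱼ i j * c (lookup v i) (lookup v j))))) ⟩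
        E μ (λ v → Φ v * value (G ⟋ P) C (h ∘ lookup v))
          ≤⟨ weighted-average≤opt (G ⟋ P) C prob (λ v → h ∘ lookup v) Φ 0≤Φ ⟩
        b * E μ Φ
          ≤⟨ *-monoˡ 0≤b EΦ≤ ⟩
        b * (Δ + κ) ∎
        where
        open ℚ.≤-Reasoning
        c : Fin n → Fin n → ℚ
        c u v = e C (h u) (h v)

      -- All errors become multiples of `Δ` through κ ≤ Δ D, and then `Δ` cancels. The term D b
      -- arises since `E μ Φ` may exceed `Δ` by `κ`. The three copies of D M n² come from counting,
      -- from sparse pairs and from edges inside classes.
      value≤ : ∀ h → value ⟦ G ⟧ C h ≤ (b + D * b) + fromℕ 3 * (D * (M * (N * N)))
      value≤ h = *-cancelˡ 0<Δ (begin
        Δ * value ⟦ G ⟧ C h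
          ≡⟨ cong (Δ *_) (sum-blocks P λ u v → A u v * c u v) ⟩
        Δ * sum (λ i → sum λ j → X 0≤M i j c)
          ≡⟨ sum²-* Δ (λ i j → X 0≤M i j c) ⟩
        sum (λ i → sum λ j → Δ * X 0≤M i j c)
          ≤⟨ sum²-mono (λ i j → pair-bound 0≤M i j (λ u v → 0≤e C (h u) (h v)) (λ u v → e≤M (h u) (h v))) ⟩
        sum (λ i → sum λ j → (wᵢⱼ i j * Y 0≤M i j c + (wᵢⱼ i j * (κ * M) + (Δ * M) * (D * size i j))) + (Δ * M) * (δ i j * wᵢⱼ i j))
          ≡⟨ trans (sum²-+ (λ i j → wᵢⱼ i j * Y 0≤M i j c + (wᵢⱼ i j * (κ * M) + (Δ * M) * (D * size i j))) (λ i j → (Δ * M) * (δ i j * wᵢⱼ i j)))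
               (cong (_+ T₄) (trans (sum²-+ (λ i j → wᵢⱼ i j * Y 0≤M i j c) (λ i j → wᵢⱼ i j * (κ * M) + (Δ * M) * (D * size i j)))
                 (cong (T₁ +_) (sum²-+ (λ i j → wᵢⱼ i j * (κ * M)) (λ i j → (Δ * M) * (D * size i j)))))) ⟩
        (T₁ + (T₂ + T₃)) + T₄
          ≤⟨ ℚ.+-mono-≤ (ℚ.+-mono-≤ (∑∑wY≤ h) (ℚ.+-mono-≤ T₂≤ T₃≤)) T₄≤ ⟩
        (b * (Δ + κ) + (κ * M * (N * N) + (Δ * M) * (D * (N * N)))) + (Δ * M) * (D * (N * N))
          ≤⟨ ℚ.+-monoˡ-≤ ((Δ * M) * (D * (N * N))) (ℚ.+-mono-≤ (*-monoˡ 0≤b (ℚ.+-monoʳ-≤ Δ κ≤ΔD))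
               (ℚ.+-monoˡ-≤ ((Δ * M) * (D * (N * N))) (*-monoʳ (0≤* 0≤N 0≤N) (*-monoʳ 0≤M κ≤ΔD)))) ⟩
        (b * (Δ + Δ * D) + (Δ * D * M * (N * N) + (Δ * M) * (D * (N * N)))) + (Δ * M) * (D * (N * N))
          ≡⟨ solve 5 (λ b x d m s → (b :* (x :+ x :* d) :+ (x :* d :* m :* s :+ (x :* m) :* (d :* s))) :+ (x :* m) :* (d :* s) := x :* ((b :+ d :* b) :+ con (fromℕ 3) :* (d :* (m :* s)))) refl b Δ D M (N * N) ⟩
        Δ * ((b + D * b) + fromℕ 3 * (D * (M * (N * N)))) ∎)
        where
        open ℚ.≤-Reasoning
        c : Fin n → Fin n → ℚ
        c u v = e C (h u) (h v)
        T₁ = sum λ i → sum λ j → wᵢⱼ i j * Y 0≤M i j c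
        T₂ = sum λ i → sum λ j → wᵢⱼ i j * (κ * M)
        T₃ = sum λ i → sum λ j → (Δ * M) * (D * size i j)
        T₄ = sum λ i → sum λ j → (Δ * M) * (δ i j * wᵢⱼ i j)
        T₂≤ : T₂ ≤ κ * M * (N * N)
        T₂≤ = ℚ.≤-trans (ℚ.≤-reflexive (trans (sum²-cong λ i j → ℚ.*-comm (wᵢⱼ i j) (κ * M)) (sym (sum²-* (κ * M) wᵢⱼ))))
          (*-monoˡ (0≤* 0≤κ 0≤M) ∑∑w≤N²)
        T₃≤ : T₃ ≤ (Δ * M) * (D * (N * N))
        T₃≤ = ℚ.≤-reflexive (trans (sym (sum²-* (Δ * M) (λ i j → D * size i j)))
          (cong ((Δ * M) *_) (trans (sym (sum²-* D size)) (cong (D *_) ∑∑size≡N²))))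
        T₄≤ : T₄ ≤ (Δ * M) * (D * (N * N))
        T₄≤ = ℚ.≤-trans (ℚ.≤-reflexive (sym (sum²-* (Δ * M) (λ i j → δ i j * wᵢⱼ i j)))) (*-monoˡ (0≤* 0≤Δ 0≤M) ∑diagonal≤)

      opt≤opt-quotient : opt ⟦ G ⟧ C ≤ (b + D * b) + fromℕ 3 * (D * (M * (N * N)))
      opt≤opt-quotient = opt≤ ⟦ G ⟧ C
        (0≤+ (0≤+ 0≤b (0≤* 0≤D 0≤b)) (0≤* (0≤fromℕ 3) (0≤* 0≤D (0≤* 0≤M (0≤* 0≤N 0≤N))))) value≤

  module _ {n k l : ℕ} (G : Graph n) (P : Partition n k) (C : Structure l) where

    -- The lift of `g` is constant on classes, so all edges between two classes receive the same
    -- weight of C, and their number is the quotient weight.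
    value-quotient : ∀ g → value (G ⟋ P) C g ≡ value ⟦ G ⟧ C (g ∘ proj₁ ∘ covers P)
    value-quotient g = sym (begin
      value ⟦ G ⟧ C (g ∘ cl)
        ≡⟨ sum-blocks P (λ u v → A u v * e C (g (cl u)) (g (cl v))) ⟩
      sum (λ i → sum λ j → block (class P i) (class P j) λ u v → A u v * e C (g (cl u)) (g (cl v)))
        ≡⟨ sum²-cong (λ i j → sum²-cong (pointwise i j)) ⟩
      sum (λ i → sum λ j → block (class P i) (class P j) λ u v → e C (g i) (g j) * A u v)
        ≡⟨ sum²-cong (λ i j → trans (block-* (class P i) (class P j) (e C (g i) (g j)) A) (trans (ℚ.*-comm (e C (g i) (g j)) (block (class P i) (class P j) A))
             (cong (_* e C (g i) (g j)) (sym (w≡block (class P i) (class P j) ⟦ G ⟧))))) ⟩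
      value (G ⟋ P) C g ∎)
      where
      open ≡-Reasoning
      A = e ⟦ G ⟧
      cl : Fin n → Fin k
      cl = proj₁ ∘ covers P
      pointwise : ∀ i j u v → (χ (class P i) u * χ (class P j) v) * (A u v * e C (g (cl u)) (g (cl v))) ≡
        (χ (class P i) u * χ (class P j) v) * (e C (g i) (g j) * A u v)
      pointwise i j u v with i Fin.≟ cl u | j Fin.≟ cl v
      ... | yes refl | yes refl = cong ((χ (class P i) u * χ (class P j) v) *_) (ℚ.*-comm (A u v) (e C (g i) (g j)))
      ... | no i≢    | _        = trans (cong (λ t → (t * χ (class P j) v) * (A u v * e C (g (cl u)) (g (cl v)))) (χ-single P u i i≢))
        (trans (solve 3 (λ y p q → (con 0ℚ :* y) :* p := (con 0ℚ :* y) :* q) refl (χ (class P j) v) (A u v * e C (g (cl u)) (g (cl v))) (e C (g i) (g j) * A u v))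
          (cong (λ t → (t * χ (class P j) v) * (e C (g i) (g j) * A u v)) (sym (χ-single P u i i≢))))
      ... | yes _    | no j≢    = trans (cong (λ t → (χ (class P i) u * t) * (A u v * e C (g (cl u)) (g (cl v)))) (χ-single P v j j≢))
        (trans (solve 3 (λ y p q → (y :* con 0ℚ) :* p := (y :* con 0ℚ) :* q) refl (χ (class P i) u) (A u v * e C (g (cl u)) (g (cl v))) (e C (g i) (g j) * A u v))
          (cong (λ t → (χ (class P i) u * t) * (e C (g i) (g j) * A u v)) (sym (χ-single P v j j≢))))

    opt-quotient≤opt : opt (G ⟋ P) C ≤ opt ⟦ G ⟧ C
    opt-quotient≤opt = opt≤ (G ⟋ P) C (0≤opt ⟦ G ⟧ C) λ g →
      subst (_≤ opt ⟦ G ⟧ C) (sym (value-quotient g)) (value≤opt ⟦ G ⟧ C (g ∘ proj₁ ∘ covers P))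

-- Passing between real hypotheses and rational estimates.

module Reals where

  open Inequalities
  open Logarithm
  open import Data.Rational.Base using (_+_; _*_; _-_; -_; _≤_; _<_)
  open +-*-Solver using (solve; _:=_; _:+_; _:*_; _:-_; :-_; con)

  -- The witness is η/(1+y); the summand 1 covers the case y = 0.
  shrink : ∀ {η y} → 0ℚ < η → 0ℚ ≤ y → ∃[ δ ] (0ℚ < δ × δ * y ≤ η)
  shrink {η} {y} 0<η 0≤y = η * r , 0<* 0<η 0<r , ≤-by (η * r) (ℚ.<⇒≤ (0<* 0<η 0<r)) (begin
      η                       ≡⟨ ℚ.*-identityʳ η ⟨
      η * 1ℚ                  ≡⟨ cong (η *_) (ℚ.*-inverseˡ (1ℚ + y) {{ℚ.>-nonZero 0<1+y}}) ⟨
      η * (r * (1ℚ + y))      ≡⟨ solve 3 (λ η r y → η :* (r :* (con 1ℚ :+ y)) := η :* r :* y :+ η :* r) refl η r y ⟩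
      η * r * y + η * r       ∎)
    where
    open ≡-Reasoning
    0<1+y : 0ℚ < 1ℚ + y
    0<1+y = ℚ.+-mono-<-≤ (ℚ.positive⁻¹ 1ℚ) 0≤y
    r : ℚ
    r = ℚ.1/_ (1ℚ + y) {{ℚ.>-nonZero 0<1+y}}
    0<r : 0ℚ < r
    0<r = ℚ.positive⁻¹ r {{ℚ.1/pos⇒pos (1ℚ + y) {{ℚ.positive 0<1+y}}}}

  0<½* : ∀ {p} → 0ℚ < p → 0ℚ < ½ * p
  0<½* = 0<* (ℚ.positive⁻¹ ½)

  -- Makes homogeneity rational: the real ε is replaced by its rational upper bound `q`. Half of δ
  -- pays for the approximate first inequality, the other half for the approximate second one after
  -- scaling by `y`.
  ≤ᴿ-scale : ∀ {p q y} (ε : ℝ) → 0ℚ ≤ y → fromℚ p ≤ᴿ ε *ᴿ fromℚ y → ε ≤ᴿ fromℚ q → p ≤ q * y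
  ≤ᴿ-scale {p} {q} {y} ε 0≤y p≤εy ε≤q = ≤-archimedean λ δ 0<δ →
    let η , 0<η , ηy≤ = shrink {½ * δ} {y} (0<½* 0<δ) 0≤y
        N₁ , h₁ = p≤εy (½ * δ) (0<½* 0<δ)
        N₂ , h₂ = ε≤q η 0<η
        m = N₁ ℕ.⊔ N₂
    in begin
      p                                 ≤⟨ h₁ m (ℕ.m≤m⊔n N₁ N₂) ⟩
      seq ε m * y + ½ * δ               ≤⟨ ℚ.+-monoˡ-≤ (½ * δ) (*-monoʳ 0≤y (h₂ m (ℕ.m≤n⊔m N₁ N₂))) ⟩
      (q + η) * y + ½ * δ               ≡⟨ solve 4 (λ q η y d → (q :+ η) :* y :+ d := q :* y :+ (η :* y :+ d)) refl q η y (½ * δ) ⟩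
      q * y + (η * y + ½ * δ)           ≤⟨ ℚ.+-monoʳ-≤ (q * y) (ℚ.+-monoˡ-≤ (½ * δ) ηy≤) ⟩
      q * y + (½ * δ + ½ * δ)           ≡⟨ cong (q * y +_) (solve 1 (λ d → con ½ :* d :+ con ½ :* d := d) refl δ) ⟩
      q * y + δ                         ∎
    where open ℚ.≤-Reasoning

  module _ {D c : ℚ} (0<D : 0ℚ < D) (D≤1 : D ≤ 1ℚ) (ε₀ : ℝ) (0<ε₀ : 0ᴿ <ᴿ ε₀) (ε₀<1 : ε₀ <ᴿ 1ᴿ)
    (D≤ : fromℚ D ≤ᴿ fromℚ c *ᴿ (ε₀ /ᴿ (1ᴿ +ᴿ ε₀) [ 0<1+ ε₀ 0<ε₀ ])) where

    private
      N₀ : ℕ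
      N₀ = proj₁ (proj₂ (proj₂ 0<ε₀))

      0≤ε₀ : ∀ m → N₀ ℕ.≤ m → 0ℚ ≤ seq ε₀ m
      0≤ε₀ m N₀≤m = let η , 0<η , _ , h = 0<ε₀ in
        ℚ.≤-trans (ℚ.<⇒≤ 0<η) (subst (_≤ seq ε₀ m) (ℚ.+-identityˡ η) (h m N₀≤m))

      r : ℕ → ℚ
      r = seq (inv (1ᴿ +ᴿ ε₀) (0<1+ ε₀ 0<ε₀))

      y : ℕ → ℚ
      y m = 1ℚ + seq ε₀ (N₀ ℕ.+ m)

      r*y≡1 : ∀ m → r m * y m ≡ 1ℚ
      r*y≡1 m = ℚ.*-inverseˡ (y m) {{_}}

    -- Clears the denominator of ε₀/(1+ε₀). The sequence of `inv` starts at `N₀`, so its denominator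
    -- uses the index N₀ + m while the numerator uses m, and the Cauchy property bridges the gap.
    -- The budget is δ/4 times a denominator at most 2, by ε₀ < 1, plus δ/2 times D ≤ 1.
    D[1+ε₀]≤ : ∀ δ → 0ℚ < δ → ∃[ N ] (∀ m → N ℕ.≤ m → 0ℚ ≤ seq ε₀ m × D * (1ℚ + seq ε₀ m) ≤ c * seq ε₀ m + δ)
    D[1+ε₀]≤ δ 0<δ =
      let η , 0<η , N₁ , h₁ = ε₀<1
          N₂ , h₂ = D≤ (½ * (½ * δ)) (0<½* (0<½* 0<δ))
          N₃ , h₃ = cauchy ε₀ (½ * δ) (0<½* 0<δ)
          N = (N₀ ℕ.⊔ N₁) ℕ.⊔ (N₂ ℕ.⊔ N₃)
      in N , λ m N≤m →
        let N₀₁≤m = ℕ.m⊔n≤o⇒m≤o (N₀ ℕ.⊔ N₁) (N₂ ℕ.⊔ N₃) N≤m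
            N₂₃≤m = ℕ.m⊔n≤o⇒n≤o (N₀ ℕ.⊔ N₁) (N₂ ℕ.⊔ N₃) N≤m
            N₀≤m = ℕ.m⊔n≤o⇒m≤o N₀ N₁ N₀₁≤m
            N₁≤m = ℕ.m⊔n≤o⇒n≤o N₀ N₁ N₀₁≤m
            N₂≤m = ℕ.m⊔n≤o⇒m≤o N₂ N₃ N₂₃≤m
            N₃≤m = ℕ.m⊔n≤o⇒n≤o N₂ N₃ N₂₃≤m
            m≤N₀+m = ℕ.m≤n+m m N₀
            y≤2 : y m ≤ fromℕ 2
            y≤2 = ℚ.+-monoʳ-≤ 1ℚ (ℚ.≤-trans (≤-by {seq ε₀ (N₀ ℕ.+ m)} η (ℚ.<⇒≤ 0<η) refl) (h₁ (N₀ ℕ.+ m) (ℕ.≤-trans N₁≤m m≤N₀+m)))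
            0≤y : 0ℚ ≤ y m
            0≤y = 0≤+ 0≤1 (0≤ε₀ (N₀ ℕ.+ m) (ℕ.m≤m+n N₀ m))
        in 0≤ε₀ m N₀≤m , estimate m (h₂ m N₂≤m) 0≤y y≤2 (∣∣≤⇒≤ (h₃ m (N₀ ℕ.+ m) N₃≤m (ℕ.≤-trans N₃≤m m≤N₀+m)))
      where
      estimate : ∀ m → D ≤ c * (seq ε₀ m * r m) + ½ * (½ * δ) → 0ℚ ≤ y m → y m ≤ fromℕ 2 →
        seq ε₀ m - seq ε₀ (N₀ ℕ.+ m) ≤ ½ * δ → D * (1ℚ + seq ε₀ m) ≤ c * seq ε₀ m + δ
      estimate m h 0≤y y≤2 close = begin
        D * (1ℚ + s)
          ≡⟨ solve 3 (λ D s t → D :* (con 1ℚ :+ s) := D :* (con 1ℚ :+ t) :+ D :* (s :- t)) refl D s (seq ε₀ (N₀ ℕ.+ m)) ⟩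
        D * y m + D * (s - seq ε₀ (N₀ ℕ.+ m))
          ≤⟨ ℚ.+-mono-≤ (*-monoʳ 0≤y h) (ℚ.≤-trans (*-monoˡ (ℚ.<⇒≤ 0<D) close)
               (subst (_≤ ½ * δ) (ℚ.*-comm (½ * δ) D) (p*q≤p (ℚ.<⇒≤ (0<½* 0<δ)) D≤1))) ⟩
        (c * (s * r m) + q) * y m + ½ * δ
          ≡⟨ solve 6 (λ c s r q y d → (c :* (s :* r) :+ q) :* y :+ d := (c :* s) :* (r :* y) :+ (q :* y :+ d)) refl c s (r m) q (y m) (½ * δ) ⟩
        (c * s) * (r m * y m) + (q * y m + ½ * δ)
          ≤⟨ ℚ.+-mono-≤ (ℚ.≤-reflexive (trans (cong ((c * s) *_) (r*y≡1 m)) (ℚ.*-identityʳ (c * s))))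
               (ℚ.+-monoˡ-≤ (½ * δ) (*-monoˡ (ℚ.<⇒≤ (0<½* (0<½* 0<δ))) y≤2)) ⟩
        c * s + (q * fromℕ 2 + ½ * δ)
          ≡⟨ cong (c * s +_) (solve 1 (λ d → con ½ :* (con ½ :* d) :* con (fromℕ 2) :+ con ½ :* d := d) refl δ) ⟩
        c * s + δ ∎
        where
        open ℚ.≤-Reasoning
        s = seq ε₀ m
        q = ½ * (½ * δ)

    -- If c ≤ D, the cleared inequality with error D/2 would give D ≤ D/2. The strictness makes the
    -- relative loss D/c less than 1, so that `b` cannot vanish when `a` does not.
    D<c : D < c
    D<c = ℚ.≰⇒> λ c≤D →
      let N , h = D[1+ε₀]≤ (½ * D) (0<½* 0<D)
          0≤ε , h′ = h N ℕ.≤-refl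
          s = seq ε₀ N
          D≤½D : D ≤ ½ * D
          D≤½D = subst₂ _≤_ (solve 2 (λ D s → D :* (con 1ℚ :+ s) :- D :* s := D) refl D s)
            (solve 3 (λ D s h → D :* s :+ h :- D :* s := h) refl D s (½ * D))
            (ℚ.+-monoˡ-≤ (- (D * s)) (ℚ.≤-trans h′ (ℚ.+-monoˡ-≤ (½ * D) (*-monoʳ 0≤ε c≤D))))
      in ℚ.<-irrefl refl (ℚ.<-≤-trans (0<½* 0<D) (subst₂ _≤_
           (solve 1 (λ D → D :- con ½ :* D := con ½ :* D) refl D) (ℚ.+-inverseʳ (½ * D)) (ℚ.+-monoˡ-≤ (- (½ * D)) D≤½D)))

    module _ {a b : ℚ} (0≤b : 0ℚ ≤ b) (b≤a : b ≤ a) (loss : c * a ≤ c * b + D * a) where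

      0<b : 0ℚ < a → 0ℚ < b
      0<b 0<a = ℚ.≰⇒> λ b≤0 → ℚ.<-irrefl refl (ℚ.<-≤-trans (ℚ.*-monoˡ-<-pos a {{ℚ.positive 0<a}} D<c)
        (subst (c * a ≤_) (trans (cong (λ t → c * t + D * a) (ℚ.≤-antisym b≤0 0≤b)) (solve 2 (λ c x → c :* con 0ℚ :+ x := x) refl c (D * a))) loss))

      -- Writing s for a term of ε₀ and neglecting the error: c(a-b) ≤ D a and D(1+s) ≤ c s give
      -- (a-b)(1+s) ≤ s a, that is a-b ≤ s b, and the Lipschitz bound of the logarithm divides by
      -- `b`. The index depends on ε₀ only, since that bound holds for all partial sums.
      ln-close : (0<a : 0ℚ < a) (0<b : 0ℚ < b) → ∣ lnPos a 0<a -ᴿ lnPos b 0<b ∣ᴿ ≤ᴿ ε₀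
      ln-close 0<a 0<b δ 0<δ =
        -- The error η enters multiplied by `a`, and the final inequality is divided by c b; this
        -- choice makes it contribute at most δ.
        let η , 0<η , ηa≤ = shrink {(c * b) * δ} {a} (0<* 0<cb 0<δ) (ℚ.<⇒≤ 0<a)
            N , h = D[1+ε₀]≤ η 0<η
        in N , λ m N≤m → *-cancelˡ 0<cb (estimate m η ηa≤ (proj₁ (h m N≤m)) (proj₂ (h m N≤m)))
        where
        0<cb : 0ℚ < c * b
        0<cb = 0<* (ℚ.<-trans 0<D D<c) 0<b
        estimate : ∀ m η → η * a ≤ (c * b) * δ → 0ℚ ≤ seq ε₀ m → D * (1ℚ + seq ε₀ m) ≤ c * seq ε₀ m + η →
          (c * b) * seq ∣ lnPos a 0<a -ᴿ lnPos b 0<b ∣ᴿ m ≤ (c * b) * (seq ε₀ m + δ)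
        estimate m η ηa≤ 0≤s h = begin
          (c * b) * T
            ≡⟨ solve 3 (λ c b t → (c :* b) :* t := c :* (t :* b)) refl c b T ⟩
          c * (T * b)
            ≤⟨ *-monoˡ (ℚ.<⇒≤ (ℚ.<-trans 0<D D<c)) (ln-lipschitz 0<a 0<b b≤a m) ⟩
          c * (a - b)
            ≡⟨ solve 4 (λ c a b s → c :* (a :- b) := (c :* a) :* (con 1ℚ :+ s) :+ :- (c :* b :+ c :* a :* s)) refl c a b s ⟩
          (c * a) * (1ℚ + s) + - (c * b + c * a * s)
            ≤⟨ ℚ.+-monoˡ-≤ (- (c * b + c * a * s)) (*-monoʳ (0≤+ 0≤1 0≤s) loss) ⟩
          (c * b + D * a) * (1ℚ + s) + - (c * b + c * a * s)
            ≡⟨ solve 5 (λ c a b s D → (c :* b :+ D :* a) :* (con 1ℚ :+ s) :+ :- (c :* b :+ c :* a :* s) := a :* (D :* (con 1ℚ :+ s)) :+ (c :* b :* s :- c :* a :* s)) refl c a b s D ⟩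
          a * (D * (1ℚ + s)) + (c * b * s - c * a * s)
            ≤⟨ ℚ.+-monoˡ-≤ (c * b * s - c * a * s) (*-monoˡ (ℚ.<⇒≤ 0<a) h) ⟩
          a * (c * s + η) + (c * b * s - c * a * s)
            ≡⟨ solve 5 (λ c a b s η → a :* (c :* s :+ η) :+ (c :* b :* s :- c :* a :* s) := η :* a :+ c :* b :* s) refl c a b s η ⟩
          η * a + c * b * s
            ≤⟨ ℚ.+-monoˡ-≤ (c * b * s) ηa≤ ⟩
          (c * b) * δ + c * b * s
            ≡⟨ solve 3 (λ x d s → x :* d :+ x :* s := x :* (s :+ d)) refl (c * b) δ s ⟩
          (c * b) * (s + δ) ∎
          where
          open ℚ.≤-Reasoning
          s = seq ε₀ m
          T = ℚ.∣ seq (lnPos a 0<a) m - seq (lnPos b 0<b) m ∣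

      ln-distance : ∣ ln a - ln b ∣ ≤∞ ε₀
      ln-distance with 0ℚ ℚ.<? a | 0ℚ ℚ.<? b
      ... | yes 0<a | yes 0<b = ln-close 0<a 0<b
      ... | yes 0<a | no  b≯0 = contradiction (0<b 0<a) b≯0
      ... | no  a≯0 | yes 0<b = contradiction (ℚ.<-≤-trans 0<b b≤a) a≯0
      ... | no  _   | no  _   = λ δ 0<δ → N₀ , λ m N₀≤m → 0≤+ (0≤ε₀ m N₀≤m) (ℚ.<⇒≤ 0<δ)

-- The loss in the optimum for an equitable regular partition.

module RegularPartition where

  open import Data.Fin.Subset using (∣_∣)
  open Inequalities
  open Logarithm
  open Optimum
  open Quotient
  open Reals
  open import Data.Rational.Base using (_+_; _*_; _≤_; _<_)
  open +-*-Solver using (solve; _:=_; _:+_; _:*_; con)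

  equitable-size : ∀ {n k m} .{{_ : NonZero k}} → m ≡ ⌊ n / k ⌋ ⊎ m ≡ ⌈ n / k ⌉ → fromℕ m ≤ 1ℚ + (ℤ.+ 1 / k) * fromℕ n
  equitable-size {n} {k} {m} h = begin
    fromℕ m                              ≡⟨ trans (sym (ℚ.*-identityʳ (fromℕ m))) (cong (fromℕ m *_) (sym (fromℕ-/ 1 k))) ⟩
    fromℕ m * (D * fromℕ k)              ≡⟨ solve 3 (λ m D k → m :* (D :* k) := D :* (m :* k)) refl (fromℕ m) D (fromℕ k) ⟩
    D * (fromℕ m * fromℕ k)              ≡⟨ cong (D *_) (fromℕ-* m k) ⟨
    D * fromℕ (m ℕ.* k)                  ≤⟨ *-monoˡ (ℚ.<⇒≤ (0<1/k k)) (fromℕ-mono (mk≤n+k h)) ⟩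
    D * fromℕ (n ℕ.+ k)                  ≡⟨ trans (cong (D *_) (fromℕ-+ n k)) (solve 3 (λ D n k → D :* (n :+ k) := D :* k :+ D :* n) refl D (fromℕ n) (fromℕ k)) ⟩
    D * fromℕ k + D * fromℕ n            ≡⟨ cong (_+ D * fromℕ n) (fromℕ-/ 1 k) ⟩
    1ℚ + D * fromℕ n                     ∎
    where
    open ℚ.≤-Reasoning
    D = ℤ.+ 1 / k
    mk≤n+k : m ≡ ⌊ n / k ⌋ ⊎ m ≡ ⌈ n / k ⌉ → m ℕ.* k ℕ.≤ n ℕ.+ k
    mk≤n+k (inj₁ refl) = ℕ.≤-trans (ℕ.m/n*n≤m n k) (ℕ.m≤m+n n k)
    mk≤n+k (inj₂ refl) = ℕ.≤-trans (ℕ.m/n*n≤m (n ℕ.+ (k ℕ.∸ 1)) k) (ℕ.+-monoʳ-≤ n (ℕ.m∸n≤m k 1))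

  module _ {n : ℕ} .{{_ : NonZero n}} (G : Graph n) where

    density-* : density G * (fromℕ n * fromℕ n) ≡ fromℕ ∣E G ∣
    density-* = trans (cong (density G *_) (sym (fromℕ-* n n))) (fromℕ-/ ∣E G ∣ (n ℕ.* n) {{ℕ.m*n≢0 n n}})

    0≤density : 0ℚ ≤ density G
    0≤density = ℚ.nonNegative⁻¹ (density G) {{ℚ.normalize-nonNeg ∣E G ∣ (n ℕ.* n) {{ℕ.m*n≢0 n n}}}}

    density≤1 : density G ≤ 1ℚ
    density≤1 = *-cancelˡ {r = fromℕ n * fromℕ n} (0<* 0<n 0<n) (begin
      (fromℕ n * fromℕ n) * density G      ≡⟨ trans (ℚ.*-comm (fromℕ n * fromℕ n) (density G)) density-* ⟩
      fromℕ ∣E G ∣                         ≤⟨ ≤-by (fromℕ ∣E G ∣) (0≤fromℕ ∣E G ∣) (solve 1 (λ t → con (fromℕ 2) :* t := t :+ t) refl (fromℕ ∣E G ∣)) ⟩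
      fromℕ 2 * fromℕ ∣E G ∣               ≤⟨ ℚ.≤-trans (2∣E∣≤arcs G) (arcs≤n² G) ⟩
      fromℕ n * fromℕ n                    ≡⟨ ℚ.*-identityʳ (fromℕ n * fromℕ n) ⟨
      (fromℕ n * fromℕ n) * 1ℚ             ∎)
      where
      open ℚ.≤-Reasoning
      0<n : 0ℚ < fromℕ n
      0<n = 0<fromℕ (ℕ.≢-nonZero⁻¹ n)

  module _ {n k : ℕ} .{{_ : NonZero n}} .{{_ : NonZero k}} (G : Graph n) (P : Partition n k) (ε : ℝ) (reg : Regular ε G P)
    (ε≤ : ε ≤ᴿ fromℚ ((ℤ.+ 1 / k) ^ (8 ℕ.* (k ℕ.* k)))) where

    private
      D : ℚ
      D = ℤ.+ 1 / k

    -- With c the density, c b ≤ a by c ≤ 1 and b ≤ a, and c n² M = |E| M ≤ 2a. Hence the density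
    -- times the error is at most D(a + 3·2a) = 7 D a, which fits below the 10 D a allowed by the
    -- factor 1/10.
    opt-loss : ∀ {l} (C : Structure l) → let a = opt ⟦ G ⟧ C ; b = opt (G ⟋ P) C ; c = density G * (ℤ.+ 1 / 10) in
      c * a ≤ c * b + D * a
    opt-loss C = begin
      c * t * a
        ≤⟨ *-monoˡ (0≤* (0≤density G) 0≤t) (RegularQuotient.opt≤opt-quotient x₀ G P (0<1/k k) (1/k≤1 k)
             (^-0≤ (ℚ.<⇒≤ (0<1/k k)) (8 ℕ.* (k ℕ.* k))) (1/k^8k² k) (λ i → equitable-size (Regular.equitable reg i))
             (λ i j i≢j U V U⊆ V⊆ → ≤ᴿ-scale {q = D ^ (8 ℕ.* (k ℕ.* k))} ε (0≤fromℕ (∣ class P i ∣ ℕ.* ∣ class P j ∣)) (Regular.homogeneous reg i j i≢j U V U⊆ V⊆) ε≤)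
             C 0≤M e≤M) ⟩
      c * t * ((b + D * b) + fromℕ 3 * (D * (M * (N * N))))
        ≡⟨ solve 6 (λ c t b D M N² → c :* t :* ((b :+ D :* b) :+ con (fromℕ 3) :* (D :* (M :* N²))) := c :* t :* b :+ (t :* D) :* (c :* b :+ con (fromℕ 3) :* ((c :* N²) :* M))) refl c t b D M (N * N) ⟩
      c * t * b + (t * D) * (c * b + fromℕ 3 * ((c * (N * N)) * M))
        ≤⟨ ℚ.+-monoʳ-≤ (c * t * b) (*-monoˡ (0≤* 0≤t (ℚ.<⇒≤ (0<1/k k))) (ℚ.+-mono-≤ cb≤a (*-monoˡ (0≤fromℕ 3) cM≤2a))) ⟩
      c * t * b + (t * D) * (a + fromℕ 3 * (fromℕ 2 * a))
        ≤⟨ ≤-by (fromℕ 3 * (t * (D * a))) (0≤* (0≤fromℕ 3) (0≤* 0≤t (0≤* (ℚ.<⇒≤ (0<1/k k)) 0≤a)))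
             (solve 3 (λ x D a → x :+ D :* a := x :+ (con t :* D) :* (a :+ con (fromℕ 3) :* (con (fromℕ 2) :* a)) :+ con (fromℕ 3) :* (con t :* (D :* a))) refl (c * t * b) D a) ⟩
      c * t * b + D * a ∎
      where
      open ℚ.≤-Reasoning
      open WeightBound (weightBound G C)
      a = opt ⟦ G ⟧ C
      b = opt (G ⟋ P) C
      c = density G
      t = ℤ.+ 1 / 10
      N = fromℕ n
      x₀ : Fin n
      x₀ = Fin.fromℕ< (ℕ.>-nonZero⁻¹ n)
      0≤t : 0ℚ ≤ t
      0≤t = ℚ.nonNegative⁻¹ t
      0≤a : 0ℚ ≤ a
      0≤a = 0≤opt ⟦ G ⟧ C
      cb≤a : c * b ≤ a
      cb≤a = subst (c * b ≤_) (ℚ.*-identityˡ a) (*-mono (0≤density G) 0≤a (density≤1 G) (opt-quotient≤opt G P C))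
      cM≤2a : (c * (N * N)) * M ≤ fromℕ 2 * a
      cM≤2a = subst (λ s → s * M ≤ fromℕ 2 * a) (sym (density-* G)) M≤opt

open import Data.Integer.Base using (+_)
open import Data.Nat.Base using (_*_)
open Optimum using (0≤opt)
open Quotient using (0<1/k; 1/k≤1; opt-quotient≤opt)
open Reals using (ln-distance)
open RegularPartition using (opt-loss)

theorem36 : ∀ {n k : ℕ} .{{_ : NonZero n}} .{{_ : NonZero k}} (G : Graph n)
    (ε₀ : ℝ) (0<ε₀ : 0ᴿ <ᴿ ε₀) → ε₀ <ᴿ 1ᴿ →
    (ε : ℝ) (P : Partition n k) → Regular ε G P →
    fromℚ (+ 1 / k) ≤ᴿ fromℚ (density G ℚ.* (+ 1 / 10)) *ᴿ (ε₀ /ᴿ (1ᴿ +ᴿ ε₀) [ 0<1+ ε₀ 0<ε₀ ]) →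
    ε ≤ᴿ fromℚ ((+ 1 / k) ^ (8 * (k * k))) →
    dopt[ ⟦ G ⟧ , G ⟋ P ]≤ ε₀
theorem36 {k = k} G ε₀ 0<ε₀ ε₀<1 ε P reg 1/k≤ ε≤ C =
  -- The constant 10 is absorbed here: the `c` of the logarithmic estimate is a tenth of the
  -- density.
  ln-distance {+ 1 / k} {density G ℚ.* (+ 1 / 10)} (0<1/k k) (1/k≤1 k) ε₀ 0<ε₀ ε₀<1 1/k≤
    (0≤opt (G ⟋ P) C) (opt-quotient≤opt G P C) (opt-loss G P ε reg ε≤ C)
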